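{- Let $K$ be a field of characteristic $0$, $F(t)=\sum_{n\ge0}a_nt^n\in K[[t]]$ with $a_0=1$, write $\log F(t)=\sum_{n\ge1}b_n\frac{t^n}{n}$, and define $R_n$ by $\sum_{n\ge0}R_nt^n=\prod_{i\ge1}F(x_it)$. Then: (a) $[s_n]R_n=a_n$ for all $n$, i.e. $\sum_{n\ge0}[s_n]R_nt^n=F(t)$. Moreover, for any homogeneous symmetric function $f$ of degree $n$, $[s_n]f$ equals the sum of the coefficients in the $h$-expansion of $f$. (b) $\sum_{n\ge0}[s_{1^n}]R_nt^n=\frac{1}{F(-t)}$. (c) For fixed $k\ge1$, $\sum_{n\ge0}[h_k^n]R_{kn}\,t^n=\exp\left(-\sum_{i\ge1}b_{ki}\frac{(-t)^i}{i}\right)$, i.e. $1/F(-t)$ with each $b_i$ replaced by $b_{ki}$. In particular $[h_n]R_n=b_n$. (d) If $i,j\ge1$ and $i+j=n$, then $[h_ih_j]R_n=b_ib_j-b_n$ if $i\ne j$, and $[h_ih_j]R_n=\frac12(b_i^2-b_n)$ if $i=j$. (e) For $k\ge 0$, $\sum_{n\ge0}R_n(1^k)t^n=F(t)^k$, where $R_n(1^k)$ denotes $R_n$ evaluated at $x_1=\cdots=x_k=1$, $x_{k+1}=x_{k+2}=\cdots=0$. (f) Let $u$ be an indeterminate and write $\frac{F(t)}{F(-ut)}=\sum_{n\ge0}P_n(u)t^n$. Then for $n\ge1$, $P_n(u)$ is a polynomial in $u$ of degree at most $n$ divisible by $1+u$, and $$\frac{P_n(u)}{1+u}=\sum_{k=0}^{n-1}\left([s_{(n-k,1^k)}]R_n\right)u^k,$$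 where $(n-k,1^k)$ denotes the hook partition with one part $n-k$ and $k$ parts equal to $1$.
   Context: For a basis $\{b_\lambda\}$ of symmetric functions, $[b_\lambda]f$ is the coefficient of $b_\lambda$ in the expansion of $f$. $s_\lambda$ are Schur functions, $h_\lambda$ complete homogeneous symmetric functions; $h_k^n$ means $h_{(k,k,\dots,k)}$ with $n$ parts, $s_n=s_{(n)}$, $s_{1^n}=s_{(1,\dots,1)}$. -}

module Defs where

open import Level using (Level) renaming (_⊔_ to _⊔ˡ_)
open import Algebra.Bundles using (CommutativeRing)
open import Data.Nat as ℕ using (ℕ; zero; suc; _∸_; _<ᵇ_; _≤ᵇ_; _≡ᵇ_; _≤_; _<_)
open import Data.Bool using (Bool; true; false; _∧_; not; if_then_else_)
open import Data.List using (List; []; _∷_; map; concat; concatMap; applyUpTo; upTo; replicate; length; foldr; zipWith)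
open import Data.List.Membership.Propositional using (_∈_)
open import Data.Product using (Σ; ∃; _×_; _,_)
open import Relation.Nullary using (¬_)
open import Relation.Binary.PropositionalEquality using (_≡_; _≢_)

allB : {A : Set} → (A → Bool) → List A → Bool
allB p []       = true
allB p (x ∷ xs) = p x ∧ allB p xs

filterB : {A : Set} → (A → Bool) → List A → List A
filterB p []       = []
filterB p (x ∷ xs) = if p x then x ∷ filterB p xs else filterB p xs

countB : {A : Set} → (A → Bool) → List A → ℕ
countB p xs = length (filterB p xs)

sumℕ : List ℕ → ℕ
sumℕ = foldr ℕ._+_ 0

-- pars fuel n m : all partitions of n (as weakly decreasing lists of
-- positive integers) with all parts ≤ m.  fuel ≥ n suffices.
pars : ℕ → ℕ → ℕ → List (List ℕ)
pars _       zero    m = [] ∷ []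
pars zero    (suc n) m = []
pars (suc f) (suc n) m =
  concatMap (λ j → map (j ∷_) (pars f (suc n ∸ j) j)) (applyUpTo suc (m ℕ.⊓ suc n))

Partitions : ℕ → List (List ℕ)
Partitions n = pars n n n

comps : ℕ → ℕ → List (List ℕ)
comps zero    zero    = [] ∷ []
comps (suc n) zero    = []
comps n       (suc k) = concatMap (λ j → map (j ∷_) (comps (n ∸ j) k)) (upTo (suc n))

insertD : ℕ → List ℕ → List ℕ
insertD x []       = x ∷ []
insertD x (y ∷ ys) = if y ≤ᵇ x then x ∷ y ∷ ys else y ∷ insertD x ys

sortD : List ℕ → List ℕ
sortD = foldr insertD []

toPartition : List ℕ → List ℕ
toPartition α = sortD (filterB (λ x → not (x ≡ᵇ 0)) α)

rowP : ℕ → List ℕ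
rowP zero    = []
rowP (suc n) = suc n ∷ []

hook : ℕ → ℕ → List ℕ
hook n k = (n ∸ k) ∷ replicate k 1

-- Kostka numbers: number of semistandard Young tableaux of shape λ and
-- content μ.  A filling of shape λ is a list of rows (row r has length λ_r),
-- with entries in {1,…,ℓ(μ)}.

rowsOf : ℕ → ℕ → List (List ℕ)
rowsOf ℓ zero    = [] ∷ []
rowsOf ℓ (suc r) = concatMap (λ e → map (e ∷_) (rowsOf ℓ r)) (applyUpTo suc ℓ)

fillings : ℕ → List ℕ → List (List (List ℕ))
fillings ℓ []      = [] ∷ []
fillings ℓ (r ∷ λ') = concatMap (λ R → map (R ∷_) (fillings ℓ λ')) (rowsOf ℓ r)

weakInc : List ℕ → Bool
weakInc (x ∷ y ∷ ys) = (x ≤ᵇ y) ∧ weakInc (y ∷ ys)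
weakInc _            = true

colLt : List ℕ → List ℕ → Bool
colLt (x ∷ xs) (y ∷ ys) = (x <ᵇ y) ∧ colLt xs ys
colLt _        _        = true

colsOK : List (List ℕ) → Bool
colsOK (R ∷ R' ∷ Rs) = colLt R R' ∧ colsOK (R' ∷ Rs)
colsOK _             = true

contentFrom : ℕ → List ℕ → List ℕ → Bool
contentFrom i entries []      = true
contentFrom i entries (m ∷ μ) = (countB (i ≡ᵇ_) entries ≡ᵇ m) ∧ contentFrom (suc i) entries μ

isSSYT : List ℕ → List (List ℕ) → Bool
isSSYT μ T = allB weakInc T ∧ colsOK T ∧ contentFrom 1 (concat T) μ

kostka : List ℕ → List ℕ → ℕ
kostka λ' μ = countB (isSSYT μ) (fillings (length μ) λ')

-- Coefficient of x^μ in h_λ = h_{λ_1} h_{λ_2} ⋯ : number of tuples of weak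
-- compositions α¹,α²,… (each of length ℓ(μ)) with |αⁱ| = λ_i and Σ αⁱ = μ.

leqB : List ℕ → List ℕ → Bool
leqB (x ∷ xs) (y ∷ ys) = (x ≤ᵇ y) ∧ leqB xs ys
leqB _        _        = true

hCoeff : List ℕ → List ℕ → ℕ
hCoeff []       μ = if allB (_≡ᵇ 0) μ then 1 else 0
hCoeff (m ∷ λ') μ =
  sumℕ (map (λ α → if leqB α μ then hCoeff λ' (zipWith _∸_ μ α) else 0) (comps m (length μ)))

module _ {c ℓ : Level} (K : CommutativeRing c ℓ) where
  open CommutativeRing K hiding (zero)

  record IsField : Set (c ⊔ˡ ℓ) where
    field
      0≉1   : ¬ (0# ≈ 1#)
      inv   : (x : Carrier) → ¬ (x ≈ 0#) → Carrier
      inv-l : ∀ x (p : ¬ (x ≈ 0#)) → inv x p * x ≈ 1#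

  natK : ℕ → Carrier
  natK zero    = 0#
  natK (suc n) = 1# + natK n

  CharZero : Set ℓ
  CharZero = ∀ n → ¬ (natK (suc n) ≈ 0#)

  sgnK : ℕ → Carrier
  sgnK zero    = 1#
  sgnK (suc n) = - sgnK n

  Σl : {A : Set} → List A → (A → Carrier) → Carrier
  Σl xs g = foldr (λ x acc → g x + acc) 0# xs

  Σ< : ℕ → (ℕ → Carrier) → Carrier
  Σ< n g = Σl (upTo n) g

  Πl : List ℕ → (ℕ → Carrier) → Carrier
  Πl xs g = foldr (λ x acc → g x * acc) 1# xs

  Series : Set c
  Series = ℕ → Carrier

  oneS : Series
  oneS zero    = 1#
  oneS (suc n) = 0#

  _⋆_ : Series → Series → Series
  (f ⋆ g) n = Σ< (suc n) (λ i → f i * g (n ∸ i))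

  powS : Series → ℕ → Series
  powS f zero    = oneS
  powS f (suc m) = f ⋆ powS f m

  negT : Series → Series
  negT f n = sgnK n * f n

  -- homogeneous symmetric functions of degree n, stored by their
  -- coefficients in the monomial basis: f λ = [m_λ] f for λ ⊢ n
  -- (values at non-partitions of n are irrelevant)

  Sym : Set c
  Sym = List ℕ → Carrier

  -- a family of symmetric functions b_λ, given in the monomial basis:
  -- b λ μ = [m_μ] b_λ
  Family : Set c
  Family = List ℕ → Sym

  schurF : Family
  schurF λ' μ = natK (kostka λ' μ)

  hF : Family
  hF λ' μ = natK (hCoeff λ' μ)

  IsExpansion : ℕ → Family → Sym → (List ℕ → Carrier) → Set ℓ
  IsExpansion n b f cf =
    ∀ μ → μ ∈ Partitions n → f μ ≈ Σl (Partitions n) (λ λ' → cf λ' * b λ' μ)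

  CoeffIs : ℕ → Family → Sym → List ℕ → Carrier → Set (c ⊔ˡ ℓ)
  CoeffIs n b f λ' v =
    (∃ λ cf → IsExpansion n b f cf) × (∀ cf → IsExpansion n b f cf → cf λ' ≈ v)

  -- R_n : coefficient of t^n in Π_i F(x_i t); its coefficient of m_λ is
  -- Π_j a_{λ_j}  (using a_0 = 1)
  Rsym : Series → ℕ → Sym
  Rsym F n λ' = Πl λ' F

  -- f(1^k) : sum of the coefficients of the monomials x^α in x_1,…,x_k of degree n
  eval1 : ℕ → ℕ → Sym → Carrier
  eval1 k n f = Σl (comps n k) (λ α → f (toPartition α))

  -- power series in two variables t,u : P n j = [t^n u^j] P

  Series2 : Set c
  Series2 = ℕ → ℕ → Carrier

  _⋆₂_ : Series2 → Series2 → Series2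
  (A ⋆₂ B) n j = Σ< (suc n) (λ i → Σ< (suc j) (λ l → A i l * B (n ∸ i) (j ∸ l)))

  inT : Series → Series2
  inT F n zero    = F n
  inT F n (suc j) = 0#

  negUT : Series → Series2
  negUT F n j = if n ≡ᵇ j then sgnK n * F n else 0#

  onePlusU : (ℕ → Carrier) → ℕ → Carrier
  onePlusU q zero    = q zero
  onePlusU q (suc j) = q (suc j) + q j

  module _ (fld : IsField) (ch0 : CharZero) where
    open IsField fld

    invS : ℕ → Carrier
    invS n = inv (natK (suc n)) (ch0 n)

    invFact : ℕ → Carrier
    invFact m = Πl (upTo m) invS

    -- F - 1  (for F with F_0 = 1)
    minus1 : Series → Series
    minus1 F zero    = 0#
    minus1 F (suc n) = F (suc n)

    logS : Series → Series
    logS F n = Σ< n (λ i → sgnK i * invS i * powS (minus1 F) (suc i) n)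

    -- b_n, where log F = Σ_{n≥1} b_n t^n / n
    bCoef : Series → ℕ → Carrier
    bCoef F n = natK n * logS F n

    -- exp H = Σ_{m ≥ 0} H^m / m!   (for H with H_0 = 0; coefficient of t^n)
    expS : Series → Series
    expS H n = Σ< (suc n) (λ m → invFact m * powS H m n)

    Hk : Series → ℕ → Series
    Hk F k zero    = 0#
    Hk F k (suc i) = - (bCoef F (k ℕ.* suc i) * sgnK (suc i) * invS i)

    PartA : Series → Set (c ⊔ˡ ℓ)
    PartA F =
      (∀ n → CoeffIs n schurF (Rsym F n) (rowP n) (F n))
      × (∀ n (f : Sym) →
           (∃ λ cs → IsExpansion n schurF f cs)
           × (∃ λ ch → IsExpansion n hF f ch)
           × (∀ cs ch → IsExpansion n schurF f cs → IsExpansion n hF f ch →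
                cs (rowP n) ≈ Σl (Partitions n) ch))

    PartB : Series → Set (c ⊔ˡ ℓ)
    PartB F =
      (∀ n → ∃ λ cs → IsExpansion n schurF (Rsym F n) cs)
      × (∀ (cs : ℕ → List ℕ → Carrier) →
           (∀ n → IsExpansion n schurF (Rsym F n) (cs n)) →
           ∀ n → ((λ m → cs m (replicate m 1)) ⋆ negT F) n ≈ oneS n)

    PartC : Series → Set (c ⊔ˡ ℓ)
    PartC F =
      (∀ k → 1 ≤ k → ∀ n →
         CoeffIs (k ℕ.* n) hF (Rsym F (k ℕ.* n)) (replicate n k) (expS (Hk F k) n))
      × (∀ n → 1 ≤ n → CoeffIs n hF (Rsym F n) (n ∷ []) (bCoef F n))

    PartD : Series → Set (c ⊔ˡ ℓ)
    PartD F =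
      ∀ i j → 1 ≤ i → 1 ≤ j →
        (i ≢ j → CoeffIs (i ℕ.+ j) hF (Rsym F (i ℕ.+ j)) ((i ℕ.⊔ j) ∷ (i ℕ.⊓ j) ∷ [])
                   (bCoef F i * bCoef F j - bCoef F (i ℕ.+ j)))
        × (i ≡ j → CoeffIs (i ℕ.+ j) hF (Rsym F (i ℕ.+ j)) (i ∷ i ∷ [])
                   (invS 1 * (bCoef F i * bCoef F i - bCoef F (i ℕ.+ j))))

    PartE : Series → Set ℓ
    PartE F = ∀ k n → eval1 k n (Rsym F n) ≈ powS F k n

    -- P = F(t)/F(-ut), characterised by F(-ut) · P = F(t) in K[[t,u]]
    IsQuotient : Series → Series2 → Set ℓ
    IsQuotient F P = ∀ n j → (negUT F ⋆₂ P) n j ≈ inT F n j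

    hookPoly : ℕ → (List ℕ → Carrier) → ℕ → Carrier
    hookPoly n cs k = if k <ᵇ n then cs (hook n k) else 0#

    PartF : Series → Set (c ⊔ˡ ℓ)
    PartF F =
      (∃ λ P → IsQuotient F P)
      × (∀ P → IsQuotient F P → ∀ n → 1 ≤ n →
           (∀ j → n < j → P n j ≈ 0#)
           × (∃ λ cs → IsExpansion n schurF (Rsym F n) cs)
           × (∀ cs → IsExpansion n schurF (Rsym F n) cs →
                ∀ j → P n j ≈ onePlusU (hookPoly n cs) j))

{-# OPTIONS --safe #-}

-- The coefficients of R = Σ R_n in the monomial basis are multiplicative: [m_λ] R = Π F_{λ_i}.
--
-- The matrix [m_μ] h_λ is symmetric, so if m_λ = Σ_κ w_κ h_κ then [h_λ] R = Σ_κ w_κ [m_κ] R, which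
-- is the value at m_λ of the ring homomorphism φ with φ(h_i) = F_i.  Newton's identities
-- m h_m = Σ p_i h_{m-i} and m F_m = Σ b_i F_{m-i} give φ(p_i) = b_i.  Multiplying by power sums
-- builds every augmented monomial function, hence the h-basis, and e_n(x₁ᵏ, x₂ᵏ, …) = m_{(k^n)}, whose
-- Newton identity is the recursion defining the exponential in (c).
--
-- A semistandard tableau is a chain of horizontal strips.  Two consecutive strips may exchange their
-- sizes (Bender–Knuth), so Kostka numbers are symmetric in the content.  They are also unitriangular for
-- the lexicographic order, hence the Schur basis.  By the Pieri rule
-- h_a e_k = s_{(a,1^k)} + s_{(a+1,1^{k-1})}, the signed sum of the [m_α] that expands the hook determinant
-- is [s_{(a,1^k)}].  On R this becomes F_a E_k = [s_{(a,1^k)}] R + [s_{(a+1,1^{k-1})}] R with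
-- E_k = [s_{1^k}] R, whose alternating sums telescope to E(t) F(-t) = 1 and which is (f) read
-- coefficientwise in F(t) E(ut).
module Submission where

open import Defs
open import Level using (Level) renaming (_⊔_ to _⊔ˡ_)
open import Algebra.Bundles using (CommutativeRing; CommutativeSemiring)
open import Data.Bool using (Bool; true; false; _∧_; if_then_else_; not; T)
open import Data.Bool.Properties using (∧-assoc; ∧-comm; ∧-identityʳ)
open import Data.Empty using (⊥-elim)
open import Data.List using (List; []; _∷_; _++_; map; concat; concatMap; applyUpTo; upTo; foldr; zipWith; length; replicate; reverse)
open import Data.List.Membership.Propositional using (_∈_)
open import Data.List.Membership.Propositional.Properties using (∈-map⁺; ∈-concatMap⁺; ∈-applyUpTo⁺; ∈-upTo⁺)
open import Data.List.Properties using (unfold-reverse; length-reverse; reverse-involutive) renaming (≡-dec to List-≡-dec)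
open import Data.List.Relation.Binary.Permutation.Propositional as Perm using (_↭_; ↭-sym; ↭-trans)
import Data.List.Relation.Binary.Permutation.Propositional.Properties as Perm
open import Data.List.Relation.Binary.Pointwise using (Pointwise; []; _∷_)
open import Data.List.Relation.Unary.All as All using (All; []; _∷_)
import Data.List.Relation.Unary.All.Properties as All
open import Data.List.Relation.Unary.AllPairs as AllPairs using (AllPairs; []; _∷_)
import Data.List.Relation.Unary.AllPairs.Properties as AllPairs
open import Data.List.Relation.Unary.Any as Any using (here; there)
open import Data.Nat as ℕ using (ℕ; zero; suc; _∸_; _≤_; _<_; z≤n; s≤s; _<ᵇ_; _≤ᵇ_; _≡ᵇ_; _⊔_; _⊓_)
import Data.Nat.Properties as ℕ
open import Data.Product using (_×_; _,_; proj₁; proj₂; uncurry; ∃)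
open import Data.Sum using (_⊎_; inj₁; inj₂)
open import Data.Unit using (tt)
open import Function using (_∘_; id)
open import Relation.Binary using (DecidableEquality)
open import Relation.Binary.Definitions using (tri<; tri≈; tri>)
open import Relation.Binary.PropositionalEquality as ≡ using (_≡_; _≢_; cong; cong₂; subst)
open import Relation.Nullary using (yes; no; does)
open import Relation.Nullary.Decidable using (dec-true; dec-false)

-- A coefficient is determined for every expansion at once: each argument exhibits a functional of
-- the monomial coefficients that returns the wanted coefficient of whatever expansion is given. On
-- hooks in the Schur basis this functional is `hookPart`; in the h-basis it is the pairing with an
-- explicit h-combination equal to m_λ. `HPoly` attaches the value under φ to a chosen
-- h-combination, so φ acts on formal combinations and the pairing makes the value independent of
-- the choice. Symmetric functions are treated as coefficient functions on all compositions, zero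
-- entries included. Multiplication by h_m or by p_i then is summation over `hs μ m` or
-- `lowered i μ`, which recurse along the list of exponents; sorting occurs only where `Partitions`
-- enters. The counting identities for tableaux and augmented monomials hold between natural
-- numbers; subtraction and division enter after `natK`.

All-concatMap : ∀ {a b p} {A : Set a} {B : Set b} {P : B → Set p} (f : A → List B) {xs : List A} →
                All (λ x → All P (f x)) xs → All P (concatMap f xs)
All-concatMap f {[]}     []         = []
All-concatMap f {x ∷ xs} (px ∷ pxs) = All.++⁺ px (All-concatMap f pxs)

All-upTo : ∀ n → All (_< n) (upTo n)
All-upTo n = All.applyUpTo⁺₁ id n id

-- Finite sums

module Sums {c ℓ : Level} (R : CommutativeSemiring c ℓ) where
  open CommutativeSemiring R hiding (zero)
  open import Relation.Binary.Reasoning.Setoid setoid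
  open import Algebra.Properties.CommutativeSemigroup +-commutativeSemigroup using (interchange)

  ∑ : ∀ {a} {A : Set a} → List A → (A → Carrier) → Carrier
  ∑ xs g = foldr (λ x acc → g x + acc) 0# xs

  infixr 7 _▹_
  _▹_ : Bool → Carrier → Carrier
  b ▹ u = if b then u else 0#

  module _ {a} {A : Set a} where

    ∑-congAll : ∀ {f g : A → Carrier} {xs} → All (λ x → f x ≈ g x) xs → ∑ xs f ≈ ∑ xs g
    ∑-congAll []       = refl
    ∑-congAll (e ∷ es) = +-cong e (∑-congAll es)

    ∑-cong : ∀ {f g : A → Carrier} xs → (∀ x → f x ≈ g x) → ∑ xs f ≈ ∑ xs g
    ∑-cong []       e = refl
    ∑-cong (x ∷ xs) e = +-cong (e x) (∑-cong xs e)

    ∑-zero : ∀ xs → ∑ {A = A} xs (λ _ → 0#) ≈ 0#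
    ∑-zero []       = refl
    ∑-zero (x ∷ xs) = trans (+-identityˡ _) (∑-zero xs)

    ∑-vanish : ∀ {f : A → Carrier} xs → (∀ x → f x ≈ 0#) → ∑ xs f ≈ 0#
    ∑-vanish xs e = trans (∑-cong xs e) (∑-zero xs)

    ∑-+ : ∀ xs (f g : A → Carrier) → ∑ xs (λ x → f x + g x) ≈ ∑ xs f + ∑ xs g
    ∑-+ []       f g = sym (+-identityˡ 0#)
    ∑-+ (x ∷ xs) f g = trans (+-congˡ (∑-+ xs f g)) (interchange (f x) (g x) _ _)

    ∑-*ˡ : ∀ a xs (f : A → Carrier) → ∑ xs (λ x → a * f x) ≈ a * ∑ xs f
    ∑-*ˡ a []       f = sym (zeroʳ a)
    ∑-*ˡ a (x ∷ xs) f = trans (+-congˡ (∑-*ˡ a xs f)) (sym (distribˡ a (f x) (∑ xs f)))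

    ∑-*ʳ : ∀ a xs (f : A → Carrier) → ∑ xs (λ x → f x * a) ≈ ∑ xs f * a
    ∑-*ʳ a []       f = sym (zeroˡ a)
    ∑-*ʳ a (x ∷ xs) f = trans (+-congˡ (∑-*ʳ a xs f)) (sym (distribʳ a (f x) (∑ xs f)))

    ∑-++ : ∀ xs ys (f : A → Carrier) → ∑ (xs ++ ys) f ≈ ∑ xs f + ∑ ys f
    ∑-++ []       ys f = sym (+-identityˡ _)
    ∑-++ (x ∷ xs) ys f = trans (+-congˡ (∑-++ xs ys f)) (sym (+-assoc _ _ _))

    ∑-▹ : ∀ b xs (f : A → Carrier) → ∑ xs (λ x → b ▹ f x) ≈ b ▹ ∑ xs f
    ∑-▹ true  xs f = refl
    ∑-▹ false xs f = ∑-zero xs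

  ∑-map : ∀ {a b} {A : Set a} {B : Set b} (h : A → B) xs (f : B → Carrier) → ∑ (map h xs) f ≡ ∑ xs (f ∘ h)
  ∑-map h []       f = ≡.refl
  ∑-map h (x ∷ xs) f = ≡.cong (f (h x) +_) (∑-map h xs f)

  ∑-concatMap : ∀ {a b} {A : Set a} {B : Set b} (h : A → List B) xs (f : B → Carrier) →
                ∑ (concatMap h xs) f ≈ ∑ xs (λ x → ∑ (h x) f)
  ∑-concatMap h []       f = refl
  ∑-concatMap h (x ∷ xs) f = trans (∑-++ (h x) (concatMap h xs) f) (+-congˡ (∑-concatMap h xs f))

  ∑-swap : ∀ {a b} {A : Set a} {B : Set b} (xs : List A) (ys : List B) (f : A → B → Carrier) →
           ∑ xs (λ x → ∑ ys (f x)) ≈ ∑ ys (λ y → ∑ xs (λ x → f x y))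
  ∑-swap []       ys f = sym (∑-zero ys)
  ∑-swap (x ∷ xs) ys f = trans (+-congˡ (∑-swap xs ys f)) (sym (∑-+ ys (f x) _))

  ∑-applyUpTo′ : ∀ {a b} {A : Set a} {B : Set b} (h : A → B) (k : ℕ → A) n (g : B → Carrier) →
                 ∑ (applyUpTo (h ∘ k) n) g ≡ ∑ (applyUpTo k n) (g ∘ h)
  ∑-applyUpTo′ h k zero    g = ≡.refl
  ∑-applyUpTo′ h k (suc n) g = ≡.cong (g (h (k 0)) +_) (∑-applyUpTo′ h (k ∘ suc) n g)

  ∑-applyUpTo : ∀ {a} {A : Set a} (h : ℕ → A) n (g : A → Carrier) → ∑ (applyUpTo h n) g ≡ ∑ (upTo n) (g ∘ h)
  ∑-applyUpTo h n g = ∑-applyUpTo′ h id n g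

  ∑-upTo-suc : ∀ n (g : ℕ → Carrier) → ∑ (upTo (suc n)) g ≡ g 0 + ∑ (upTo n) (g ∘ suc)
  ∑-upTo-suc n g = ≡.cong (g 0 +_) (∑-applyUpTo suc n g)

  ∑-upTo-snoc : ∀ n (g : ℕ → Carrier) → ∑ (upTo (suc n)) g ≈ ∑ (upTo n) g + g n
  ∑-upTo-snoc zero    g = +-comm _ _
  ∑-upTo-snoc (suc n) g = begin
    ∑ (upTo (suc (suc n))) g ≡⟨ ∑-upTo-suc (suc n) g ⟩
    g 0 + ∑ (upTo (suc n)) (g ∘ suc) ≈⟨ +-congˡ (∑-upTo-snoc n (g ∘ suc)) ⟩
    g 0 + (∑ (upTo n) (g ∘ suc) + g (suc n)) ≈⟨ +-assoc _ _ _ ⟨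
    (g 0 + ∑ (upTo n) (g ∘ suc)) + g (suc n) ≡⟨ ≡.cong (_+ g (suc n)) (∑-upTo-suc n g) ⟨
    ∑ (upTo (suc n)) g + g (suc n) ∎

  ∑-upTo-cong : ∀ n {f g : ℕ → Carrier} → (∀ i → i < n → f i ≈ g i) → ∑ (upTo n) f ≈ ∑ (upTo n) g
  ∑-upTo-cong n e = ∑-congAll (All.map (e _) (All-upTo n))

  -- A variable upper bound becomes a guard, so that nested sums with dependent ranges can be
  -- interchanged by `∑-swap`.
  ∑-upTo-extend : ∀ {n N} → n ≤ N → (g : ℕ → Carrier) → ∑ (upTo n) g ≈ ∑ (upTo N) (λ i → (i <ᵇ n) ▹ g i)
  ∑-upTo-extend {N = N} z≤n g = sym (∑-zero (upTo N))
  ∑-upTo-extend {suc n} {suc N} (s≤s le) g = begin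
    ∑ (upTo (suc n)) g ≡⟨ ∑-upTo-suc n g ⟩
    g 0 + ∑ (upTo n) (g ∘ suc) ≈⟨ +-congˡ (∑-upTo-extend le (g ∘ suc)) ⟩
    g 0 + ∑ (upTo N) (λ i → (i <ᵇ n) ▹ g (suc i)) ≡⟨ ∑-upTo-suc N (λ i → (i <ᵇ suc n) ▹ g i) ⟨
    ∑ (upTo (suc N)) (λ i → (i <ᵇ suc n) ▹ g i) ∎

  ∑-upTo-truncate : ∀ {n N} → n ≤ N → (g : ℕ → Carrier) → (∀ i → n ≤ i → g i ≈ 0#) →
                    ∑ (upTo N) g ≈ ∑ (upTo n) g
  ∑-upTo-truncate {N = N} z≤n g z = ∑-vanish (upTo N) (λ i → z i z≤n)
  ∑-upTo-truncate {suc n} {suc N} (s≤s le) g z = begin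
    ∑ (upTo (suc N)) g ≡⟨ ∑-upTo-suc N g ⟩
    g 0 + ∑ (upTo N) (g ∘ suc) ≈⟨ +-congˡ (∑-upTo-truncate le (g ∘ suc) (λ i p → z (suc i) (s≤s p))) ⟩
    g 0 + ∑ (upTo n) (g ∘ suc) ≡⟨ ∑-upTo-suc n g ⟨
    ∑ (upTo (suc n)) g ∎

  -- The sum of φ i j over i + j = n. Both indices are carried along, so no truncated subtraction
  -- appears and commutativity and associativity of convolution are plain inductions.
  ∑⊕ : ℕ → (ℕ → ℕ → Carrier) → Carrier
  ∑⊕ zero    φ = φ 0 0
  ∑⊕ (suc n) φ = φ 0 (suc n) + ∑⊕ n (φ ∘ suc)

  ∑⊕-cong : ∀ n {φ ψ : ℕ → ℕ → Carrier} → (∀ i j → i ℕ.+ j ≡ n → φ i j ≈ ψ i j) → ∑⊕ n φ ≈ ∑⊕ n ψ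
  ∑⊕-cong zero    e = e 0 0 ≡.refl
  ∑⊕-cong (suc n) e = +-cong (e 0 (suc n) ≡.refl) (∑⊕-cong n (λ i j p → e (suc i) j (≡.cong suc p)))

  ∑⊕-zero : ∀ n → ∑⊕ n (λ _ _ → 0#) ≈ 0#
  ∑⊕-zero zero    = refl
  ∑⊕-zero (suc n) = trans (+-identityˡ _) (∑⊕-zero n)

  ∑⊕-vanish : ∀ n {φ : ℕ → ℕ → Carrier} → (∀ i j → i ℕ.+ j ≡ n → φ i j ≈ 0#) → ∑⊕ n φ ≈ 0#
  ∑⊕-vanish n e = trans (∑⊕-cong n e) (∑⊕-zero n)

  ∑⊕-+ : ∀ n (φ ψ : ℕ → ℕ → Carrier) → ∑⊕ n (λ i j → φ i j + ψ i j) ≈ ∑⊕ n φ + ∑⊕ n ψ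
  ∑⊕-+ zero    φ ψ = refl
  ∑⊕-+ (suc n) φ ψ = trans (+-congˡ (∑⊕-+ n (φ ∘ suc) (ψ ∘ suc))) (interchange _ _ _ _)

  ∑⊕-*ˡ : ∀ a n (φ : ℕ → ℕ → Carrier) → ∑⊕ n (λ i j → a * φ i j) ≈ a * ∑⊕ n φ
  ∑⊕-*ˡ a zero    φ = refl
  ∑⊕-*ˡ a (suc n) φ = trans (+-congˡ (∑⊕-*ˡ a n (φ ∘ suc))) (sym (distribˡ _ _ _))

  ∑⊕-*ʳ : ∀ a n (φ : ℕ → ℕ → Carrier) → ∑⊕ n (λ i j → φ i j * a) ≈ ∑⊕ n φ * a
  ∑⊕-*ʳ a zero    φ = refl
  ∑⊕-*ʳ a (suc n) φ = trans (+-congˡ (∑⊕-*ʳ a n (φ ∘ suc))) (sym (distribʳ _ _ _))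

  ∑⊕-∑ : ∀ {a} {A : Set a} n (L : List A) (φ : A → ℕ → ℕ → Carrier) →
         ∑⊕ n (λ i j → ∑ L (λ x → φ x i j)) ≈ ∑ L (λ x → ∑⊕ n (φ x))
  ∑⊕-∑ n []      φ = ∑⊕-zero n
  ∑⊕-∑ n (x ∷ L) φ = trans (∑⊕-+ n _ _) (+-congˡ (∑⊕-∑ n L φ))

  ∑⊕-snoc : ∀ n (φ : ℕ → ℕ → Carrier) → ∑⊕ (suc n) φ ≈ ∑⊕ n (λ i j → φ i (suc j)) + φ (suc n) 0
  ∑⊕-snoc zero    φ = refl
  ∑⊕-snoc (suc n) φ = trans (+-congˡ (∑⊕-snoc n (φ ∘ suc))) (sym (+-assoc _ _ _))

  ∑⊕-comm : ∀ n (φ : ℕ → ℕ → Carrier) → ∑⊕ n φ ≈ ∑⊕ n (λ i j → φ j i)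
  ∑⊕-comm zero    φ = refl
  ∑⊕-comm (suc n) φ = begin
    φ 0 (suc n) + ∑⊕ n (φ ∘ suc) ≈⟨ +-congˡ (∑⊕-comm n (φ ∘ suc)) ⟩
    φ 0 (suc n) + ∑⊕ n (λ i j → φ (suc j) i) ≈⟨ +-comm _ _ ⟩
    ∑⊕ n (λ i j → φ (suc j) i) + φ 0 (suc n) ≈⟨ ∑⊕-snoc n (λ i j → φ j i) ⟨
    ∑⊕ (suc n) (λ i j → φ j i) ∎

  ∑⊕-assoc : ∀ n (φ : ℕ → ℕ → ℕ → Carrier) →
             ∑⊕ n (λ i j → ∑⊕ i (λ k l → φ k l j)) ≈ ∑⊕ n (λ k r → ∑⊕ r (λ l j → φ k l j))
  ∑⊕-assoc zero    φ = refl
  ∑⊕-assoc (suc n) φ = begin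
    φ 0 0 (suc n) + ∑⊕ n (λ i j → φ 0 (suc i) j + ∑⊕ i (λ k l → φ (suc k) l j))
      ≈⟨ +-congˡ (trans (∑⊕-+ n _ _) (+-congˡ (∑⊕-assoc n (φ ∘ suc)))) ⟩
    φ 0 0 (suc n) + (∑⊕ n (λ i j → φ 0 (suc i) j) + ∑⊕ n (λ k r → ∑⊕ r (φ (suc k))))
      ≈⟨ +-assoc _ _ _ ⟨
    ∑⊕ (suc n) (φ 0) + ∑⊕ n (λ k r → ∑⊕ r (φ (suc k))) ∎

  ∑-upTo-⊕ : ∀ n (φ : ℕ → ℕ → Carrier) → ∑ (upTo (suc n)) (λ i → φ i (n ℕ.∸ i)) ≈ ∑⊕ n φ
  ∑-upTo-⊕ zero    φ = +-identityʳ _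
  ∑-upTo-⊕ (suc n) φ = begin
    ∑ (upTo (suc (suc n))) (λ i → φ i (suc n ℕ.∸ i)) ≡⟨ ∑-upTo-suc (suc n) _ ⟩
    φ 0 (suc n) + ∑ (upTo (suc n)) (λ i → φ (suc i) (n ℕ.∸ i)) ≈⟨ +-congˡ (∑-upTo-⊕ n (φ ∘ suc)) ⟩
    ∑⊕ (suc n) φ ∎

-- Boolean tests, and the operators that lower exponents or remove horizontal strips

T-ext : ∀ {a b} → (T a → T b) → (T b → T a) → a ≡ b
T-ext {false} {false} f g = ≡.refl
T-ext {false} {true}  f g = ⊥-elim (g tt)
T-ext {true}  {false} f g = ⊥-elim (f tt)
T-ext {true}  {true}  f g = ≡.refl

T-∧ : ∀ {a b} → T a → T b → T (a ∧ b)
T-∧ {true} p q = q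

T-∧₁ : ∀ {a b} → T (a ∧ b) → T a
T-∧₁ {true} p = tt

T-∧₂ : ∀ {a b} → T (a ∧ b) → T b
T-∧₂ {true} p = p

All-filterB : ∀ {A : Set} {Q : A → Set} (p : A → Bool) {xs} → All (λ x → T (p x) → Q x) xs → All Q (filterB p xs)
All-filterB p [] = []
All-filterB p {x ∷ xs} (q ∷ qs) with p x
... | true  = q tt ∷ All-filterB p qs
... | false = All-filterB p qs

-- hs μ m lists the differences μ − α over all α ≤ μ with |α| = m; the last clause is
-- H_{m+1} = H′_{m+1} + X H_m, where X lowers the first entry and H′ ignores it.
hs : List ℕ → ℕ → List (List ℕ)
hs []          zero    = [] ∷ []
hs []          (suc m) = []
hs (zero ∷ μ)  m       = map (zero ∷_) (hs μ m)
hs (suc x ∷ μ) zero    = map (suc x ∷_) (hs μ zero)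
hs (suc x ∷ μ) (suc m) = map (suc x ∷_) (hs μ (suc m)) ++ hs (x ∷ μ) m

module HOps {c ℓ : Level} (R : CommutativeSemiring c ℓ) where
  open CommutativeSemiring R hiding (zero) renaming (refl to ≈-refl; sym to ≈-sym; trans to ≈-trans)
  open import Relation.Binary.Reasoning.Setoid setoid
  open Sums R

  hs-suc : ∀ x μ m (g : List ℕ → Carrier) →
           ∑ (hs (suc x ∷ μ) (suc m)) g ≈ ∑ (hs μ (suc m)) (g ∘ (suc x ∷_)) + ∑ (hs (x ∷ μ) m) g
  hs-suc x μ m g = ≈-trans (∑-++ (map (suc x ∷_) (hs μ (suc m))) _ g)
                           (+-congʳ (reflexive (∑-map (suc x ∷_) (hs μ (suc m)) g)))

  hs-0 : ∀ μ (g : List ℕ → Carrier) → ∑ (hs μ 0) g ≈ g μ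
  hs-0 []          g = +-identityʳ _
  hs-0 (zero ∷ μ)  g = ≈-trans (reflexive (∑-map (zero ∷_) (hs μ 0) g)) (hs-0 μ _)
  hs-0 (suc x ∷ μ) g = ≈-trans (reflexive (∑-map (suc x ∷_) (hs μ 0) g)) (hs-0 μ _)

hd : List ℕ → ℕ
hd []      = 0
hd (x ∷ _) = x

-- Zero entries are allowed because the shapes produced by `strips` keep their empty rows; m bounds
-- the first entry, so that a longer row can be put in front.
data Dec : ℕ → List ℕ → Set where
  []  : ∀ {m} → Dec m []
  _∷_ : ∀ {m x xs} → x ≤ m → Dec x xs → Dec m (x ∷ xs)

Dec-hd : ∀ {m xs} → Dec m xs → hd xs ≤ m
Dec-hd []      = z≤n
Dec-hd (p ∷ _) = p

Dec-weaken : ∀ {m n xs} → m ≤ n → Dec m xs → Dec n xs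
Dec-weaken le []      = []
Dec-weaken le (p ∷ d) = ℕ.≤-trans p le ∷ d

Dec-tighten : ∀ {m xs} → Dec m xs → Dec (hd xs) xs
Dec-tighten []      = []
Dec-tighten (p ∷ d) = ℕ.≤-refl ∷ d

stripCons : ℕ → ℕ → ℕ × List ℕ → ℕ × List ℕ
stripCons x y (i , ν) = x ∸ y ℕ.+ i , y ∷ ν

-- The pairs (|λ/ν| , ν) with λ/ν a horizontal strip; ν has as many rows as λ, possibly empty ones.
strips : List ℕ → List (ℕ × List ℕ)
strips []       = (0 , []) ∷ []
strips (x ∷ λ') = concatMap (λ y → map (stripCons x y) (strips λ')) (filterB (hd λ' ≤ᵇ_) (upTo (suc x)))

module StripSums {c ℓ : Level} (R : CommutativeSemiring c ℓ) where
  open CommutativeSemiring R hiding (zero; sym) renaming (trans to ≈-trans; refl to ≈-refl)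
  open import Relation.Binary.Reasoning.Setoid setoid
  open Sums R

  ▹-cong : ∀ b {u v} → (T b → u ≈ v) → b ▹ u ≈ b ▹ v
  ▹-cong true  e = e tt
  ▹-cong false e = ≈-refl

  ▹-zero : ∀ b → b ▹ 0# ≈ 0#
  ▹-zero true  = ≈-refl
  ▹-zero false = ≈-refl

  ▹-false : ∀ b {u} → (T b → u ≈ 0#) → b ▹ u ≈ 0#
  ▹-false b e = ≈-trans (▹-cong b e) (▹-zero b)

  ▹-∧ : ∀ a b u → (a ∧ b) ▹ u ≈ a ▹ b ▹ u
  ▹-∧ true  b u = ≈-refl
  ▹-∧ false b u = ≈-refl

  ∑-filterB : ∀ {A : Set} (p : A → Bool) xs (g : A → Carrier) → ∑ (filterB p xs) g ≈ ∑ xs (λ x → p x ▹ g x)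
  ∑-filterB p []       g = ≈-refl
  ∑-filterB p (x ∷ xs) g with p x
  ... | true  = +-congˡ (∑-filterB p xs g)
  ... | false = ≈-trans (∑-filterB p xs g) (CommutativeSemiring.sym R (+-identityˡ _))

  ∑-strips : ∀ x λ' (φ : ℕ × List ℕ → Carrier) →
             ∑ (strips (x ∷ λ')) φ ≈ ∑ (upTo (suc x)) (λ y → (hd λ' ≤ᵇ y) ▹ ∑ (strips λ') (φ ∘ stripCons x y))
  ∑-strips x λ' φ = begin
    ∑ (strips (x ∷ λ')) φ
      ≈⟨ ∑-concatMap (λ y → map (stripCons x y) (strips λ')) (filterB (hd λ' ≤ᵇ_) (upTo (suc x))) φ ⟩
    ∑ (filterB (hd λ' ≤ᵇ_) (upTo (suc x))) (λ y → ∑ (map (stripCons x y) (strips λ')) φ)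
      ≈⟨ ∑-cong (filterB (hd λ' ≤ᵇ_) (upTo (suc x))) (λ y → reflexive (∑-map (stripCons x y) (strips λ') φ)) ⟩
    ∑ (filterB (hd λ' ≤ᵇ_) (upTo (suc x))) (λ y → ∑ (strips λ') (φ ∘ stripCons x y))
      ≈⟨ ∑-filterB (hd λ' ≤ᵇ_) (upTo (suc x)) _ ⟩
    ∑ (upTo (suc x)) (λ y → (hd λ' ≤ᵇ y) ▹ ∑ (strips λ') (φ ∘ stripCons x y)) ∎

  strips-zero : ∀ {λ'} → Dec 0 λ' → (φ : ℕ × List ℕ → Carrier) → ∑ (strips λ') φ ≈ φ (0 , λ')
  strips-zero [] φ = +-identityʳ _
  strips-zero {0 ∷ λ'} (z≤n ∷ d) φ = begin
    ∑ (strips (0 ∷ λ')) φ ≈⟨ ∑-strips 0 λ' φ ⟩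
    (hd λ' ≤ᵇ 0) ▹ ∑ (strips λ') (φ ∘ stripCons 0 0) + 0# ≈⟨ +-identityʳ _ ⟩
    (hd λ' ≤ᵇ 0) ▹ ∑ (strips λ') (φ ∘ stripCons 0 0) ≡⟨ cong (_▹ ∑ (strips λ') (φ ∘ stripCons 0 0)) hd-true ⟩
    ∑ (strips λ') (φ ∘ stripCons 0 0) ≈⟨ strips-zero d (φ ∘ stripCons 0 0) ⟩
    φ (0 , 0 ∷ λ') ∎
    where
    hd-true : (hd λ' ≤ᵇ 0) ≡ true
    hd-true = T-ext (λ _ → tt) (λ _ → ℕ.≤⇒≤ᵇ (Dec-hd d))

replaceOne : (ℕ → Bool) → (ℕ → ℕ) → List ℕ → List (List ℕ)
replaceOne c t []      = []
replaceOne c t (x ∷ μ) = (if c x then (t x ∷ μ) ∷ [] else []) ++ map (x ∷_) (replaceOne c t μ)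

-- Summing f over lowered i μ gives [x^μ] (p_i f); cleared and shrunk split it by whether the lowered
-- entry vanishes.
lowered cleared shrunk : ℕ → List ℕ → List (List ℕ)
lowered i = replaceOne (i ≤ᵇ_) (_∸ i)
cleared i = replaceOne (_≡ᵇ i) (λ _ → 0)
shrunk  i = replaceOne (i <ᵇ_) (_∸ i)

module ReplaceSums {c ℓ : Level} (R : CommutativeSemiring c ℓ) where
  open CommutativeSemiring R hiding (zero; sym) renaming (trans to ≈-trans; refl to ≈-refl)
  open Sums R

  ∑-replaceOne : ∀ c t x μ (g : List ℕ → Carrier) →
                 ∑ (replaceOne c t (x ∷ μ)) g ≈ c x ▹ g (t x ∷ μ) + ∑ (replaceOne c t μ) (g ∘ (x ∷_))
  ∑-replaceOne c t x μ g with c x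
  ... | true  = +-cong ≈-refl (reflexive (∑-map (x ∷_) (replaceOne c t μ) g))
  ... | false = ≈-trans (reflexive (∑-map (x ∷_) (replaceOne c t μ) g)) (CommutativeSemiring.sym R (+-identityˡ _))

-- Symmetries of the matrix [m_μ] h_λ

module Counting where
  open import Data.Nat using (_+_; _*_)
  open import Data.Nat.Solver using (module +-*-Solver)
  open +-*-Solver using (solve; _:+_; _:=_)
  open ≡ using (refl; sym; trans)
  open ≡.≡-Reasoning
  open Sums ℕ.+-*-commutativeSemiring
  open HOps ℕ.+-*-commutativeSemiring
  open StripSums ℕ.+-*-commutativeSemiring
  open ReplaceSums ℕ.+-*-commutativeSemiring

  -- The enumeration of compositions in `hCoeff` chooses a whole entry at a time, whereas `hs` moves
  -- a single unit; the later inductions lower the degree and the first entry together.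
  hs-leqB : ∀ m μ (g : List ℕ → ℕ) →
            ∑ (comps m (length μ)) (λ α → leqB α μ ▹ g (zipWith _∸_ μ α)) ≡ ∑ (hs μ m) g
  hs-leqB-∷ : ∀ m x μ (g : List ℕ → ℕ) →
              ∑ (upTo (suc m)) (λ j → (j ≤ᵇ x) ▹ ∑ (hs μ (m ∸ j)) (g ∘ ((x ∸ j) ∷_))) ≡ ∑ (hs (x ∷ μ) m) g

  comps-suc : ∀ m k → comps m (suc k) ≡ concatMap (λ j → map (j ∷_) (comps (m ∸ j) k)) (upTo (suc m))
  comps-suc zero    k = refl
  comps-suc (suc m) k = refl

  hs-leqB zero    []      g = refl
  hs-leqB (suc m) []      g = refl
  hs-leqB m       (x ∷ μ) g = begin
    ∑ (comps m (suc (length μ))) G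
      ≡⟨ cong (λ L → ∑ L G) (comps-suc m (length μ)) ⟩
    ∑ (concatMap (λ j → map (j ∷_) (comps (m ∸ j) (length μ))) (upTo (suc m))) G
      ≡⟨ ∑-concatMap (λ j → map (j ∷_) (comps (m ∸ j) (length μ))) (upTo (suc m)) G ⟩
    ∑ (upTo (suc m)) (λ j → ∑ (map (j ∷_) (comps (m ∸ j) (length μ))) G)
      ≡⟨ ∑-cong (upTo (suc m)) step ⟩
    ∑ (upTo (suc m)) (λ j → (j ≤ᵇ x) ▹ ∑ (hs μ (m ∸ j)) (g ∘ ((x ∸ j) ∷_)))
      ≡⟨ hs-leqB-∷ m x μ g ⟩
    ∑ (hs (x ∷ μ) m) g ∎
    where
    G : List ℕ → ℕ
    G α = leqB α (x ∷ μ) ▹ g (zipWith _∸_ (x ∷ μ) α)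
    ∧-▹ : ∀ a b u → (a ∧ b) ▹ u ≡ a ▹ b ▹ u
    ∧-▹ false b u = refl
    ∧-▹ true  b u = refl
    step : ∀ j → ∑ (map (j ∷_) (comps (m ∸ j) (length μ))) G
               ≡ (j ≤ᵇ x) ▹ ∑ (hs μ (m ∸ j)) (g ∘ ((x ∸ j) ∷_))
    step j = begin
      ∑ (map (j ∷_) C) G
        ≡⟨ ∑-map (j ∷_) C G ⟩
      ∑ C (λ α → ((j ≤ᵇ x) ∧ leqB α μ) ▹ g ((x ∸ j) ∷ zipWith _∸_ μ α))
        ≡⟨ ∑-cong C (λ α → ∧-▹ (j ≤ᵇ x) (leqB α μ) _) ⟩
      ∑ C (λ α → (j ≤ᵇ x) ▹ leqB α μ ▹ g ((x ∸ j) ∷ zipWith _∸_ μ α))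
        ≡⟨ ∑-▹ (j ≤ᵇ x) C _ ⟩
      (j ≤ᵇ x) ▹ ∑ C (λ α → leqB α μ ▹ g ((x ∸ j) ∷ zipWith _∸_ μ α))
        ≡⟨ cong ((j ≤ᵇ x) ▹_) (hs-leqB (m ∸ j) μ (g ∘ ((x ∸ j) ∷_))) ⟩
      (j ≤ᵇ x) ▹ ∑ (hs μ (m ∸ j)) (g ∘ ((x ∸ j) ∷_)) ∎
      where C = comps (m ∸ j) (length μ)

  hs-leqB-∷ m zero μ g = begin
    ∑ (upTo (suc m)) G ≡⟨ ∑-upTo-suc m G ⟩
    G 0 + ∑ (upTo m) (λ _ → 0) ≡⟨ cong (G 0 +_) (∑-zero (upTo m)) ⟩
    G 0 + 0 ≡⟨ ℕ.+-identityʳ (G 0) ⟩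
    ∑ (hs μ m) (g ∘ (0 ∷_)) ≡⟨ ∑-map (0 ∷_) (hs μ m) g ⟨
    ∑ (hs (0 ∷ μ) m) g ∎
    where
    G : ℕ → ℕ
    G j = (j ≤ᵇ 0) ▹ ∑ (hs μ (m ∸ j)) (g ∘ ((0 ∸ j) ∷_))
  hs-leqB-∷ zero (suc x) μ g = trans (ℕ.+-identityʳ _) (sym (∑-map (suc x ∷_) (hs μ 0) g))
  hs-leqB-∷ (suc m) (suc x) μ g = begin
    ∑ (upTo (suc (suc m))) G ≡⟨ ∑-upTo-suc (suc m) G ⟩
    G 0 + ∑ (upTo (suc m)) (G ∘ suc) ≡⟨ cong (G 0 +_) (∑-cong (upTo (suc m)) (λ j → cong (_▹ ∑ (hs μ (m ∸ j)) (g ∘ ((x ∸ j) ∷_))) (≤ᵇ-suc j x))) ⟩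
    G 0 + ∑ (upTo (suc m)) (λ j → (j ≤ᵇ x) ▹ ∑ (hs μ (m ∸ j)) (g ∘ ((x ∸ j) ∷_)))
                                               ≡⟨ cong (G 0 +_) (hs-leqB-∷ m x μ g) ⟩
    G 0 + ∑ (hs (x ∷ μ) m) g ≡⟨ hs-suc x μ m g ⟨
    ∑ (hs (suc x ∷ μ) (suc m)) g ∎
    where
    ≤ᵇ-suc : ∀ a b → (suc a ≤ᵇ suc b) ≡ (a ≤ᵇ b)
    ≤ᵇ-suc zero    b = refl
    ≤ᵇ-suc (suc a) b = refl
    G : ℕ → ℕ
    G j = (j ≤ᵇ suc x) ▹ ∑ (hs μ (suc m ∸ j)) (g ∘ ((suc x ∸ j) ∷_))

  sumℕ-map : ∀ {A : Set} (f : A → ℕ) xs → sumℕ (map f xs) ≡ ∑ xs f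
  sumℕ-map f []       = refl
  sumℕ-map f (x ∷ xs) = cong (f x +_) (sumℕ-map f xs)

  hCoeff-∷ : ∀ m λ' μ → hCoeff (m ∷ λ') μ ≡ ∑ (hs μ m) (hCoeff λ')
  hCoeff-∷ m λ' μ = trans (sumℕ-map _ (comps m (length μ))) (hs-leqB m μ (hCoeff λ'))

  hCoeff-0∷ : ∀ λ' μ → hCoeff (0 ∷ λ') μ ≡ hCoeff λ' μ
  hCoeff-0∷ λ' μ = trans (hCoeff-∷ 0 λ' μ) (hs-0 μ (hCoeff λ'))

  hCoeff-∷0 : ∀ λ' μ → hCoeff λ' (0 ∷ μ) ≡ hCoeff λ' μ
  hCoeff-∷0 []       μ = refl
  hCoeff-∷0 (m ∷ λ') μ = begin
    hCoeff (m ∷ λ') (0 ∷ μ) ≡⟨ hCoeff-∷ m λ' (0 ∷ μ) ⟩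
    ∑ (hs (0 ∷ μ) m) (hCoeff λ') ≡⟨ ∑-map (0 ∷_) (hs μ m) (hCoeff λ') ⟩
    ∑ (hs μ m) (hCoeff λ' ∘ (0 ∷_)) ≡⟨ ∑-cong (hs μ m) (hCoeff-∷0 λ') ⟩
    ∑ (hs μ m) (hCoeff λ') ≡⟨ hCoeff-∷ m λ' μ ⟨
    hCoeff (m ∷ λ') μ ∎

  -- `hCoeff λ' μ` counts the matrices of nonnegative integers with row sums λ' and column sums μ.
  -- Where `hCoeff-∷` takes off the first row, this takes off the first column.
  hCoeff-column : ∀ λ' x μ → hCoeff λ' (x ∷ μ) ≡ ∑ (hs λ' x) (λ κ → hCoeff κ μ)
  hCoeff-column [] zero    μ = sym (ℕ.+-identityʳ _)
  hCoeff-column [] (suc x) μ = refl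
  hCoeff-column (m ∷ λ') x μ = trans (hCoeff-∷ m λ' (x ∷ μ)) (go m x)
    where
    g : List ℕ → ℕ
    g κ = hCoeff κ μ
    first : ∀ m x → ∑ (hs μ m) (hCoeff λ' ∘ (x ∷_)) ≡ ∑ (hs λ' x) (g ∘ (m ∷_))
    first m x = begin
      ∑ (hs μ m) (λ ν → hCoeff λ' (x ∷ ν)) ≡⟨ ∑-cong (hs μ m) (hCoeff-column λ' x) ⟩
      ∑ (hs μ m) (λ ν → ∑ (hs λ' x) (λ κ → hCoeff κ ν)) ≡⟨ ∑-swap (hs μ m) (hs λ' x) _ ⟩
      ∑ (hs λ' x) (λ κ → ∑ (hs μ m) (hCoeff κ)) ≡⟨ ∑-cong (hs λ' x) (λ κ → sym (hCoeff-∷ m κ μ)) ⟩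
      ∑ (hs λ' x) (λ κ → hCoeff (m ∷ κ) μ) ∎
    go : ∀ m x → ∑ (hs (x ∷ μ) m) (hCoeff λ') ≡ ∑ (hs (m ∷ λ') x) g
    go zero x = begin
      ∑ (hs (x ∷ μ) 0) (hCoeff λ') ≡⟨ hs-0 (x ∷ μ) (hCoeff λ') ⟩
      hCoeff λ' (x ∷ μ) ≡⟨ hCoeff-column λ' x μ ⟩
      ∑ (hs λ' x) g ≡⟨ ∑-cong (hs λ' x) (λ κ → sym (hCoeff-0∷ κ μ)) ⟩
      ∑ (hs λ' x) (g ∘ (0 ∷_)) ≡⟨ ∑-map (0 ∷_) (hs λ' x) g ⟨
      ∑ (hs (0 ∷ λ') x) g ∎
    go (suc m) zero = begin
      ∑ (hs (0 ∷ μ) (suc m)) (hCoeff λ') ≡⟨ hCoeff-∷ (suc m) λ' (0 ∷ μ) ⟨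
      hCoeff (suc m ∷ λ') (0 ∷ μ) ≡⟨ hCoeff-∷0 (suc m ∷ λ') μ ⟩
      hCoeff (suc m ∷ λ') μ ≡⟨ hs-0 (suc m ∷ λ') g ⟨
      ∑ (hs (suc m ∷ λ') 0) g ∎
    -- The corner entry of the matrix is either 0, or it can be lowered by one, which lowers the
    -- first row sum and the first column sum together.
    go (suc m) (suc x) = begin
      ∑ (hs (suc x ∷ μ) (suc m)) (hCoeff λ')
        ≡⟨ hs-suc x μ m (hCoeff λ') ⟩
      ∑ (hs μ (suc m)) (hCoeff λ' ∘ (suc x ∷_)) + ∑ (hs (x ∷ μ) m) (hCoeff λ')
        ≡⟨ cong₂ _+_ (first (suc m) (suc x)) (go m x) ⟩
      ∑ (hs λ' (suc x)) (g ∘ (suc m ∷_)) + ∑ (hs (m ∷ λ') x) g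
        ≡⟨ hs-suc m λ' x g ⟨
      ∑ (hs (suc m ∷ λ') (suc x)) g ∎

  hCoeff-[] : ∀ λ' → hCoeff λ' [] ≡ hCoeff [] λ'
  hCoeff-[] []       = refl
  hCoeff-[] (m ∷ λ') = trans (hCoeff-∷ m λ' []) (base m)
    where
    base : ∀ m → ∑ (hs [] m) (hCoeff λ') ≡ hCoeff [] (m ∷ λ')
    base zero    = trans (ℕ.+-identityʳ _) (hCoeff-[] λ')
    base (suc m) = refl

  -- Transposition of matrices: removing columns on one side matches removing rows on the other.
  hCoeff-sym : ∀ λ' μ → hCoeff λ' μ ≡ hCoeff μ λ'
  hCoeff-sym λ' []      = hCoeff-[] λ'
  hCoeff-sym λ' (x ∷ μ) = begin
    hCoeff λ' (x ∷ μ) ≡⟨ hCoeff-column λ' x μ ⟩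
    ∑ (hs λ' x) (λ κ → hCoeff κ μ) ≡⟨ ∑-cong (hs λ' x) (λ κ → hCoeff-sym κ μ) ⟩
    ∑ (hs λ' x) (hCoeff μ) ≡⟨ hCoeff-∷ x μ λ' ⟨
    hCoeff (x ∷ μ) λ' ∎

  hs-swap-0 : ∀ μ (g g′ : List ℕ → ℕ) → (∀ a b ν → g (a ∷ b ∷ ν) ≡ g′ (b ∷ a ∷ ν)) → ∀ y m →
    ∑ (hs (0 ∷ y ∷ μ) m) g ≡ ∑ (hs (y ∷ 0 ∷ μ) m) g′
  hs-swap-0 μ g g′ e zero m = begin
    ∑ (hs (0 ∷ 0 ∷ μ) m) g ≡⟨ ∑-map (0 ∷_) (hs (0 ∷ μ) m) g ⟩
    ∑ (hs (0 ∷ μ) m) (g ∘ (0 ∷_)) ≡⟨ ∑-map (0 ∷_) (hs μ m) _ ⟩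
    ∑ (hs μ m) (λ ν → g (0 ∷ 0 ∷ ν)) ≡⟨ ∑-cong (hs μ m) (e 0 0) ⟩
    ∑ (hs μ m) (λ ν → g′ (0 ∷ 0 ∷ ν)) ≡⟨ ∑-map (0 ∷_) (hs μ m) _ ⟨
    ∑ (hs (0 ∷ μ) m) (g′ ∘ (0 ∷_)) ≡⟨ ∑-map (0 ∷_) (hs (0 ∷ μ) m) g′ ⟨
    ∑ (hs (0 ∷ 0 ∷ μ) m) g′ ∎
  hs-swap-0 μ g g′ e (suc y) zero = begin
    ∑ (hs (0 ∷ suc y ∷ μ) 0) g ≡⟨ hs-0 (0 ∷ suc y ∷ μ) g ⟩
    g (0 ∷ suc y ∷ μ) ≡⟨ e 0 (suc y) μ ⟩
    g′ (suc y ∷ 0 ∷ μ) ≡⟨ hs-0 (suc y ∷ 0 ∷ μ) g′ ⟨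
    ∑ (hs (suc y ∷ 0 ∷ μ) 0) g′ ∎
  hs-swap-0 μ g g′ e (suc y) (suc m) = begin
    ∑ (hs (0 ∷ suc y ∷ μ) (suc m)) g
      ≡⟨ ∑-map (0 ∷_) (hs (suc y ∷ μ) (suc m)) g ⟩
    ∑ (hs (suc y ∷ μ) (suc m)) (g ∘ (0 ∷_))
      ≡⟨ hs-suc y μ m (g ∘ (0 ∷_)) ⟩
    ∑ (hs μ (suc m)) (λ ν → g (0 ∷ suc y ∷ ν)) + ∑ (hs (y ∷ μ) m) (g ∘ (0 ∷_))
      ≡⟨ cong₂ _+_ (∑-cong (hs μ (suc m)) (e 0 (suc y))) (sym (∑-map (0 ∷_) (hs (y ∷ μ) m) g)) ⟩
    ∑ (hs μ (suc m)) (λ ν → g′ (suc y ∷ 0 ∷ ν)) + ∑ (hs (0 ∷ y ∷ μ) m) g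
      ≡⟨ cong₂ _+_ (sym (∑-map (0 ∷_) (hs μ (suc m)) _)) (hs-swap-0 μ g g′ e y m) ⟩
    ∑ (hs (0 ∷ μ) (suc m)) (λ ν → g′ (suc y ∷ ν)) + ∑ (hs (y ∷ 0 ∷ μ) m) g′
      ≡⟨ hs-suc y (0 ∷ μ) m g′ ⟨
    ∑ (hs (suc y ∷ 0 ∷ μ) (suc m)) g′ ∎

  -- Adding A_{m-1}(x , y) to both sides makes the two-variable recursion symmetric.
  hs-swap : ∀ m x y μ (g g′ : List ℕ → ℕ) → (∀ a b ν → g (a ∷ b ∷ ν) ≡ g′ (b ∷ a ∷ ν)) →
            ∑ (hs (x ∷ y ∷ μ) m) g ≡ ∑ (hs (y ∷ x ∷ μ) m) g′
  hs-swap m x y μ g g′ e = go m x y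
    where
    A C A′ C′ : ℕ → ℕ → ℕ → ℕ
    A m x y = ∑ (hs (x ∷ y ∷ μ) m) g
    A′ m y x = ∑ (hs (y ∷ x ∷ μ) m) g′
    C m x y = ∑ (hs (y ∷ μ) m) (g ∘ (x ∷_))
    C′ m y x = ∑ (hs (x ∷ μ) m) (g′ ∘ (y ∷_))
    go : ∀ m x y → A m x y ≡ A′ m y x
    go m       zero    y       = hs-swap-0 μ g g′ e y m
    go m       (suc x) zero    = sym (hs-swap-0 μ g′ g (λ a b ν → sym (e b a ν)) (suc x) m)
    go zero    (suc x) (suc y) = trans (hs-0 (suc x ∷ suc y ∷ μ) g) (trans (e _ _ μ) (sym (hs-0 (suc y ∷ suc x ∷ μ) g′)))
    -- In degree one the term to be added on both sides would have degree -1, so the three summands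
    -- are matched directly.
    go (suc zero) (suc x) (suc y) = begin
      A 1 (suc x) (suc y) ≡⟨ hs-suc x (suc y ∷ μ) 0 g ⟩
      C 1 (suc x) (suc y) + A 0 x (suc y) ≡⟨ cong (_+ A 0 x (suc y)) (hs-suc y μ 0 (g ∘ (suc x ∷_))) ⟩
      V + C 0 (suc x) y + A 0 x (suc y) ≡⟨ cong₂ (λ u v → V + u + v) c0 (go 0 x (suc y)) ⟩
      V + A′ 0 y (suc x) + A′ 0 (suc y) x ≡⟨ cong (λ t → t + A′ 0 y (suc x) + A′ 0 (suc y) x) (∑-cong (hs μ 1) (e (suc x) (suc y))) ⟩
      V′ + A′ 0 y (suc x) + A′ 0 (suc y) x ≡⟨ solve 3 (λ t a b → t :+ a :+ b := t :+ b :+ a) refl V′ _ _ ⟩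
      V′ + A′ 0 (suc y) x + A′ 0 y (suc x) ≡⟨ cong (λ u → V′ + u + A′ 0 y (suc x)) (trans (hs-0 (suc y ∷ x ∷ μ) g′) (sym (hs-0 (x ∷ μ) (g′ ∘ (suc y ∷_))))) ⟩
      V′ + C′ 0 (suc y) x + A′ 0 y (suc x) ≡⟨ cong (_+ A′ 0 y (suc x)) (hs-suc x μ 0 (g′ ∘ (suc y ∷_))) ⟨
      C′ 1 (suc y) (suc x) + A′ 0 y (suc x) ≡⟨ hs-suc y (suc x ∷ μ) 0 g′ ⟨
      A′ 1 (suc y) (suc x) ∎
      where
      V  = ∑ (hs μ 1) (λ ν → g (suc x ∷ suc y ∷ ν))
      V′ = ∑ (hs μ 1) (λ ν → g′ (suc y ∷ suc x ∷ ν))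
      c0 : C 0 (suc x) y ≡ A′ 0 y (suc x)
      c0 = trans (hs-0 (y ∷ μ) _) (trans (e (suc x) y μ) (sym (hs-0 (y ∷ suc x ∷ μ) g′)))
    go (suc (suc m)) (suc x) (suc y) = ℕ.+-cancelʳ-≡ (A m x y) _ _ (begin
      A (2 + m) (suc x) (suc y) + A m x y
        ≡⟨ cong (_+ A m x y) (trans (hs-suc x (suc y ∷ μ) (suc m) g) (cong (_+ A (suc m) x (suc y)) (hs-suc y μ (suc m) (g ∘ (suc x ∷_))))) ⟩
      V + C (suc m) (suc x) y + A (suc m) x (suc y) + A m x y
        ≡⟨ solve 4 (λ t c a b → t :+ c :+ a :+ b := t :+ a :+ (c :+ b)) refl V _ _ _ ⟩
      V + A (suc m) x (suc y) + (C (suc m) (suc x) y + A m x y)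
        ≡⟨ cong (V + A (suc m) x (suc y) +_) (sym (hs-suc x (y ∷ μ) m g)) ⟩
      V + A (suc m) x (suc y) + A (suc m) (suc x) y
        ≡⟨ cong₂ _+_ (cong₂ _+_ (∑-cong (hs μ (2 + m)) (e (suc x) (suc y))) (go (suc m) x (suc y))) (go (suc m) (suc x) y) ⟩
      V′ + A′ (suc m) (suc y) x + A′ (suc m) y (suc x)
        ≡⟨ cong (λ u → V′ + u + A′ (suc m) y (suc x)) (hs-suc y (x ∷ μ) m g′) ⟩
      V′ + (C′ (suc m) (suc y) x + A′ m y x) + A′ (suc m) y (suc x)
        ≡⟨ solve 4 (λ t c a b → t :+ (c :+ b) :+ a := t :+ c :+ a :+ b) refl V′ (C′ (suc m) (suc y) x) (A′ (suc m) y (suc x)) (A′ m y x) ⟩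
      V′ + C′ (suc m) (suc y) x + A′ (suc m) y (suc x) + A′ m y x
        ≡⟨ cong (_+ A′ m y x) (trans (hs-suc y (suc x ∷ μ) (suc m) g′) (cong (_+ A′ (suc m) y (suc x)) (hs-suc x μ (suc m) (g′ ∘ (suc y ∷_))))) ⟨
      A′ (2 + m) (suc y) (suc x) + A′ m y x
        ≡⟨ cong (A′ (2 + m) (suc y) (suc x) +_) (sym (go m x y)) ⟩
      A′ (2 + m) (suc y) (suc x) + A m x y ∎)
      where
      V  = ∑ (hs μ (2 + m)) (λ ν → g (suc x ∷ suc y ∷ ν))
      V′ = ∑ (hs μ (2 + m)) (λ ν → g′ (suc y ∷ suc x ∷ ν))

  hCoeff-swap : ∀ λ' x y μ → hCoeff λ' (x ∷ y ∷ μ) ≡ hCoeff λ' (y ∷ x ∷ μ)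
  hCoeff-swap [] zero    y μ = base y
    where
    base : ∀ y → hCoeff [] (0 ∷ y ∷ μ) ≡ hCoeff [] (y ∷ 0 ∷ μ)
    base zero    = refl
    base (suc y) = refl
  hCoeff-swap [] (suc x) zero    μ = refl
  hCoeff-swap [] (suc x) (suc y) μ = refl
  hCoeff-swap (m ∷ λ') x y μ =
    trans (hCoeff-∷ m λ' (x ∷ y ∷ μ))
   (trans (hs-swap m x y μ (hCoeff λ') (hCoeff λ') (hCoeff-swap λ'))
          (sym (hCoeff-∷ m λ' (y ∷ x ∷ μ))))

  hCoeff-∷-cong : ∀ x {α β} → (∀ λ' → hCoeff λ' α ≡ hCoeff λ' β) → ∀ λ' → hCoeff λ' (x ∷ α) ≡ hCoeff λ' (x ∷ β)
  hCoeff-∷-cong x {α} {β} e λ' = begin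
    hCoeff λ' (x ∷ α) ≡⟨ hCoeff-column λ' x α ⟩
    ∑ (hs λ' x) (λ κ → hCoeff κ α) ≡⟨ ∑-cong (hs λ' x) e ⟩
    ∑ (hs λ' x) (λ κ → hCoeff κ β) ≡⟨ hCoeff-column λ' x β ⟨
    hCoeff λ' (x ∷ β) ∎

  hCoeff-↭ : ∀ {α β} → α ↭ β → ∀ λ' → hCoeff λ' α ≡ hCoeff λ' β
  hCoeff-↭ Perm.refl         λ' = refl
  hCoeff-↭ (Perm.prep x p)   λ' = hCoeff-∷-cong x (hCoeff-↭ p) λ'
  hCoeff-↭ (Perm.swap x y p) λ' =
    trans (hCoeff-∷-cong x (hCoeff-∷-cong y (hCoeff-↭ p)) λ') (hCoeff-swap λ' x y _)
  hCoeff-↭ (Perm.trans p q)  λ' = trans (hCoeff-↭ p λ') (hCoeff-↭ q λ')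

  -- Removal of two horizontal strips and the Bender-Knuth exchange

  All-strips : ∀ {Q : ℕ × List ℕ → Set} x λ' →
               (∀ y → y ≤ x → hd λ' ≤ y → All (λ p → Q (stripCons x y p)) (strips λ')) → All Q (strips (x ∷ λ'))
  All-strips x λ' q =
    All-concatMap (λ y → map (stripCons x y) (strips λ'))
      (All-filterB (hd λ' ≤ᵇ_) (All.map (λ { {y} (s≤s le) t → All.map⁺ (q y le (ℕ.≤ᵇ⇒≤ (hd λ') y t)) }) (All-upTo (suc x))))

  strips-Dec : ∀ {m λ'} → Dec m λ' → All (λ p → Dec (hd λ') (proj₂ p)) (strips λ')
  strips-Dec []                    = [] ∷ []
  strips-Dec {λ' = x ∷ λ'} (p ∷ d) =
    All-strips x λ' (λ y y≤x hd≤y → All.map (λ dν → y≤x ∷ Dec-weaken hd≤y dν) (strips-Dec d))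

  strips-size : ∀ λ' → All (λ p → proj₁ p ℕ.+ sumℕ (proj₂ p) ≡ sumℕ λ') (strips λ')
  strips-size []       = refl ∷ []
  strips-size (x ∷ λ') = All-strips x λ' λ y y≤x _ → All.map (λ {p} → step y y≤x p) (strips-size λ')
    where
    step : ∀ y → y ≤ x → ∀ p → proj₁ p ℕ.+ sumℕ (proj₂ p) ≡ sumℕ λ' →
           x ∸ y ℕ.+ proj₁ p ℕ.+ (y ℕ.+ sumℕ (proj₂ p)) ≡ x ℕ.+ sumℕ λ'
    step y y≤x (i , ν) e =
      trans (solve 4 (λ a i y s → a :+ i :+ (y :+ s) := a :+ y :+ (i :+ s)) refl (x ∸ y) i y (sumℕ ν))
            (cong₂ ℕ._+_ (ℕ.m∸n+n≡m y≤x) e)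

  module BenderKnuth where

    dn : (ℕ → List ℕ → ℕ) → List ℕ → ℕ
    dn φ λ' = ∑ (strips λ') (uncurry φ)

    -- In a recursion on rows, the condition that ν/ρ be a horizontal strip links the first
    -- remaining row of ν to the row of ρ just above it; c carries that row.
    capped : ℕ → (ℕ → ℕ → List ℕ → ℕ) → List ℕ → ℕ
    capped c φ λ' = dn (λ i ν → (hd ν ≤ᵇ c) ▹ dn (φ i) ν) λ'

    -- For fixed ρ the entries of ν in λ ⊇ ν ⊇ ρ range over independent intervals; here ν₁ is
    -- summed inside ρ₁, and c is the bound that the previous row of ρ puts on ν₁.
    rows : ℕ → (ℕ → ℕ → List ℕ → ℕ) → List ℕ → ℕ
    rows c φ []       = φ 0 0 []
    rows c φ (x ∷ λ') = ∑ (upTo (suc x)) λ ρ → ∑ (upTo (suc x)) λ ν →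
      ((hd λ' ≤ᵇ ν) ∧ (ν ≤ᵇ c) ∧ (ρ <ᵇ suc ν)) ▹ rows ρ (λ i j r → φ (x ∸ ν + i) (ν ∸ ρ + j) (ρ ∷ r)) λ'

    -- On the left all of ν is chosen before ρ, on the right both are chosen row by row. Moving the
    -- choice of ρ₁ in front of the lower rows of ν turns its range into the guard ρ₁ ≤ ν₁, and ρ₁
    -- becomes the cap for these rows.
    capped≡rows : ∀ c φ λ' → capped c φ λ' ≡ rows c φ λ'
    capped≡rows c φ [] = trans (ℕ.+-identityʳ _) (ℕ.+-identityʳ _)
    capped≡rows c φ (x ∷ λ') = begin
      capped c φ (x ∷ λ')
        ≡⟨ ∑-strips x λ' _ ⟩
      ∑ (upTo (suc x)) (λ ν → (hd λ' ≤ᵇ ν) ▹ ∑ (strips λ') (λ p → (ν ≤ᵇ c) ▹ dn (φ (x ∸ ν + proj₁ p)) (ν ∷ proj₂ p)))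
        ≡⟨ ∑-upTo-cong (suc x) (λ { ν (s≤s le) → cong ((hd λ' ≤ᵇ ν) ▹_) (inner ν le) }) ⟩
      ∑ (upTo (suc x)) (λ ν → (hd λ' ≤ᵇ ν) ▹ (ν ≤ᵇ c) ▹ ∑ (upTo (suc x)) (λ ρ → (ρ <ᵇ suc ν) ▹ rows ρ (Φ ν ρ) λ'))
        ≡⟨ ∑-cong (upTo (suc x)) merge ⟩
      ∑ (upTo (suc x)) (λ ν → ∑ (upTo (suc x)) (λ ρ → ((hd λ' ≤ᵇ ν) ∧ (ν ≤ᵇ c) ∧ (ρ <ᵇ suc ν)) ▹ rows ρ (Φ ν ρ) λ'))
        ≡⟨ ∑-swap (upTo (suc x)) (upTo (suc x)) _ ⟩
      rows c φ (x ∷ λ') ∎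
      where
      Φ : ℕ → ℕ → ℕ → ℕ → List ℕ → ℕ
      Φ ν ρ i j r = φ (x ∸ ν + i) (ν ∸ ρ + j) (ρ ∷ r)
      X : ℕ → ℕ → ℕ × List ℕ → ℕ
      X ν ρ p = (hd (proj₂ p) ≤ᵇ ρ) ▹ dn (Φ ν ρ (proj₁ p)) (proj₂ p)
      inner : ∀ ν → ν ≤ x → ∑ (strips λ') (λ p → (ν ≤ᵇ c) ▹ dn (φ (x ∸ ν + proj₁ p)) (ν ∷ proj₂ p))
                          ≡ (ν ≤ᵇ c) ▹ ∑ (upTo (suc x)) (λ ρ → (ρ <ᵇ suc ν) ▹ rows ρ (Φ ν ρ) λ')
      inner ν ν≤x = begin
        ∑ (strips λ') (λ p → (ν ≤ᵇ c) ▹ dn (φ (x ∸ ν + proj₁ p)) (ν ∷ proj₂ p))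
          ≡⟨ ∑-▹ (ν ≤ᵇ c) (strips λ') _ ⟩
        (ν ≤ᵇ c) ▹ ∑ (strips λ') (λ p → dn (φ (x ∸ ν + proj₁ p)) (ν ∷ proj₂ p))
          ≡⟨ cong ((ν ≤ᵇ c) ▹_) (begin
            ∑ (strips λ') (λ p → dn (φ (x ∸ ν + proj₁ p)) (ν ∷ proj₂ p))
              ≡⟨ ∑-cong (strips λ') (λ p → trans (∑-strips ν (proj₂ p) (uncurry (φ (x ∸ ν + proj₁ p)))) (∑-upTo-extend (s≤s ν≤x) (λ ρ → X ν ρ p))) ⟩
            ∑ (strips λ') (λ p → ∑ (upTo (suc x)) (λ ρ → (ρ <ᵇ suc ν) ▹ X ν ρ p))
              ≡⟨ ∑-swap (strips λ') (upTo (suc x)) _ ⟩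
            ∑ (upTo (suc x)) (λ ρ → ∑ (strips λ') (λ p → (ρ <ᵇ suc ν) ▹ X ν ρ p))
              ≡⟨ ∑-cong (upTo (suc x)) (λ ρ → trans (∑-▹ (ρ <ᵇ suc ν) (strips λ') (X ν ρ)) (cong ((ρ <ᵇ suc ν) ▹_) (capped≡rows ρ (Φ ν ρ) λ'))) ⟩
            ∑ (upTo (suc x)) (λ ρ → (ρ <ᵇ suc ν) ▹ rows ρ (Φ ν ρ) λ') ∎) ⟩
        (ν ≤ᵇ c) ▹ ∑ (upTo (suc x)) (λ ρ → (ρ <ᵇ suc ν) ▹ rows ρ (Φ ν ρ) λ') ∎
      merge : ∀ ν → (hd λ' ≤ᵇ ν) ▹ (ν ≤ᵇ c) ▹ ∑ (upTo (suc x)) (λ ρ → (ρ <ᵇ suc ν) ▹ rows ρ (Φ ν ρ) λ')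
                  ≡ ∑ (upTo (suc x)) (λ ρ → ((hd λ' ≤ᵇ ν) ∧ (ν ≤ᵇ c) ∧ (ρ <ᵇ suc ν)) ▹ rows ρ (Φ ν ρ) λ')
      merge ν with hd λ' ≤ᵇ ν | ν ≤ᵇ c
      ... | true  | true  = refl
      ... | true  | false = sym (∑-zero (upTo (suc x)))
      ... | false | _     = sym (∑-zero (upTo (suc x)))

    ≤ᵇ≡<ᵇ : ∀ a b → (a ≤ᵇ b) ≡ (a <ᵇ suc b)
    ≤ᵇ≡<ᵇ zero    b = refl
    ≤ᵇ≡<ᵇ (suc a) b = refl

    ∑-interval : ∀ lo d x (G : ℕ → ℕ) → d + lo ≤ x →
                 ∑ (upTo (suc x)) (λ ν → ((lo ≤ᵇ ν) ∧ (ν ≤ᵇ d + lo)) ▹ G ν) ≡ ∑⊕ d (λ u _ → G (u + lo))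
    ∑-interval zero d x G le = begin
      ∑ (upTo (suc x)) (λ ν → (ν ≤ᵇ d + 0) ▹ G ν)
        ≡⟨ ∑-cong (upTo (suc x)) (λ ν → cong (_▹ G ν) (trans (cong (ν ≤ᵇ_) (ℕ.+-identityʳ d)) (≤ᵇ≡<ᵇ ν d))) ⟩
      ∑ (upTo (suc x)) (λ ν → (ν <ᵇ suc d) ▹ G ν)
        ≡⟨ ∑-upTo-extend (s≤s (subst (_≤ x) (ℕ.+-identityʳ d) le)) G ⟨
      ∑ (upTo (suc d)) G
        ≡⟨ ∑-upTo-⊕ d (λ u _ → G u) ⟩
      ∑⊕ d (λ u _ → G u)
        ≡⟨ ∑⊕-cong d (λ u _ _ → cong G (sym (ℕ.+-identityʳ u))) ⟩
      ∑⊕ d (λ u _ → G (u + 0)) ∎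
    ∑-interval (suc lo) d x G le with x | subst (_≤ x) (ℕ.+-suc d lo) le
    ... | suc x′ | s≤s le′ = begin
      ∑ (upTo (suc (suc x′))) (λ ν → ((suc lo ≤ᵇ ν) ∧ (ν ≤ᵇ d + suc lo)) ▹ G ν)
        ≡⟨ ∑-upTo-suc (suc x′) (λ ν → ((suc lo ≤ᵇ ν) ∧ (ν ≤ᵇ d + suc lo)) ▹ G ν) ⟩
      ∑ (upTo (suc x′)) (λ ν → ((suc lo ≤ᵇ suc ν) ∧ (suc ν ≤ᵇ d + suc lo)) ▹ G (suc ν))
        ≡⟨ ∑-cong (upTo (suc x′)) (λ ν → cong (_▹ G (suc ν)) (cong₂ _∧_ (sym (≤ᵇ≡<ᵇ lo ν)) (trans (cong (suc ν ≤ᵇ_) (ℕ.+-suc d lo)) (sym (≤ᵇ≡<ᵇ ν (d + lo)))))) ⟩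
      ∑ (upTo (suc x′)) (λ ν → ((lo ≤ᵇ ν) ∧ (ν ≤ᵇ d + lo)) ▹ G (suc ν))
        ≡⟨ ∑-interval lo d x′ (G ∘ suc) le′ ⟩
      ∑⊕ d (λ u _ → G (suc (u + lo)))
        ≡⟨ ∑⊕-cong d (λ u _ _ → cong G (sym (ℕ.+-suc u lo))) ⟩
      ∑⊕ d (λ u _ → G (u + suc lo)) ∎

    -- Mirror images in the interval from lo to hi are u + lo and v + lo with u + v + lo = hi; if
    -- the interval is empty, both sides vanish.
    ∑-reflect : ∀ lo hi x (G G′ : ℕ → ℕ) → hi ≤ x → (∀ u v → u + v + lo ≡ hi → G (u + lo) ≡ G′ (v + lo)) →
                ∑ (upTo (suc x)) (λ ν → ((lo ≤ᵇ ν) ∧ (ν ≤ᵇ hi)) ▹ G ν) ≡ ∑ (upTo (suc x)) (λ ν → ((lo ≤ᵇ ν) ∧ (ν ≤ᵇ hi)) ▹ G′ ν)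
    ∑-reflect lo hi x G G′ hi≤x e with lo ℕ.≤? hi
    ... | no lo≰hi = ∑-cong (upTo (suc x)) λ ν → trans (empty ν G) (sym (empty ν G′))
      where
      empty : ∀ ν (G : ℕ → ℕ) → ((lo ≤ᵇ ν) ∧ (ν ≤ᵇ hi)) ▹ G ν ≡ 0
      empty ν G = ▹-false ((lo ≤ᵇ ν) ∧ (ν ≤ᵇ hi)) λ t →
        ⊥-elim (lo≰hi (ℕ.≤-trans (ℕ.≤ᵇ⇒≤ lo ν (T-∧₁ t)) (ℕ.≤ᵇ⇒≤ ν hi (T-∧₂ {lo ≤ᵇ ν} t))))
    ... | yes lo≤hi with hi ∸ lo | ℕ.m∸n+n≡m lo≤hi
    ... | d | refl = begin
      ∑ (upTo (suc x)) (λ ν → ((lo ≤ᵇ ν) ∧ (ν ≤ᵇ d + lo)) ▹ G ν) ≡⟨ ∑-interval lo d x G hi≤x ⟩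
      ∑⊕ d (λ u _ → G (u + lo)) ≡⟨ ∑⊕-cong d (λ u v p → e u v (cong (_+ lo) p)) ⟩
      ∑⊕ d (λ _ v → G′ (v + lo)) ≡⟨ ∑⊕-comm d (λ _ v → G′ (v + lo)) ⟩
      ∑⊕ d (λ u _ → G′ (u + lo)) ≡⟨ ∑-interval lo d x G′ hi≤x ⟨
      ∑ (upTo (suc x)) (λ ν → ((lo ≤ᵇ ν) ∧ (ν ≤ᵇ d + lo)) ▹ G′ ν) ∎

    -- Reflecting every interval exchanges |λ/ν| and |ν/ρ|; the hd λ ∸ c boxes of the first row
    -- beyond the cap are always removed first.
    rows-sym : ∀ λ' c (φ φ′ : ℕ → ℕ → List ℕ → ℕ) → (∀ i j r → φ (hd λ' ∸ c + i) j r ≡ φ′ (hd λ' ∸ c + j) i r) → rows c φ λ' ≡ rows c φ′ λ'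
    rows-sym [] c φ φ′ e = subst (λ z → φ (z + 0) 0 [] ≡ φ′ (z + 0) 0 []) (ℕ.0∸n≡0 c) (e 0 0 [])
    rows-sym (x ∷ λ') c φ φ′ e = ∑-cong (upTo (suc x)) λ ρ → begin
      ∑ (upTo (suc x)) (λ ν → cond ρ ν ▹ G φ ρ ν)
        ≡⟨ ∑-upTo-cong (suc x) (λ { ν (s≤s le) → cong (_▹ G φ ρ ν) (cond≡ ρ ν le) }) ⟩
      ∑ (upTo (suc x)) (λ ν → ((lo ρ ≤ᵇ ν) ∧ (ν ≤ᵇ hi)) ▹ G φ ρ ν)
        ≡⟨ ∑-reflect (lo ρ) hi x (G φ ρ) (G φ′ ρ) (ℕ.m⊓n≤n c x) (λ u v p → rows-sym λ' ρ _ _ (step ρ u v p)) ⟩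
      ∑ (upTo (suc x)) (λ ν → ((lo ρ ≤ᵇ ν) ∧ (ν ≤ᵇ hi)) ▹ G φ′ ρ ν)
        ≡⟨ ∑-upTo-cong (suc x) (λ { ν (s≤s le) → cong (_▹ G φ′ ρ ν) (cond≡ ρ ν le) }) ⟨
      ∑ (upTo (suc x)) (λ ν → cond ρ ν ▹ G φ′ ρ ν) ∎
      where
      hi = c ⊓ x
      -- This is the larger of `hd λ'` and ρ, written so that subtracting ρ leaves `hd λ' ∸ ρ`, the
      -- excess of the next row over its cap ρ.
      lo : ℕ → ℕ
      lo ρ = (hd λ' ∸ ρ) + ρ
      G : (ℕ → ℕ → List ℕ → ℕ) → ℕ → ℕ → ℕ
      G φ ρ ν = rows ρ (λ i j r → φ (x ∸ ν + i) (ν ∸ ρ + j) (ρ ∷ r)) λ'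
      cond : ℕ → ℕ → Bool
      cond ρ ν = (hd λ' ≤ᵇ ν) ∧ (ν ≤ᵇ c) ∧ (ρ <ᵇ suc ν)
      lo-lub : ∀ {ρ ν} → hd λ' ≤ ν → ρ ≤ ν → lo ρ ≤ ν
      lo-lub {ρ} {ν} p q with ℕ.≤-total ρ (hd λ')
      ... | inj₁ r = subst (_≤ ν) (sym (ℕ.m∸n+n≡m r)) p
      ... | inj₂ r = subst (λ z → z + ρ ≤ ν) (sym (ℕ.m≤n⇒m∸n≡0 r)) q
      cond≡ : ∀ ρ ν → ν ≤ x → cond ρ ν ≡ (lo ρ ≤ᵇ ν) ∧ (ν ≤ᵇ hi)
      cond≡ ρ ν ν≤x = T-ext to from
        where
        to : T (cond ρ ν) → T ((lo ρ ≤ᵇ ν) ∧ (ν ≤ᵇ hi))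
        to t = T-∧ (ℕ.≤⇒≤ᵇ (lo-lub (ℕ.≤ᵇ⇒≤ (hd λ') ν (T-∧₁ t)) (ℕ.≤-pred (ℕ.<ᵇ⇒< ρ (suc ν) (T-∧₂ {ν ≤ᵇ c} (T-∧₂ {hd λ' ≤ᵇ ν} t))))))
                   (ℕ.≤⇒≤ᵇ (ℕ.⊓-glb (ℕ.≤ᵇ⇒≤ ν c (T-∧₁ (T-∧₂ {hd λ' ≤ᵇ ν} t))) ν≤x))
        from : T ((lo ρ ≤ᵇ ν) ∧ (ν ≤ᵇ hi)) → T (cond ρ ν)
        from t = T-∧ (ℕ.≤⇒≤ᵇ (ℕ.≤-trans (subst (hd λ' ≤_) (ℕ.+-comm ρ _) (ℕ.m≤n+m∸n (hd λ') ρ)) lo≤ν))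
                (T-∧ (ℕ.≤⇒≤ᵇ (ℕ.≤-trans (ℕ.≤ᵇ⇒≤ ν hi (T-∧₂ {lo ρ ≤ᵇ ν} t)) (ℕ.m⊓n≤m c x)))
                     (ℕ.<⇒<ᵇ (s≤s (ℕ.≤-trans (ℕ.m≤n+m ρ (hd λ' ∸ ρ)) lo≤ν))))
          where
          lo≤ν : lo ρ ≤ ν
          lo≤ν = ℕ.≤ᵇ⇒≤ (lo ρ) ν (T-∧₁ t)
      rem : ∀ ρ u v → u + v + lo ρ ≡ hi → x ∸ (u + lo ρ) ≡ (x ∸ c) + v
      rem ρ u v p = begin
        x ∸ (u + lo ρ) ≡⟨ cong (_∸ (u + lo ρ)) (ℕ.m⊓n+n∸m≡n c x) ⟨
        hi + (x ∸ c) ∸ (u + lo ρ) ≡⟨ cong (λ h → h + (x ∸ c) ∸ (u + lo ρ)) p ⟨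
        u + v + lo ρ + (x ∸ c) ∸ (u + lo ρ) ≡⟨ cong (_∸ (u + lo ρ)) (solve 4 (λ u v l e → u :+ v :+ l :+ e := u :+ l :+ (e :+ v)) refl u v (lo ρ) (x ∸ c)) ⟩
        u + lo ρ + ((x ∸ c) + v) ∸ (u + lo ρ) ≡⟨ ℕ.m+n∸m≡n (u + lo ρ) _ ⟩
        (x ∸ c) + v ∎
      rest : ∀ ρ u → u + lo ρ ∸ ρ ≡ u + (hd λ' ∸ ρ)
      rest ρ u = trans (cong (_∸ ρ) (sym (ℕ.+-assoc u (hd λ' ∸ ρ) ρ))) (ℕ.m+n∸n≡m (u + (hd λ' ∸ ρ)) ρ)
      step : ∀ ρ u v → u + v + lo ρ ≡ hi → ∀ i j r →
             φ (x ∸ (u + lo ρ) + (hd λ' ∸ ρ + i)) (u + lo ρ ∸ ρ + j) (ρ ∷ r)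
           ≡ φ′ (x ∸ (v + lo ρ) + (hd λ' ∸ ρ + j)) (v + lo ρ ∸ ρ + i) (ρ ∷ r)
      step ρ u v p i j r = begin
        φ (x ∸ (u + lo ρ) + (e′ + i)) (u + lo ρ ∸ ρ + j) (ρ ∷ r)
          ≡⟨ cong₂ (λ a b → φ (a + (e′ + i)) (b + j) (ρ ∷ r)) (rem ρ u v p) (rest ρ u) ⟩
        φ ((x ∸ c) + v + (e′ + i)) (u + e′ + j) (ρ ∷ r)
          ≡⟨ cong (λ a → φ a (u + e′ + j) (ρ ∷ r)) (ℕ.+-assoc (x ∸ c) v (e′ + i)) ⟩
        φ ((x ∸ c) + (v + (e′ + i))) (u + e′ + j) (ρ ∷ r)
          ≡⟨ e (v + (e′ + i)) (u + e′ + j) (ρ ∷ r) ⟩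
        φ′ ((x ∸ c) + (u + e′ + j)) (v + (e′ + i)) (ρ ∷ r)
          ≡⟨ cong₂ (λ a b → φ′ a b (ρ ∷ r)) (trans (cong ((x ∸ c) +_) (ℕ.+-assoc u e′ j)) (sym (ℕ.+-assoc (x ∸ c) u (e′ + j)))) (sym (ℕ.+-assoc v e′ i)) ⟩
        φ′ ((x ∸ c) + u + (e′ + j)) (v + e′ + i) (ρ ∷ r)
          ≡⟨ cong₂ (λ a b → φ′ (a + (e′ + j)) (b + i) (ρ ∷ r)) (rem ρ v u (trans (cong (_+ lo ρ) (ℕ.+-comm v u)) p)) (rest ρ v) ⟨
        φ′ (x ∸ (v + lo ρ) + (e′ + j)) (v + lo ρ ∸ ρ + i) (ρ ∷ r) ∎
        where e′ = hd λ' ∸ ρ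

    -- The cap λ₁ is vacuous, and it makes the excess in `rows-sym` equal to 0.
    double≡capped : ∀ (φ : ℕ → ℕ → List ℕ → ℕ) λ' → dn (λ i ν → dn (φ i) ν) λ' ≡ capped (hd λ') φ λ'
    double≡capped φ []       = refl
    double≡capped φ (x ∷ λ') = ∑-congAll (All-strips x λ' (λ y y≤x _ → All.universal (λ p →
      cong (_▹ dn (φ (x ∸ y + proj₁ p)) (y ∷ proj₂ p)) (sym (T-ext {y ≤ᵇ x} {true} (λ _ → tt) (λ _ → ℕ.≤⇒≤ᵇ y≤x)))) (strips λ')))

    dn-swap : ∀ (φ φ′ : ℕ → ℕ → List ℕ → ℕ) λ' → (∀ i j r → φ i j r ≡ φ′ j i r) → dn (λ i ν → dn (φ i) ν) λ' ≡ dn (λ i ν → dn (φ′ i) ν) λ'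
    dn-swap φ φ′ λ' e = begin
      dn (λ i ν → dn (φ i) ν) λ' ≡⟨ trans (double≡capped φ λ') (capped≡rows (hd λ') φ λ') ⟩
      rows (hd λ') φ λ' ≡⟨ rows-sym λ' (hd λ') φ φ′ cond ⟩
      rows (hd λ') φ′ λ' ≡⟨ trans (double≡capped φ′ λ') (capped≡rows (hd λ') φ′ λ') ⟨
      dn (λ i ν → dn (φ′ i) ν) λ' ∎
      where
      cond : ∀ i j r → φ (hd λ' ∸ hd λ' + i) j r ≡ φ′ (hd λ' ∸ hd λ' + j) i r
      cond i j r rewrite ℕ.n∸n≡0 (hd λ') = e i j r

  open BenderKnuth using (dn-swap; ≤ᵇ≡<ᵇ)

  ▹-comm : ∀ c d u → c ▹ d ▹ u ≡ d ▹ c ▹ u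
  ▹-comm true  d     u = refl
  ▹-comm false true  u = refl
  ▹-comm false false u = refl

  -- Kostka numbers

  -- Kr α λ counts the semistandard tableaux of shape λ whose content, read from the largest letter, is α.
  Kr : List ℕ → List ℕ → ℕ
  Kr []      λ' = allB (_≡ᵇ 0) λ' ▹ 1
  Kr (m ∷ α) λ' = ∑ (strips λ') (λ p → (proj₁ p ≡ᵇ m) ▹ Kr α (proj₂ p))

  Kr-swap : ∀ a b α λ' → Kr (a ∷ b ∷ α) λ' ≡ Kr (b ∷ a ∷ α) λ'
  Kr-swap a b α λ' = begin
    Kr (a ∷ b ∷ α) λ'
      ≡⟨ ∑-cong (strips λ') (λ p → sym (∑-▹ (proj₁ p ≡ᵇ a) (strips (proj₂ p)) _)) ⟩
    ∑ (strips λ') (λ p → ∑ (strips (proj₂ p)) (λ q → (proj₁ p ≡ᵇ a) ▹ (proj₁ q ≡ᵇ b) ▹ Kr α (proj₂ q)))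
      ≡⟨ dn-swap (λ i j ρ → (i ≡ᵇ a) ▹ (j ≡ᵇ b) ▹ Kr α ρ) (λ i j ρ → (i ≡ᵇ b) ▹ (j ≡ᵇ a) ▹ Kr α ρ) λ' (λ i j ρ → ▹-comm (i ≡ᵇ a) (j ≡ᵇ b) (Kr α ρ)) ⟩
    ∑ (strips λ') (λ p → ∑ (strips (proj₂ p)) (λ q → (proj₁ p ≡ᵇ b) ▹ (proj₁ q ≡ᵇ a) ▹ Kr α (proj₂ q)))
      ≡⟨ ∑-cong (strips λ') (λ p → ∑-▹ (proj₁ p ≡ᵇ b) (strips (proj₂ p)) _) ⟩
    Kr (b ∷ a ∷ α) λ' ∎

  Kr-∷-cong : ∀ x α β → (∀ λ' → Kr α λ' ≡ Kr β λ') → ∀ λ' → Kr (x ∷ α) λ' ≡ Kr (x ∷ β) λ'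
  Kr-∷-cong x α β e λ' = ∑-cong (strips λ') (λ p → cong ((proj₁ p ≡ᵇ x) ▹_) (e (proj₂ p)))

  Kr-↭ : ∀ {α β} → α ↭ β → ∀ λ' → Kr α λ' ≡ Kr β λ'
  Kr-↭ Perm.refl         λ' = refl
  Kr-↭ (Perm.prep {α} {β} x p) λ' = Kr-∷-cong x α β (Kr-↭ p) λ'
  Kr-↭ (Perm.swap {α} {β} x y p) λ' =
    trans (Kr-∷-cong x (y ∷ α) (y ∷ β) (Kr-∷-cong y α β (Kr-↭ p)) λ') (Kr-swap x y β λ')
  Kr-↭ (Perm.trans p q)  λ' = trans (Kr-↭ p λ') (Kr-↭ q λ')

  -- Nothing may remain after the only letter is removed, so only the choice 0 for the new first row
  -- survives, and it forces the second row to be empty already.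
  Kr-single : ∀ m x λ' → Dec x λ' → Kr (m ∷ []) (x ∷ λ') ≡ (x ≡ᵇ m) ▹ Kr [] λ'
  Kr-single m x λ' d = begin
    ∑ (strips (x ∷ λ')) φ
      ≡⟨ ∑-strips x λ' φ ⟩
    ∑ (upTo (suc x)) (λ y → (hd λ' ≤ᵇ y) ▹ ∑ (strips λ') (φ ∘ stripCons x y))
      ≡⟨ ∑-upTo-suc x (λ y → (hd λ' ≤ᵇ y) ▹ ∑ (strips λ') (φ ∘ stripCons x y)) ⟩
    (hd λ' ≤ᵇ 0) ▹ ∑ (strips λ') (φ ∘ stripCons x 0)
      + ∑ (upTo x) (λ y → (hd λ' ≤ᵇ suc y) ▹ ∑ (strips λ') (φ ∘ stripCons x (suc y)))
      ≡⟨ cong ((hd λ' ≤ᵇ 0) ▹ ∑ (strips λ') (φ ∘ stripCons x 0) +_)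
           (∑-vanish (upTo x) (λ y → ▹-false (hd λ' ≤ᵇ suc y) (λ _ → ∑-vanish (strips λ') (λ p → ▹-zero (x ∸ suc y + proj₁ p ≡ᵇ m))))) ⟩
    (hd λ' ≤ᵇ 0) ▹ ∑ (strips λ') (φ ∘ stripCons x 0) + 0
      ≡⟨ ℕ.+-identityʳ _ ⟩
    (hd λ' ≤ᵇ 0) ▹ ∑ (strips λ') (φ ∘ stripCons x 0)
      ≡⟨ last λ' d ⟩
    (x ≡ᵇ m) ▹ allB (_≡ᵇ 0) λ' ▹ 1 ∎
    where
    φ : ℕ × List ℕ → ℕ
    φ p = (proj₁ p ≡ᵇ m) ▹ Kr [] (proj₂ p)
    last : ∀ λ' → Dec x λ' → (hd λ' ≤ᵇ 0) ▹ ∑ (strips λ') (φ ∘ stripCons x 0) ≡ (x ≡ᵇ m) ▹ allB (_≡ᵇ 0) λ' ▹ 1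
    last []           d        = trans (ℕ.+-identityʳ _) (cong (λ z → (z ≡ᵇ m) ▹ 1) (ℕ.+-identityʳ x))
    last (suc y ∷ λ') d        = sym (▹-zero (x ≡ᵇ m))
    last (zero ∷ λ')  (p ∷ d)  = trans (strips-zero (z≤n ∷ d) (φ ∘ stripCons x 0)) (cong (λ z → (z ≡ᵇ m) ▹ allB (_≡ᵇ 0) λ' ▹ 1) (ℕ.+-identityʳ x))

  -- If λ₁ ≤ m, a tableau with m letters 1 has its first row consist of exactly these.
  Kr-first : ∀ α m x λ' → x ≤ m → Dec x λ' → Kr (α ++ m ∷ []) (x ∷ λ') ≡ (x ≡ᵇ m) ▹ Kr α λ'
  Kr-first []      m x λ' x≤m d = Kr-single m x λ' d
  Kr-first (a ∷ α) m x λ' x≤m d = begin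
    Kr (a ∷ α ++ m ∷ []) (x ∷ λ')
      ≡⟨ ∑-strips x λ' _ ⟩
    ∑ (upTo (suc x)) (λ y → (hd λ' ≤ᵇ y) ▹ ∑ (strips λ') (λ p → (x ∸ y + proj₁ p ≡ᵇ a) ▹ Kr (α ++ m ∷ []) (y ∷ proj₂ p)))
      ≡⟨ ∑-upTo-cong (suc x) (λ { y (s≤s le) → ▹-cong (hd λ' ≤ᵇ y) (λ t → inner y le (ℕ.≤ᵇ⇒≤ (hd λ') y t)) }) ⟩
    ∑ (upTo (suc x)) Y
      ≡⟨ ∑-upTo-snoc x Y ⟩
    ∑ (upTo x) Y + Y x
      ≡⟨ cong₂ _+_ (trans (∑-upTo-cong x small) (∑-zero (upTo x))) top ⟩
    (x ≡ᵇ m) ▹ Kr (a ∷ α) λ' ∎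
    where
    Y : ℕ → ℕ
    Y y = (hd λ' ≤ᵇ y) ▹ (y ≡ᵇ m) ▹ ∑ (strips λ') (λ p → (x ∸ y + proj₁ p ≡ᵇ a) ▹ Kr α (proj₂ p))
    inner : ∀ y → y ≤ x → hd λ' ≤ y →
            ∑ (strips λ') (λ p → (x ∸ y + proj₁ p ≡ᵇ a) ▹ Kr (α ++ m ∷ []) (y ∷ proj₂ p))
          ≡ (y ≡ᵇ m) ▹ ∑ (strips λ') (λ p → (x ∸ y + proj₁ p ≡ᵇ a) ▹ Kr α (proj₂ p))
    inner y y≤x hd≤y = trans
      (∑-congAll (All.map (λ {p} dν → trans (cong ((x ∸ y + proj₁ p ≡ᵇ a) ▹_) (Kr-first α m y (proj₂ p) (ℕ.≤-trans y≤x x≤m) (Dec-weaken hd≤y dν)))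
                                      (▹-comm (x ∸ y + proj₁ p ≡ᵇ a) (y ≡ᵇ m) (Kr α (proj₂ p)))) (strips-Dec d)))
      (∑-▹ (y ≡ᵇ m) (strips λ') _)
    small : ∀ y → y < x → Y y ≡ 0
    small y y<x = ▹-false (hd λ' ≤ᵇ y) (λ _ → ▹-false (y ≡ᵇ m) (λ t → ⊥-elim (ℕ.<⇒≱ y<x (subst (x ≤_) (sym (ℕ.≡ᵇ⇒≡ y m t)) x≤m))))
    top : Y x ≡ (x ≡ᵇ m) ▹ Kr (a ∷ α) λ'
    top rewrite T-ext {hd λ' ≤ᵇ x} {true} (λ _ → tt) (λ _ → ℕ.≤⇒≤ᵇ (Dec-hd d)) | ℕ.n∸n≡0 x = refl

  -- Semistandard fillings as chains of horizontal strips

  ∑-rowsOf : ∀ ℓ r (f : List ℕ → ℕ) → ∑ (rowsOf ℓ (suc r)) f ≡ ∑ (upTo ℓ) (λ e → ∑ (rowsOf ℓ r) (λ R → f (suc e ∷ R)))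
  ∑-rowsOf ℓ r f = begin
    ∑ (rowsOf ℓ (suc r)) f
      ≡⟨ ∑-concatMap (λ e → map (e ∷_) (rowsOf ℓ r)) (applyUpTo suc ℓ) f ⟩
    ∑ (applyUpTo suc ℓ) (λ e → ∑ (map (e ∷_) (rowsOf ℓ r)) f)
      ≡⟨ ∑-applyUpTo suc ℓ (λ e → ∑ (map (e ∷_) (rowsOf ℓ r)) f) ⟩
    ∑ (upTo ℓ) (λ e → ∑ (map (suc e ∷_) (rowsOf ℓ r)) f)
      ≡⟨ ∑-cong (upTo ℓ) (λ e → ∑-map (suc e ∷_) (rowsOf ℓ r) f) ⟩
    ∑ (upTo ℓ) (λ e → ∑ (rowsOf ℓ r) (λ R → f (suc e ∷ R))) ∎

  ∑-fillings : ∀ ℓ r λ' (f : List (List ℕ) → ℕ) →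
               ∑ (fillings ℓ (r ∷ λ')) f ≡ ∑ (rowsOf ℓ r) (λ R → ∑ (fillings ℓ λ') (λ T → f (R ∷ T)))
  ∑-fillings ℓ r λ' f = trans (∑-concatMap (λ R → map (R ∷_) (fillings ℓ λ')) (rowsOf ℓ r) f)
                              (∑-cong (rowsOf ℓ r) (λ R → ∑-map (R ∷_) (fillings ℓ λ') f))

  Row : ℕ → List ℕ → ℕ → Set
  Row ℓ R r = length R ≡ r × All (_≤ ℓ) R

  All-rowsOf : ∀ ℓ r → All (λ R → Row ℓ R r) (rowsOf ℓ r)
  All-rowsOf ℓ zero    = (refl , []) ∷ []
  All-rowsOf ℓ (suc r) = All-concatMap (λ e → map (e ∷_) (rowsOf ℓ r))
    (All.applyUpTo⁺₁ suc ℓ (λ e<ℓ → All.map⁺ (All.map (λ { (p , q) → cong suc p , e<ℓ ∷ q }) (All-rowsOf ℓ r))))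

  All-fillings : ∀ ℓ λ' → All (λ T → Pointwise (Row ℓ) T λ') (fillings ℓ λ')
  All-fillings ℓ []       = [] ∷ []
  All-fillings ℓ (r ∷ λ') = All-concatMap (λ R → map (R ∷_) (fillings ℓ λ'))
    (All.map (λ pR → All.map⁺ (All.map (pR ∷_) (All-fillings ℓ λ'))) (All-rowsOf ℓ r))

  strips-⊆ : ∀ λ' → All (λ p → Pointwise _≤_ (proj₂ p) λ') (strips λ')
  strips-⊆ []       = [] ∷ []
  strips-⊆ (x ∷ λ') = All-strips x λ' (λ y y≤x _ → All.map (y≤x ∷_) (strips-⊆ λ'))

  -- A weakly increasing row ends in a block of letters ℓ + 1, and y is the length of what precedes
  -- this block. In the induction lb is the preceding letter.
  rows-split : ∀ ℓ lb r (g : List ℕ → ℕ) → lb ≤ suc ℓ →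
               ∑ (rowsOf (suc ℓ) r) (λ R → weakInc (lb ∷ R) ▹ g R)
             ≡ ∑ (upTo (suc r)) (λ y → ∑ (rowsOf ℓ y) (λ R → weakInc (lb ∷ R) ▹ g (R ++ replicate (r ∸ y) (suc ℓ))))
  rows-split ℓ lb zero    g le = sym (ℕ.+-identityʳ _)
  rows-split ℓ lb (suc r) g le = begin
    ∑ (rowsOf (suc ℓ) (suc r)) (λ R → weakInc (lb ∷ R) ▹ g R)
      ≡⟨ ∑-rowsOf (suc ℓ) r (λ R → weakInc (lb ∷ R) ▹ g R) ⟩
    ∑ (upTo (suc ℓ)) (λ e → ∑ (rowsOf (suc ℓ) r) (λ R → ((lb ≤ᵇ suc e) ∧ weakInc (suc e ∷ R)) ▹ g (suc e ∷ R)))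
      ≡⟨ ∑-upTo-cong (suc ℓ) (λ e e<ℓ → trans (pull e (rowsOf (suc ℓ) r) (λ R → g (suc e ∷ R)))
           (cong ((lb ≤ᵇ suc e) ▹_) (rows-split ℓ (suc e) r (λ R → g (suc e ∷ R)) e<ℓ))) ⟩
    ∑ (upTo (suc ℓ)) (λ e → (lb ≤ᵇ suc e) ▹ ∑ (upTo (suc r)) (A e))
      ≡⟨ ∑-upTo-snoc ℓ (λ e → (lb ≤ᵇ suc e) ▹ ∑ (upTo (suc r)) (A e)) ⟩
    ∑ (upTo ℓ) (λ e → (lb ≤ᵇ suc e) ▹ ∑ (upTo (suc r)) (A e)) + (lb ≤ᵇ suc ℓ) ▹ ∑ (upTo (suc r)) (A ℓ)
      ≡⟨ cong₂ _+_ shorter full ⟩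
    ∑ (upTo (suc r)) (B ∘ suc) + B 0
      ≡⟨ ℕ.+-comm _ (B 0) ⟩
    B 0 + ∑ (upTo (suc r)) (B ∘ suc)
      ≡⟨ ∑-upTo-suc (suc r) B ⟨
    ∑ (upTo (suc (suc r))) B ∎
    where
    A : ℕ → ℕ → ℕ
    A e y = ∑ (rowsOf ℓ y) (λ R → weakInc (suc e ∷ R) ▹ g (suc e ∷ R ++ replicate (r ∸ y) (suc ℓ)))
    B : ℕ → ℕ
    B y = ∑ (rowsOf ℓ y) (λ R → weakInc (lb ∷ R) ▹ g (R ++ replicate (suc r ∸ y) (suc ℓ)))
    pull : ∀ e Rs (f : List ℕ → ℕ) → ∑ Rs (λ R → ((lb ≤ᵇ suc e) ∧ weakInc (suc e ∷ R)) ▹ f R)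
                                   ≡ (lb ≤ᵇ suc e) ▹ ∑ Rs (λ R → weakInc (suc e ∷ R) ▹ f R)
    pull e Rs f = trans (∑-cong Rs (λ R → ▹-∧ (lb ≤ᵇ suc e) (weakInc (suc e ∷ R)) (f R))) (∑-▹ (lb ≤ᵇ suc e) Rs _)
    shorter : ∑ (upTo ℓ) (λ e → (lb ≤ᵇ suc e) ▹ ∑ (upTo (suc r)) (A e)) ≡ ∑ (upTo (suc r)) (B ∘ suc)
    shorter = begin
      ∑ (upTo ℓ) (λ e → (lb ≤ᵇ suc e) ▹ ∑ (upTo (suc r)) (A e))
        ≡⟨ ∑-cong (upTo ℓ) (λ e → sym (∑-▹ (lb ≤ᵇ suc e) (upTo (suc r)) (A e))) ⟩
      ∑ (upTo ℓ) (λ e → ∑ (upTo (suc r)) (λ y → (lb ≤ᵇ suc e) ▹ A e y))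
        ≡⟨ ∑-swap (upTo ℓ) (upTo (suc r)) (λ e y → (lb ≤ᵇ suc e) ▹ A e y) ⟩
      ∑ (upTo (suc r)) (λ y → ∑ (upTo ℓ) (λ e → (lb ≤ᵇ suc e) ▹ A e y))
        ≡⟨ ∑-cong (upTo (suc r)) (λ y → trans
             (∑-cong (upTo ℓ) (λ e → sym (pull e (rowsOf ℓ y) (λ R → g (suc e ∷ R ++ replicate (r ∸ y) (suc ℓ))))))
             (sym (∑-rowsOf ℓ y (λ R → weakInc (lb ∷ R) ▹ g (R ++ replicate (r ∸ y) (suc ℓ)))))) ⟩
      ∑ (upTo (suc r)) (B ∘ suc) ∎
    -- After a letter ℓ + 1 no smaller letter may follow, so the part preceding the final block is
    -- empty.
    above : ∀ y → A ℓ (suc y) ≡ 0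
    above y = trans (∑-rowsOf ℓ y _) (trans (∑-upTo-cong ℓ (λ e e<ℓ → ∑-vanish (rowsOf ℓ y) (λ R →
      ▹-false (weakInc (suc ℓ ∷ suc e ∷ R)) {g (suc ℓ ∷ suc e ∷ R ++ replicate (r ∸ suc y) (suc ℓ))} (λ t → ⊥-elim (ℕ.<⇒≱ e<ℓ (ℕ.≤-pred (ℕ.≤ᵇ⇒≤ (suc ℓ) (suc e) (T-∧₁ t)))))))) (∑-zero (upTo ℓ)))
    full : (lb ≤ᵇ suc ℓ) ▹ ∑ (upTo (suc r)) (A ℓ) ≡ B 0
    full = begin
      (lb ≤ᵇ suc ℓ) ▹ ∑ (upTo (suc r)) (A ℓ) ≡⟨ cong (_▹ ∑ (upTo (suc r)) (A ℓ)) (T-ext {lb ≤ᵇ suc ℓ} {true} (λ _ → tt) (λ _ → ℕ.≤⇒≤ᵇ le)) ⟩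
      ∑ (upTo (suc r)) (A ℓ) ≡⟨ ∑-upTo-suc r (A ℓ) ⟩
      A ℓ 0 + ∑ (upTo r) (A ℓ ∘ suc) ≡⟨ cong (A ℓ 0 +_) (∑-vanish (upTo r) above) ⟩
      A ℓ 0 + 0 ≡⟨ ℕ.+-identityʳ (A ℓ 0) ⟩
      B 0 ∎

  weakInc-0∷ : ∀ R → weakInc (0 ∷ R) ≡ weakInc R
  weakInc-0∷ []      = refl
  weakInc-0∷ (x ∷ R) = refl

  colLt-[] : ∀ R → colLt R [] ≡ true
  colLt-[] []      = refl
  colLt-[] (x ∷ R) = refl

  ≤ᵇ-suc : ∀ a b → (suc a ≤ᵇ suc b) ≡ (a ≤ᵇ b)
  ≤ᵇ-suc zero    b = refl
  ≤ᵇ-suc (suc a) b = refl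

  <ᵇ-false : ∀ {a b} → b ≤ a → (a <ᵇ b) ≡ false
  <ᵇ-false {a} {b} le = T-ext {a <ᵇ b} {false} (λ t → ℕ.<⇒≱ (ℕ.<ᵇ⇒< a b t) le) (λ ())

  -- No letter can stand below ℓ + 1 in a strictly increasing column. The whole lower row, padding
  -- included, must therefore fit under the old part of the upper row, which is exactly the
  -- horizontal strip condition.
  colLt-pad : ∀ ℓ R p R′ q → All (_≤ ℓ) R → All (_≤ ℓ) R′ → length R′ + q ≤ length R + p →
              colLt (R ++ replicate p (suc ℓ)) (R′ ++ replicate q (suc ℓ)) ≡ (length R′ + q ≤ᵇ length R) ∧ colLt R R′
  colLt-pad ℓ [] p       []       zero    a b le = colLt-[] (replicate p (suc ℓ))
  colLt-pad ℓ [] (suc p) []       (suc q) a b le rewrite <ᵇ-false (ℕ.≤-refl {ℓ}) = refl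
  colLt-pad ℓ [] (suc p) (y ∷ R′) q a (y≤ℓ ∷ b) le rewrite <ᵇ-false (ℕ.m≤n⇒m≤1+n y≤ℓ) = refl
  colLt-pad ℓ (x ∷ R) p [] zero a b le = refl
  colLt-pad ℓ (x ∷ R) p [] (suc q) (x≤ℓ ∷ a) b (s≤s le) = trans
    (cong₂ _∧_ (T-ext {x <ᵇ suc ℓ} {true} (λ _ → tt) (λ _ → ℕ.<⇒<ᵇ (s≤s x≤ℓ))) (colLt-pad ℓ R p [] q a b le))
    (cong₂ _∧_ (sym (≤ᵇ-suc q (length R))) (colLt-[] R))
  colLt-pad ℓ (x ∷ R) p (y ∷ R′) q (x≤ℓ ∷ a) (y≤ℓ ∷ b) (s≤s le) = begin
    (x <ᵇ y) ∧ colLt (R ++ replicate p (suc ℓ)) (R′ ++ replicate q (suc ℓ))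
      ≡⟨ cong ((x <ᵇ y) ∧_) (colLt-pad ℓ R p R′ q a b le) ⟩
    (x <ᵇ y) ∧ ((length R′ + q ≤ᵇ length R) ∧ colLt R R′)
      ≡⟨ ∧-assoc (x <ᵇ y) _ _ ⟨
    ((x <ᵇ y) ∧ (length R′ + q ≤ᵇ length R)) ∧ colLt R R′
      ≡⟨ cong (_∧ colLt R R′) (∧-comm (x <ᵇ y) _) ⟩
    ((length R′ + q ≤ᵇ length R) ∧ (x <ᵇ y)) ∧ colLt R R′
      ≡⟨ ∧-assoc (length R′ + q ≤ᵇ length R) _ _ ⟩
    (length R′ + q ≤ᵇ length R) ∧ ((x <ᵇ y) ∧ colLt R R′)
      ≡⟨ cong (_∧ ((x <ᵇ y) ∧ colLt R R′)) (≤ᵇ-suc (length R′ + q) (length R)) ⟨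
    (suc (length R′ + q) ≤ᵇ suc (length R)) ∧ ((x <ᵇ y) ∧ colLt R R′) ∎

  tableau : List (List ℕ) → Bool
  tableau T = allB weakInc T ∧ colsOK T

  colHead : List ℕ → List (List ℕ) → Bool
  colHead R []       = true
  colHead R (R′ ∷ _) = colLt R R′

  tableau-∷ : ∀ R T u → tableau (R ∷ T) ▹ u ≡ weakInc R ▹ tableau T ▹ colHead R T ▹ u
  tableau-∷ R []       u = trans (▹-∧ (weakInc R ∧ true) true u) (▹-∧ (weakInc R) true u)
  tableau-∷ R (R′ ∷ T) u with weakInc R | allB weakInc (R′ ∷ T) | colLt R R′ | colsOK (R′ ∷ T)
  ... | false | _     | _     | _     = refl
  ... | true  | false | _     | _     = refl
  ... | true  | true  | true  | true  = refl
  ... | true  | true  | false | true  = refl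
  ... | true  | true  | true  | false = refl
  ... | true  | true  | false | false = refl

  pad : ℕ → List ℕ → List (List ℕ) → List (List ℕ)
  pad ℓ []       T       = []
  pad ℓ (x ∷ λ') []      = []
  pad ℓ (x ∷ λ') (R ∷ T) = (R ++ replicate (x ∸ length R) (suc ℓ)) ∷ pad ℓ λ' T

  colHead-pad : ∀ ℓ {x y λ' ν R T} → Row ℓ R y → y ≤ x → hd λ' ≤ x → Pointwise _≤_ ν λ' → Pointwise (Row ℓ) T ν →
                colHead (R ++ replicate (x ∸ y) (suc ℓ)) (pad ℓ λ' T) ≡ (hd λ' ≤ᵇ y) ∧ colHead R T
  colHead-pad ℓ rR y≤x hd≤x [] [] = refl
  colHead-pad ℓ {x} {λ' = x′ ∷ _} {R = R} {T = R′ ∷ _} (refl , aR) y≤x hd≤x (y′≤x′ ∷ _) ((refl , aR′) ∷ _) = trans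
    (colLt-pad ℓ R (x ∸ length R) R′ (x′ ∸ length R′) aR aR′
      (≡.subst₂ _≤_ (sym (ℕ.m+[n∸m]≡n y′≤x′)) (sym (ℕ.m+[n∸m]≡n y≤x)) hd≤x))
    (cong (λ z → (z ≤ᵇ length R) ∧ colLt R R′) (ℕ.m+[n∸m]≡n y′≤x′))

  -- The boxes with the letter ℓ + 1 form a horizontal strip. The weight φ is arbitrary because the
  -- induction on rows puts into it the column condition against the row above; the content test is
  -- another such weight.
  remove-largest : ∀ ℓ {m} λ' → Dec m λ' → (φ : List (List ℕ) → ℕ) →
    ∑ (fillings (suc ℓ) λ') (λ T → tableau T ▹ φ T)
      ≡ ∑ (strips λ') (λ p → ∑ (fillings ℓ (proj₂ p)) (λ T → tableau T ▹ φ (pad ℓ λ' T)))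
  remove-largest ℓ []       d          φ = sym (ℕ.+-identityʳ _)
  remove-largest ℓ (x ∷ λ') (x≤m ∷ d) φ = begin
    ∑ (fillings (suc ℓ) (x ∷ λ')) (λ T → tableau T ▹ φ T)
      ≡⟨ ∑-fillings (suc ℓ) x λ' (λ T → tableau T ▹ φ T) ⟩
    ∑ (rowsOf (suc ℓ) x) (λ R → ∑ (fillings (suc ℓ) λ') (λ T → tableau (R ∷ T) ▹ φ (R ∷ T)))
      ≡⟨ ∑-cong (rowsOf (suc ℓ) x) (λ R → trans
           (∑-cong (fillings (suc ℓ) λ') (λ T → trans (tableau-∷ R T (φ (R ∷ T))) (cong (_▹ tableau T ▹ colHead R T ▹ φ (R ∷ T)) (sym (weakInc-0∷ R)))))
           (trans (∑-▹ (weakInc (0 ∷ R)) (fillings (suc ℓ) λ') (λ T → tableau T ▹ colHead R T ▹ φ (R ∷ T)))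
                  (cong (weakInc (0 ∷ R) ▹_) (remove-largest ℓ λ' d (λ T → colHead R T ▹ φ (R ∷ T)))))) ⟩
    ∑ (rowsOf (suc ℓ) x) (λ R → weakInc (0 ∷ R) ▹ G R)
      ≡⟨ rows-split ℓ 0 x G z≤n ⟩
    ∑ (upTo (suc x)) (λ y → ∑ (rowsOf ℓ y) (λ R → weakInc (0 ∷ R) ▹ G (R ++ replicate (x ∸ y) (suc ℓ))))
      ≡⟨ ∑-upTo-cong (suc x) (λ { y (s≤s y≤x) → row y y≤x }) ⟩
    ∑ (upTo (suc x)) (λ y → (hd λ' ≤ᵇ y) ▹ ∑ (strips λ') (λ p → ∑ (fillings ℓ (y ∷ proj₂ p)) (λ T → tableau T ▹ φ (pad ℓ (x ∷ λ') T))))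
      ≡⟨ ∑-strips x λ' (λ p → ∑ (fillings ℓ (proj₂ p)) (λ T → tableau T ▹ φ (pad ℓ (x ∷ λ') T))) ⟨
    ∑ (strips (x ∷ λ')) (λ p → ∑ (fillings ℓ (proj₂ p)) (λ T → tableau T ▹ φ (pad ℓ (x ∷ λ') T))) ∎
    where
    G : List ℕ → ℕ
    G R = ∑ (strips λ') (λ p → ∑ (fillings ℓ (proj₂ p)) (λ T → tableau T ▹ colHead R (pad ℓ λ' T) ▹ φ (R ∷ pad ℓ λ' T)))
    module _ (y : ℕ) (y≤x : y ≤ x) where
      entry : ∀ {R} → Row ℓ R y → ∀ {ν} → Pointwise _≤_ ν λ' → ∀ {T} → Pointwise (Row ℓ) T ν →
              weakInc (0 ∷ R) ▹ tableau T ▹ colHead (R ++ replicate (x ∸ y) (suc ℓ)) (pad ℓ λ' T) ▹ φ ((R ++ replicate (x ∸ y) (suc ℓ)) ∷ pad ℓ λ' T)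
            ≡ (hd λ' ≤ᵇ y) ▹ tableau (R ∷ T) ▹ φ (pad ℓ (x ∷ λ') (R ∷ T))
      entry {R} rR {ν} ν⊆ {T} rT
        rewrite colHead-pad ℓ rR y≤x (Dec-hd d) ν⊆ rT | weakInc-0∷ R | tableau-∷ R T (φ (pad ℓ (x ∷ λ') (R ∷ T))) | proj₁ rR
        with hd λ' ≤ᵇ y | weakInc R | tableau T
      ... | true  | true  | true  = refl
      ... | true  | true  | false = refl
      ... | true  | false | _     = refl
      ... | false | true  | true  = refl
      ... | false | true  | false = refl
      ... | false | false | _     = refl
      row : ∑ (rowsOf ℓ y) (λ R → weakInc (0 ∷ R) ▹ G (R ++ replicate (x ∸ y) (suc ℓ)))
          ≡ (hd λ' ≤ᵇ y) ▹ ∑ (strips λ') (λ p → ∑ (fillings ℓ (y ∷ proj₂ p)) (λ T → tableau T ▹ φ (pad ℓ (x ∷ λ') T)))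
      row = begin
        ∑ (rowsOf ℓ y) (λ R → weakInc (0 ∷ R) ▹ G (R ++ replicate (x ∸ y) (suc ℓ)))
          ≡⟨ ∑-congAll (All.map (λ {R} rR → trans (sym (∑-▹ (weakInc (0 ∷ R)) (strips λ') _))
               (∑-congAll (All.map (λ {p} ν⊆ → trans (sym (∑-▹ (weakInc (0 ∷ R)) (fillings ℓ (proj₂ p)) _))
                 (∑-congAll (All.map (λ rT → entry rR ν⊆ rT) (All-fillings ℓ (proj₂ p))))) (strips-⊆ λ')))) (All-rowsOf ℓ y)) ⟩
        ∑ (rowsOf ℓ y) (λ R → ∑ (strips λ') (λ p → ∑ (fillings ℓ (proj₂ p)) (λ T → (hd λ' ≤ᵇ y) ▹ tableau (R ∷ T) ▹ φ (pad ℓ (x ∷ λ') (R ∷ T)))))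
          ≡⟨ ∑-cong (rowsOf ℓ y) (λ R → trans (∑-cong (strips λ') (λ p → ∑-▹ (hd λ' ≤ᵇ y) (fillings ℓ (proj₂ p)) _)) (∑-▹ (hd λ' ≤ᵇ y) (strips λ') _)) ⟩
        ∑ (rowsOf ℓ y) (λ R → (hd λ' ≤ᵇ y) ▹ ∑ (strips λ') (λ p → ∑ (fillings ℓ (proj₂ p)) (λ T → tableau (R ∷ T) ▹ φ (pad ℓ (x ∷ λ') (R ∷ T)))))
          ≡⟨ ∑-▹ (hd λ' ≤ᵇ y) (rowsOf ℓ y) _ ⟩
        (hd λ' ≤ᵇ y) ▹ ∑ (rowsOf ℓ y) (λ R → ∑ (strips λ') (λ p → ∑ (fillings ℓ (proj₂ p)) (λ T → tableau (R ∷ T) ▹ φ (pad ℓ (x ∷ λ') (R ∷ T)))))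
          ≡⟨ cong ((hd λ' ≤ᵇ y) ▹_) (trans (∑-swap (rowsOf ℓ y) (strips λ') _)
               (∑-cong (strips λ') (λ p → sym (∑-fillings ℓ y (proj₂ p) (λ T → tableau T ▹ φ (pad ℓ (x ∷ λ') T)))))) ⟩
        (hd λ' ≤ᵇ y) ▹ ∑ (strips λ') (λ p → ∑ (fillings ℓ (y ∷ proj₂ p)) (λ T → tableau T ▹ φ (pad ℓ (x ∷ λ') T))) ∎

  count : ℕ → List ℕ → ℕ
  count e = countB (e ≡ᵇ_)

  countB-∑ : ∀ {A : Set} (p : A → Bool) xs → countB p xs ≡ ∑ xs (λ x → p x ▹ 1)
  countB-∑ p []       = refl
  countB-∑ p (x ∷ xs) with p x
  ... | true  = cong suc (countB-∑ p xs)
  ... | false = countB-∑ p xs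

  count-++ : ∀ e xs ys → count e (xs ++ ys) ≡ count e xs + count e ys
  count-++ e xs ys = trans (countB-∑ (e ≡ᵇ_) (xs ++ ys))
    (trans (∑-++ xs ys _) (cong₂ _+_ (sym (countB-∑ (e ≡ᵇ_) xs)) (sym (countB-∑ (e ≡ᵇ_) ys))))

  ≡ᵇ-refl : ∀ a → (a ≡ᵇ a) ≡ true
  ≡ᵇ-refl a = T-ext (λ _ → tt) (λ _ → ℕ.≡⇒≡ᵇ a a refl)

  ≢⇒≡ᵇ : ∀ {a b} → a ≢ b → (a ≡ᵇ b) ≡ false
  ≢⇒≡ᵇ {a} {b} n = T-ext {a ≡ᵇ b} {false} (λ t → n (ℕ.≡ᵇ⇒≡ a b t)) (λ ())

  count-replicate : ∀ e k → count e (replicate k e) ≡ k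
  count-replicate e zero    = refl
  count-replicate e (suc k) rewrite ≡ᵇ-refl e = cong suc (count-replicate e k)

  count-absent : ∀ e {xs} → All (e ≢_) xs → count e xs ≡ 0
  count-absent e []       = refl
  count-absent e (n ∷ ns) rewrite ≢⇒≡ᵇ n = count-absent e ns

  count-pad-new : ∀ ℓ {λ' ν T} → Pointwise _≤_ ν λ' → Pointwise (Row ℓ) T ν →
                  count (suc ℓ) (concat (pad ℓ λ' T)) + sumℕ ν ≡ sumℕ λ'
  count-pad-new ℓ [] [] = refl
  count-pad-new ℓ {x ∷ λ'} {ν = y ∷ ν} {R ∷ T} (y≤x ∷ ν⊆) ((refl , aR) ∷ rT) = begin
    count (suc ℓ) ((R ++ replicate (x ∸ y) (suc ℓ)) ++ concat (pad ℓ λ' T)) + (y + sumℕ ν)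
      ≡⟨ cong (_+ (y + sumℕ ν)) (trans (count-++ (suc ℓ) (R ++ replicate (x ∸ y) (suc ℓ)) _) (cong (_+ C) (count-++ (suc ℓ) R _))) ⟩
    count (suc ℓ) R + count (suc ℓ) (replicate (x ∸ y) (suc ℓ)) + C + (y + sumℕ ν)
      ≡⟨ cong₂ (λ a b → a + b + C + (y + sumℕ ν)) (count-absent (suc ℓ) (All.map (λ { z≤ℓ refl → ℕ.1+n≰n z≤ℓ }) aR)) (count-replicate (suc ℓ) (x ∸ y)) ⟩
    (x ∸ y) + C + (y + sumℕ ν)
      ≡⟨ solve 4 (λ a c y s → a :+ c :+ (y :+ s) := a :+ y :+ (c :+ s)) refl (x ∸ y) C y (sumℕ ν) ⟩
    (x ∸ y) + y + (C + sumℕ ν)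
      ≡⟨ cong₂ _+_ (ℕ.m∸n+n≡m y≤x) (count-pad-new ℓ ν⊆ rT) ⟩
    x + sumℕ λ' ∎
    where
    C = count (suc ℓ) (concat (pad ℓ λ' T))

  count-pad-old : ∀ ℓ e {λ' ν T} → e ≤ ℓ → Pointwise _≤_ ν λ' → Pointwise (Row ℓ) T ν →
                  count e (concat (pad ℓ λ' T)) ≡ count e (concat T)
  count-pad-old ℓ e e≤ℓ [] [] = refl
  count-pad-old ℓ e {x ∷ λ'} {ν = y ∷ ν} {R ∷ T} e≤ℓ (y≤x ∷ ν⊆) (rR ∷ rT) = begin
    count e ((R ++ new) ++ concat (pad ℓ λ' T))
      ≡⟨ trans (count-++ e (R ++ new) _) (cong (_+ count e (concat (pad ℓ λ' T))) (count-++ e R new)) ⟩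
    count e R + count e new + count e (concat (pad ℓ λ' T))
      ≡⟨ cong₂ (λ a b → count e R + a + b) (count-absent e (All.replicate⁺ (x ∸ length R) λ { refl → ℕ.1+n≰n e≤ℓ })) (count-pad-old ℓ e e≤ℓ ν⊆ rT) ⟩
    count e R + 0 + count e (concat T)
      ≡⟨ cong (_+ count e (concat T)) (ℕ.+-identityʳ (count e R)) ⟩
    count e R + count e (concat T)
      ≡⟨ count-++ e R (concat T) ⟨
    count e (R ++ concat T) ∎
    where
    new = replicate (x ∸ length R) (suc ℓ)

  contentFrom-snoc : ∀ i E μ m → contentFrom i E (μ ++ m ∷ []) ≡ contentFrom i E μ ∧ (count (i + length μ) E ≡ᵇ m)
  contentFrom-snoc i E []      m rewrite ℕ.+-identityʳ i = ∧-identityʳ _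
  contentFrom-snoc i E (x ∷ μ) m rewrite ℕ.+-suc i (length μ) =
    trans (cong ((count i E ≡ᵇ x) ∧_) (contentFrom-snoc (suc i) E μ m)) (sym (∧-assoc (count i E ≡ᵇ x) _ _))

  contentFrom-cong : ∀ i E E′ μ → (∀ e → i ≤ e → e < i + length μ → count e E ≡ count e E′) →
                     contentFrom i E μ ≡ contentFrom i E′ μ
  contentFrom-cong i E E′ []      c = refl
  contentFrom-cong i E E′ (x ∷ μ) c = cong₂ _∧_
    (cong (_≡ᵇ x) (c i ℕ.≤-refl (ℕ.m<m+n i (s≤s z≤n))))
    (contentFrom-cong (suc i) E E′ μ (λ e p q → c e (ℕ.<⇒≤ p) (subst (e <_) (sym (ℕ.+-suc i (length μ))) q)))

  fillings-0 : ∀ λ' → ∑ (fillings 0 λ') (λ T → tableau T ▹ 1) ≡ allB (_≡ᵇ 0) λ' ▹ 1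
  fillings-0 []           = refl
  fillings-0 (suc x ∷ λ') = refl
  fillings-0 (zero ∷ λ')  = trans (∑-fillings 0 0 λ' (λ T → tableau T ▹ 1))
    (trans (ℕ.+-identityʳ _) (trans (∑-cong (fillings 0 λ') (λ T → trans (tableau-∷ [] T 1) (cong (λ b → tableau T ▹ b ▹ 1) (colHead-[] T)))) (fillings-0 λ')))
    where
    colHead-[] : ∀ T → colHead [] T ≡ true
    colHead-[] []      = refl
    colHead-[] (R ∷ T) = refl

  tableaux : ℕ → List ℕ → List ℕ → ℕ
  tableaux ℓ μ λ' = ∑ (fillings ℓ λ') (λ T → tableau T ▹ contentFrom 1 (concat T) μ ▹ 1)

  -- Peeling starts with the largest letter, whose multiplicity is the last entry of the content;
  -- hence the reversal, which `kostka≡Kr` undoes by the symmetry `Kr-↭`.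
  tableaux≡Kr : ∀ α {m λ'} → Dec m λ' → tableaux (length α) (reverse α) λ' ≡ Kr α λ'
  tableaux≡Kr []      {λ' = λ'} d = fillings-0 λ'
  tableaux≡Kr (m ∷ α) {λ' = λ'} d = begin
    tableaux (suc ℓ) (reverse (m ∷ α)) λ'
      ≡⟨ cong (λ μ → tableaux (suc ℓ) μ λ') (unfold-reverse m α) ⟩
    tableaux (suc ℓ) (reverse α ++ m ∷ []) λ'
      ≡⟨ remove-largest ℓ λ' d (λ T → contentFrom 1 (concat T) (reverse α ++ m ∷ []) ▹ 1) ⟩
    ∑ (strips λ') (λ p → ∑ (fillings ℓ (proj₂ p)) (λ T → tableau T ▹ contentFrom 1 (concat (pad ℓ λ' T)) (reverse α ++ m ∷ []) ▹ 1))
      ≡⟨ ∑-congAll (All.zipWith (λ {p} (s , ν⊆ , dν) → step p s ν⊆ dν) (strips-size λ' , All.zip (strips-⊆ λ' , strips-Dec d))) ⟩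
    ∑ (strips λ') (λ p → (proj₁ p ≡ᵇ m) ▹ Kr α (proj₂ p)) ∎
    where
    ℓ = length α
    step : ∀ p → proj₁ p + sumℕ (proj₂ p) ≡ sumℕ λ' → Pointwise _≤_ (proj₂ p) λ' → Dec (hd λ') (proj₂ p) →
           ∑ (fillings ℓ (proj₂ p)) (λ T → tableau T ▹ contentFrom 1 (concat (pad ℓ λ' T)) (reverse α ++ m ∷ []) ▹ 1)
         ≡ (proj₁ p ≡ᵇ m) ▹ Kr α (proj₂ p)
    step (i , ν) s ν⊆ dν = begin
      ∑ (fillings ℓ ν) (λ T → tableau T ▹ contentFrom 1 (concat (pad ℓ λ' T)) (reverse α ++ m ∷ []) ▹ 1)
        ≡⟨ ∑-congAll (All.map (λ {T} rT → trans (cong (λ b → tableau T ▹ b ▹ 1) (content T rT)) (shuffle (tableau T) (i ≡ᵇ m) (contentFrom 1 (concat T) (reverse α)))) (All-fillings ℓ ν)) ⟩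
      ∑ (fillings ℓ ν) (λ T → (i ≡ᵇ m) ▹ tableau T ▹ contentFrom 1 (concat T) (reverse α) ▹ 1)
        ≡⟨ ∑-▹ (i ≡ᵇ m) (fillings ℓ ν) _ ⟩
      (i ≡ᵇ m) ▹ tableaux ℓ (reverse α) ν
        ≡⟨ cong ((i ≡ᵇ m) ▹_) (tableaux≡Kr α dν) ⟩
      (i ≡ᵇ m) ▹ Kr α ν ∎
      where
      shuffle : ∀ a b c → a ▹ (c ∧ b) ▹ 1 ≡ b ▹ a ▹ c ▹ 1
      shuffle true  true  true  = refl
      shuffle true  true  false = refl
      shuffle true  false true  = refl
      shuffle true  false false = refl
      shuffle false true  c     = refl
      shuffle false false c     = refl
      content : ∀ T → Pointwise (Row ℓ) T ν →
                contentFrom 1 (concat (pad ℓ λ' T)) (reverse α ++ m ∷ []) ≡ contentFrom 1 (concat T) (reverse α) ∧ (i ≡ᵇ m)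
      content T rT = trans (contentFrom-snoc 1 (concat (pad ℓ λ' T)) (reverse α) m) (cong₂ _∧_
        (contentFrom-cong 1 (concat (pad ℓ λ' T)) (concat T) (reverse α) (λ { e _ (s≤s q) → count-pad-old ℓ e (subst (e ≤_) (length-reverse α) q) ν⊆ rT }))
        (cong (_≡ᵇ m) (trans (cong (λ n → count (suc n) (concat (pad ℓ λ' T))) (length-reverse α))
                             (ℕ.+-cancelʳ-≡ (sumℕ ν) _ _ (trans (count-pad-new ℓ ν⊆ rT) (sym s))))))

  kostka≡Kr : ∀ {m λ'} → Dec m λ' → ∀ μ → kostka λ' μ ≡ Kr μ λ'
  kostka≡Kr {λ' = λ'} d μ = begin
    kostka λ' μ
      ≡⟨ countB-∑ (isSSYT μ) (fillings (length μ) λ') ⟩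
    ∑ (fillings (length μ) λ') (λ T → isSSYT μ T ▹ 1)
      ≡⟨ ∑-cong (fillings (length μ) λ') (λ T → trans (cong (_▹ 1) (sym (∧-assoc (allB weakInc T) (colsOK T) _))) (▹-∧ (tableau T) _ 1)) ⟩
    tableaux (length μ) μ λ'
      ≡⟨ cong₂ (λ n ν → tableaux n ν λ') (sym (length-reverse μ)) (sym (reverse-involutive μ)) ⟩
    tableaux (length (reverse μ)) (reverse (reverse μ)) λ'
      ≡⟨ tableaux≡Kr (reverse μ) d ⟩
    Kr (reverse μ) λ'
      ≡⟨ Kr-↭ (Perm.↭-reverse μ) λ' ⟩
    Kr μ λ' ∎

  -- Partitions and sorting

  record IsPartition (n m : ℕ) (λ' : List ℕ) : Set where
    constructor isPartition
    field
      dec      : Dec m λ'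
      positive : All (0 <_) λ'
      size     : sumℕ λ' ≡ n
  open IsPartition public

  pars-sound : ∀ f n m → All (IsPartition n m) (pars f n m)
  pars-sound f       zero    m = isPartition [] [] refl ∷ []
  pars-sound zero    (suc n) m = []
  pars-sound (suc f) (suc n) m = All-concatMap (λ j → map (j ∷_) (pars f (suc n ∸ j) j))
    (All.applyUpTo⁺₁ suc (m ⊓ suc n) (λ {i} i<m⊓n → All.map⁺ (All.map
      (λ (isPartition d p s) → isPartition (ℕ.≤-trans i<m⊓n (ℕ.m⊓n≤m m (suc n)) ∷ d) (s≤s z≤n ∷ p)
        (trans (cong (suc i +_) s) (ℕ.m+[n∸m]≡n (ℕ.≤-trans i<m⊓n (ℕ.m⊓n≤n m (suc n))))))
      (pars-sound f (suc n ∸ suc i) (suc i)))))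

  ∈-partition : ∀ n {λ'} → λ' ∈ Partitions n → IsPartition n n λ'
  ∈-partition n = All.lookup (pars-sound n n n)

  pars-complete : ∀ f {m λ'} → Dec m λ' → All (0 <_) λ' → sumℕ λ' ≤ f → λ' ∈ pars f (sumℕ λ') m
  pars-complete f       []                     []      le       = here refl
  pars-complete (suc f) {m} {suc x ∷ λ'} (x<m ∷ d) (_ ∷ p) (s≤s le) =
    ∈-concatMap⁺ (λ j → map (j ∷_) (pars f (suc x + sumℕ λ' ∸ j) j))
      (Any.map (λ { refl → ∈-map⁺ (suc x ∷_) (subst (λ n → λ' ∈ pars f n (suc x)) (sym (ℕ.m+n∸m≡n x (sumℕ λ')))
                  (pars-complete f d p (ℕ.≤-trans (ℕ.m≤n+m (sumℕ λ') x) le))) })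
        (∈-applyUpTo⁺ suc (ℕ.⊓-glb x<m (s≤s (ℕ.m≤m+n x (sumℕ λ'))))))

  -- The symmetry of the content lets its first entry play the role of the number of letters 1.
  Kr-first′ : ∀ m α x λ' → x ≤ m → Dec x λ' → Kr (m ∷ α) (x ∷ λ') ≡ (if x ≡ᵇ m then Kr α λ' else 0)
  Kr-first′ m α x λ' x≤m d = trans (Kr-↭ (Perm.∷↭∷ʳ m α) (x ∷ λ')) (Kr-first α m x λ' x≤m d)

  Kr-diagonal : ∀ {m λ'} → Dec m λ' → Kr λ' λ' ≡ 1
  Kr-diagonal []                        = refl
  Kr-diagonal {λ' = x ∷ λ'} (x≤m ∷ d) =
    trans (Kr-first′ x λ' x λ' ℕ.≤-refl d) (trans (cong (if_then Kr λ' λ' else 0) (≡ᵇ-refl x)) (Kr-diagonal d))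

  Precedes : List ℕ → List ℕ → Set
  Precedes λ' μ = λ' ≢ μ × Kr μ λ' ≡ 0

  -- The enumeration of partitions is lexicographically increasing.
  pars-unitriangular : ∀ f n m → AllPairs Precedes (pars f n m)
  pars-unitriangular f       zero    m = [] ∷ []
  pars-unitriangular zero    (suc n) m = []
  pars-unitriangular (suc f) (suc n) m = AllPairs.concat⁺
    (All.map⁺ (All.applyUpTo⁺₂ suc (m ⊓ suc n) (λ i → AllPairs.map⁺ (same i (pars-sound f (suc n ∸ suc i) (suc i)) (pars-unitriangular f (suc n ∸ suc i) (suc i))))))
    (AllPairs.map⁺ (AllPairs.applyUpTo⁺₁ suc (m ⊓ suc n) (λ {i} {j} i<j _ →
      All.map⁺ (All.map (λ {λ'} pλ → All.map⁺ (All.universal (λ μ → smaller i<j pλ) _)) (pars-sound f (suc n ∸ suc i) (suc i))))))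
    where
    same : ∀ i {L n} → All (IsPartition n (suc i)) L → AllPairs Precedes L → AllPairs (λ λ' μ → Precedes (suc i ∷ λ') (suc i ∷ μ)) L
    same i []       []       = []
    same i {λ' ∷ L} (p ∷ ps) (q ∷ qs) = All.map (λ { {μ} (ne , z) → (λ { refl → ne refl }) ,
      trans (Kr-first′ (suc i) μ (suc i) λ' ℕ.≤-refl (dec p)) (trans (cong (if_then Kr μ λ' else 0) (≡ᵇ-refl i)) z) }) q ∷ same i ps qs
    -- A first row of i + 1 boxes cannot consist of j + 1 letters 1.
    smaller : ∀ {i j λ' μ n} → i < j → IsPartition n (suc i) λ' → Precedes (suc i ∷ λ') (suc j ∷ μ)
    smaller {i} {j} {λ'} {μ} i<j p = (λ { refl → ℕ.<-irrefl refl i<j }) ,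
      trans (Kr-first′ (suc j) μ (suc i) λ' (s≤s (ℕ.<⇒≤ i<j)) (dec p)) (cong (if_then Kr μ λ' else 0) (≢⇒≡ᵇ (λ e → ℕ.<⇒≢ i<j e)))

  insertD-↭ : ∀ x ys → insertD x ys ↭ x ∷ ys
  insertD-↭ x []       = Perm.refl
  insertD-↭ x (y ∷ ys) with y ≤ᵇ x
  ... | true  = Perm.refl
  ... | false = ↭-trans (Perm.prep y (insertD-↭ x ys)) (Perm.swap y x Perm.refl)

  sortD-↭ : ∀ xs → sortD xs ↭ xs
  sortD-↭ []       = Perm.refl
  sortD-↭ (x ∷ xs) = ↭-trans (insertD-↭ x (sortD xs)) (Perm.prep x (sortD-↭ xs))

  insertD-Dec : ∀ {m} x ys → x ≤ m → Dec m ys → Dec m (insertD x ys)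
  insertD-Dec x []       x≤m d = x≤m ∷ []
  insertD-Dec x (y ∷ ys) x≤m (y≤m ∷ d) with y ≤ᵇ x in eq
  ... | true  = x≤m ∷ ℕ.≤ᵇ⇒≤ y x (subst T (sym eq) tt) ∷ d
  ... | false = y≤m ∷ insertD-Dec x ys (ℕ.≰⇒≥ (λ y≤x → subst T eq (ℕ.≤⇒≤ᵇ y≤x))) d

  sortD-Dec : ∀ {m xs} → All (_≤ m) xs → Dec m (sortD xs)
  sortD-Dec []                  = []
  sortD-Dec {xs = x ∷ xs} (p ∷ ps) = insertD-Dec x (sortD xs) p (sortD-Dec ps)

  parts-≤-sum : ∀ xs → All (_≤ sumℕ xs) xs
  parts-≤-sum []       = []
  parts-≤-sum (x ∷ xs) = ℕ.m≤m+n x (sumℕ xs) ∷ All.map (λ p → ℕ.≤-trans p (ℕ.m≤n+m (sumℕ xs) x)) (parts-≤-sum xs)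

  sumℕ-↭ : ∀ {xs ys} → xs ↭ ys → sumℕ xs ≡ sumℕ ys
  sumℕ-↭ Perm.refl         = refl
  sumℕ-↭ (Perm.prep x p)   = cong (x +_) (sumℕ-↭ p)
  sumℕ-↭ (Perm.swap x y p) = trans (cong (λ s → x + (y + s)) (sumℕ-↭ p)) (solve 3 (λ x y s → x :+ (y :+ s) := y :+ (x :+ s)) refl x y _)
  sumℕ-↭ (Perm.trans p q)  = trans (sumℕ-↭ p) (sumℕ-↭ q)

  nonzero : ℕ → Bool
  nonzero x = not (x ≡ᵇ 0)

  nonzero-positive : ∀ xs → All (0 <_) (filterB nonzero xs)
  nonzero-positive []           = []
  nonzero-positive (zero ∷ xs)  = nonzero-positive xs
  nonzero-positive (suc x ∷ xs) = s≤s z≤n ∷ nonzero-positive xs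

  sumℕ-nonzero : ∀ xs → sumℕ (filterB nonzero xs) ≡ sumℕ xs
  sumℕ-nonzero []           = refl
  sumℕ-nonzero (zero ∷ xs)  = sumℕ-nonzero xs
  sumℕ-nonzero (suc x ∷ xs) = cong (suc x +_) (sumℕ-nonzero xs)

  partition-∈ : ∀ {m λ'} → Dec m λ' → All (0 <_) λ' → λ' ∈ Partitions (sumℕ λ')
  partition-∈ {λ' = λ'} d p = pars-complete (sumℕ λ') (bound d) p ℕ.≤-refl
    where
    bound : ∀ {m λ'} → Dec m λ' → Dec (sumℕ λ') λ'
    bound []      = []
    bound {λ' = x ∷ λ'} (_ ∷ d) = ℕ.m≤m+n x (sumℕ λ') ∷ d

  row-∈ : ∀ n → rowP n ∈ Partitions n
  row-∈ zero    = here refl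
  row-∈ (suc n) = subst (λ s → suc n ∷ [] ∈ Partitions s) (ℕ.+-identityʳ (suc n)) (partition-∈ (ℕ.≤-refl ∷ []) (s≤s z≤n ∷ []))

  toPartition-∈ : ∀ α → toPartition α ∈ Partitions (sumℕ α)
  toPartition-∈ α = subst (λ n → toPartition α ∈ Partitions n)
    (trans (sumℕ-↭ (sortD-↭ (filterB nonzero α))) (sumℕ-nonzero α))
    (partition-∈ (sortD-Dec (parts-≤-sum (filterB nonzero α)))
                 (Perm.All-resp-↭ (↭-sym (sortD-↭ (filterB nonzero α))) (nonzero-positive α)))

  filter-positive : ∀ {α} → All (0 <_) α → filterB nonzero α ≡ α
  filter-positive []                    = refl
  filter-positive (s≤s {n = x} z≤n ∷ p) = cong (suc x ∷_) (filter-positive p)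

  toPartition-↭ : ∀ {α} → All (0 <_) α → toPartition α ↭ α
  toPartition-↭ {α} p = ↭-trans (sortD-↭ (filterB nonzero α)) (Perm.↭-reflexive (filter-positive p))

  -- Permutation invariance is available in the second argument, and `hCoeff-sym` carries it to the
  -- first.
  hCoeff-toPartition : ∀ α μ → hCoeff (toPartition α) μ ≡ hCoeff α μ
  hCoeff-toPartition α μ = trans (hCoeff-sym (toPartition α) μ)
    (trans (hCoeff-↭ (sortD-↭ (filterB nonzero α)) μ) (trans (hCoeff-sym μ (filterB nonzero α)) (drop α μ)))
    where
    drop : ∀ α μ → hCoeff (filterB nonzero α) μ ≡ hCoeff α μ
    drop []           μ = refl
    drop (zero ∷ α)   μ = trans (drop α μ) (sym (hCoeff-0∷ α μ))
    drop (suc x ∷ α)  μ = begin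
      hCoeff (suc x ∷ filterB nonzero α) μ ≡⟨ hCoeff-sym (suc x ∷ filterB nonzero α) μ ⟩
      hCoeff μ (suc x ∷ filterB nonzero α) ≡⟨ hCoeff-∷-cong (suc x) (λ κ → trans (hCoeff-sym κ _) (trans (drop α κ) (hCoeff-sym α κ))) μ ⟩
      hCoeff μ (suc x ∷ α) ≡⟨ hCoeff-sym μ (suc x ∷ α) ⟩
      hCoeff (suc x ∷ α) μ ∎

  -- Products of power sums with augmented monomial and elementary functions

  ▹-+ : ∀ b u v → b ▹ (u + v) ≡ b ▹ u + b ▹ v
  ▹-+ true  u v = refl
  ▹-+ false u v = refl

  lowered-split : ∀ i μ (g : List ℕ → ℕ) → ∑ (lowered i μ) g ≡ ∑ (cleared i μ) g + ∑ (shrunk i μ) g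
  lowered-split i []      g = refl
  lowered-split i (x ∷ μ) g = begin
    ∑ (lowered i (x ∷ μ)) g
      ≡⟨ ∑-replaceOne (i ≤ᵇ_) (_∸ i) x μ g ⟩
    (i ≤ᵇ x) ▹ g (x ∸ i ∷ μ) + ∑ (lowered i μ) (g ∘ (x ∷_))
      ≡⟨ cong₂ _+_ (head i x (λ y → g (y ∷ μ))) (lowered-split i μ (g ∘ (x ∷_))) ⟩
    ((x ≡ᵇ i) ▹ g (0 ∷ μ) + (i <ᵇ x) ▹ g (x ∸ i ∷ μ)) + (∑ (cleared i μ) (g ∘ (x ∷_)) + ∑ (shrunk i μ) (g ∘ (x ∷_)))
      ≡⟨ solve 4 (λ a b c d → (a :+ b) :+ (c :+ d) := (a :+ c) :+ (b :+ d)) refl ((x ≡ᵇ i) ▹ g (0 ∷ μ)) _ _ _ ⟩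
    ((x ≡ᵇ i) ▹ g (0 ∷ μ) + ∑ (cleared i μ) (g ∘ (x ∷_))) + ((i <ᵇ x) ▹ g (x ∸ i ∷ μ) + ∑ (shrunk i μ) (g ∘ (x ∷_)))
      ≡⟨ cong₂ _+_ (∑-replaceOne (_≡ᵇ i) (λ _ → 0) x μ g) (∑-replaceOne (i <ᵇ_) (_∸ i) x μ g) ⟨
    ∑ (cleared i (x ∷ μ)) g + ∑ (shrunk i (x ∷ μ)) g ∎
    where
    head : ∀ i x (f : ℕ → ℕ) → (i ≤ᵇ x) ▹ f (x ∸ i) ≡ (x ≡ᵇ i) ▹ f 0 + (i <ᵇ x) ▹ f (x ∸ i)
    head zero    zero    f = sym (ℕ.+-identityʳ _)
    head zero    (suc x) f = refl
    head (suc i) zero    f = refl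
    head (suc i) (suc x) f = trans (cong (_▹ f (x ∸ i)) (sym (≤ᵇ≡<ᵇ i x))) (head i x f)

  ∸-≡ᵇ : ∀ i k x → 1 ≤ k → ((i <ᵇ x) ∧ (x ∸ i ≡ᵇ k)) ≡ (x ≡ᵇ k + i)
  ∸-≡ᵇ i k x 1≤k = T-ext
    (λ t → ℕ.≡⇒≡ᵇ x (k + i) (trans (sym (ℕ.m∸n+n≡m (ℕ.<⇒≤ (ℕ.<ᵇ⇒< i x (T-∧₁ t))))) (cong (_+ i) (ℕ.≡ᵇ⇒≡ (x ∸ i) k (T-∧₂ {i <ᵇ x} t)))))
    (λ t → subst (λ z → T ((i <ᵇ z) ∧ (z ∸ i ≡ᵇ k))) (sym (ℕ.≡ᵇ⇒≡ x (k + i) t))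
      (T-∧ (ℕ.<⇒<ᵇ (ℕ.+-monoˡ-≤ i 1≤k)) (ℕ.≡⇒≡ᵇ (k + i ∸ i) k (ℕ.m+n∸n≡m k i))))

  -- If both operations hit the same entry, that entry was l + i and is cleared at once; otherwise
  -- they act on different entries and commute.
  shrunk-cleared : ∀ i l μ (g : List ℕ → ℕ) → 1 ≤ l →
    ∑ (shrunk i μ) (λ ν → ∑ (cleared l ν) g) ≡ ∑ (cleared (l + i) μ) g + ∑ (cleared l μ) (λ ν → ∑ (shrunk i ν) g)
  shrunk-cleared i l []      g 1≤l = refl
  shrunk-cleared i l (x ∷ μ) g 1≤l = begin
    ∑ (shrunk i (x ∷ μ)) (λ ν → ∑ (cleared l ν) g)
      ≡⟨ ∑-replaceOne (i <ᵇ_) (_∸ i) x μ (λ ν → ∑ (cleared l ν) g) ⟩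
    (i <ᵇ x) ▹ ∑ (cleared l (x ∸ i ∷ μ)) g + ∑ (shrunk i μ) (λ ν → ∑ (cleared l (x ∷ ν)) g)
      ≡⟨ cong₂ _+_
           (trans (cong ((i <ᵇ x) ▹_) (∑-replaceOne (_≡ᵇ l) (λ _ → 0) (x ∸ i) μ g))
           (trans (▹-+ (i <ᵇ x) _ _) (cong (_+ B) (trans (sym (▹-∧ (i <ᵇ x) (x ∸ i ≡ᵇ l) _)) (cong (_▹ g (0 ∷ μ)) (∸-≡ᵇ i l x 1≤l))))))
           (trans (∑-cong (shrunk i μ) (λ ν → ∑-replaceOne (_≡ᵇ l) (λ _ → 0) x ν g))
           (trans (∑-+ (shrunk i μ) _ _) (cong₂ _+_ (∑-▹ (x ≡ᵇ l) (shrunk i μ) _) (shrunk-cleared i l μ (g ∘ (x ∷_)) 1≤l)))) ⟩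
    (A + B) + (C + (D + E))
      ≡⟨ solve 5 (λ a b c d e → (a :+ b) :+ (c :+ (d :+ e)) := (a :+ d) :+ (c :+ (b :+ e))) refl A B C D E ⟩
    (A + D) + (C + (B + E))
      ≡⟨ cong₂ _+_ (∑-replaceOne (_≡ᵇ (l + i)) (λ _ → 0) x μ g)
          (trans (∑-replaceOne (_≡ᵇ l) (λ _ → 0) x μ (λ ν → ∑ (shrunk i ν) g))
                 (cong₂ _+_ (cong ((x ≡ᵇ l) ▹_) (∑-replaceOne (i <ᵇ_) (_∸ i) 0 μ g))
                   (trans (∑-cong (cleared l μ) (λ ν → ∑-replaceOne (i <ᵇ_) (_∸ i) x ν g))
                   (trans (∑-+ (cleared l μ) _ _) (cong (_+ E) (∑-▹ (i <ᵇ x) (cleared l μ) _)))))) ⟨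
    ∑ (cleared (l + i) (x ∷ μ)) g + ∑ (cleared l (x ∷ μ)) (λ ν → ∑ (shrunk i ν) g) ∎
    where
    A = (x ≡ᵇ l + i) ▹ g (0 ∷ μ)
    B = (i <ᵇ x) ▹ ∑ (cleared l μ) (g ∘ ((x ∸ i) ∷_))
    C = (x ≡ᵇ l) ▹ ∑ (shrunk i μ) (g ∘ (0 ∷_))
    D = ∑ (cleared (l + i) μ) (g ∘ (x ∷_))
    E = ∑ (cleared l μ) (λ ν → ∑ (shrunk i ν) (g ∘ (x ∷_)))

  -- The augmented monomial symmetric function: [x^μ] of the sum of x_{p₁}^{λ₁} x_{p₂}^{λ₂} ⋯ over distinct p₁, p₂, …
  augmented : List ℕ → List ℕ → ℕ
  augmented []       μ = allB (_≡ᵇ 0) μ ▹ 1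
  augmented (l ∷ λ') μ = ∑ (cleared l μ) (augmented λ')

  bumps : ℕ → List ℕ → List (List ℕ)
  bumps i []       = []
  bumps i (l ∷ λ') = (l + i ∷ λ') ∷ map (l ∷_) (bumps i λ')

  shrunk-augmented : ∀ i λ' μ → All (0 <_) λ' → ∑ (shrunk i μ) (augmented λ') ≡ ∑ (bumps i λ') (λ κ → augmented κ μ)
  shrunk-augmented i [] μ [] = go μ
    where
    go : ∀ μ → ∑ (shrunk i μ) (augmented []) ≡ 0
    go []          = refl
    go (zero ∷ μ)  = trans (∑-replaceOne (i <ᵇ_) (_∸ i) 0 μ (augmented [])) (go μ)
    go (suc x ∷ μ) = trans (∑-replaceOne (i <ᵇ_) (_∸ i) (suc x) μ (augmented []))
      (cong₂ _+_ (▹-false (i <ᵇ suc x) (λ t → first (suc x ∸ i) (ℕ.m<n⇒0<n∸m (ℕ.<ᵇ⇒< i (suc x) t)))) (∑-zero (shrunk i μ)))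
      where
      first : ∀ y → 0 < y → augmented [] (y ∷ μ) ≡ 0
      first (suc y) _ = refl
  shrunk-augmented i (l ∷ λ') μ (0<l ∷ p) = begin
    ∑ (shrunk i μ) (λ ν → ∑ (cleared l ν) (augmented λ'))
      ≡⟨ shrunk-cleared i l μ (augmented λ') 0<l ⟩
    augmented (l + i ∷ λ') μ + ∑ (cleared l μ) (λ ν → ∑ (shrunk i ν) (augmented λ'))
      ≡⟨ cong (augmented (l + i ∷ λ') μ +_) (trans (∑-cong (cleared l μ) (λ ν → shrunk-augmented i λ' ν p)) (∑-swap (cleared l μ) (bumps i λ') _)) ⟩
    augmented (l + i ∷ λ') μ + ∑ (bumps i λ') (λ κ → augmented (l ∷ κ) μ)
      ≡⟨ cong (augmented (l + i ∷ λ') μ +_) (∑-map (l ∷_) (bumps i λ') (λ κ → augmented κ μ)) ⟨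
    ∑ (bumps i (l ∷ λ')) (λ κ → augmented κ μ) ∎

  -- The variable contributed by p_i is either distinct from those already used, which gives the new
  -- part i, or coincides with one of them, which raises a part of λ' by i.
  lowered-augmented : ∀ i λ' μ → All (0 <_) λ' →
    ∑ (lowered i μ) (augmented λ') ≡ augmented (i ∷ λ') μ + ∑ (bumps i λ') (λ κ → augmented κ μ)
  lowered-augmented i λ' μ p = trans (lowered-split i μ (augmented λ')) (cong (augmented (i ∷ λ') μ +_) (shrunk-augmented i λ' μ p))

  augmented-0∷ : ∀ λ' μ → All (0 <_) λ' → augmented λ' (0 ∷ μ) ≡ augmented λ' μ
  augmented-0∷ []           μ []      = refl
  augmented-0∷ (suc l ∷ λ') μ (_ ∷ p) =
    trans (∑-map (0 ∷_) (cleared (suc l) μ) (augmented λ')) (∑-cong (cleared (suc l) μ) (λ ν → augmented-0∷ λ' ν p))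

  augmented-∷ : ∀ l λ' x μ → All (0 <_) λ' →
    augmented (l ∷ λ') (x ∷ μ) ≡ (x ≡ᵇ l) ▹ augmented λ' μ + ∑ (cleared l μ) (augmented λ' ∘ (x ∷_))
  augmented-∷ l λ' x μ p = trans (∑-replaceOne (_≡ᵇ l) (λ _ → 0) x μ (augmented λ'))
    (cong (λ u → (x ≡ᵇ l) ▹ u + ∑ (cleared l μ) (augmented λ' ∘ (x ∷_))) (augmented-0∷ λ' μ p))

  -- The diagonal entry is the product of the factorials of the multiplicities in λ'; positivity is
  -- what allows division by it in characteristic 0.
  augmented-diagonal : ∀ λ' → All (0 <_) λ' → 1 ≤ augmented λ' λ'
  augmented-diagonal []       []      = ℕ.≤-refl
  augmented-diagonal (l ∷ λ') (_ ∷ p) = ℕ.≤-trans (augmented-diagonal λ' p) (ℕ.≤-trans (ℕ.m≤m+n _ rest)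
    (ℕ.≤-reflexive (sym (trans (augmented-∷ l λ' l λ' p) (cong (λ b → b ▹ augmented λ' λ' + rest) (≡ᵇ-refl l))))))
    where rest = ∑ (cleared l λ') (augmented λ' ∘ (l ∷_))

  cleared-↭ : ∀ l μ → 0 < l → All (λ ν → filterB nonzero μ ↭ l ∷ filterB nonzero ν) (cleared l μ)
  cleared-↭ l []          0<l = []
  cleared-↭ (suc l) (zero ∷ μ)  0<l = All.map⁺ (cleared-↭ (suc l) μ 0<l)
  cleared-↭ l (suc x ∷ μ) 0<l = All.++⁺ head (All.map⁺ (All.map (λ p → ↭-trans (Perm.prep (suc x) p) (Perm.swap (suc x) l Perm.refl)) (cleared-↭ l μ 0<l)))
    where
    head : All (λ ν → suc x ∷ filterB nonzero μ ↭ l ∷ filterB nonzero ν) (if suc x ≡ᵇ l then (0 ∷ μ) ∷ [] else [])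
    head with suc x ≡ᵇ l in eq
    ... | true  = Perm.↭-reflexive (cong (_∷ filterB nonzero μ) (ℕ.≡ᵇ⇒≡ (suc x) l (subst T (sym eq) tt))) ∷ []
    ... | false = []

  ∑-zero⊎ : ∀ {A P : Set} {f : A → ℕ} {xs} → All (λ x → f x ≡ 0 ⊎ P) xs → ∑ xs f ≡ 0 ⊎ P
  ∑-zero⊎ []            = inj₁ refl
  ∑-zero⊎ (inj₂ p ∷ ps) = inj₂ p
  ∑-zero⊎ (inj₁ z ∷ ps) with ∑-zero⊎ ps
  ... | inj₁ z′ = inj₁ (cong₂ _+_ z z′)
  ... | inj₂ p  = inj₂ p

  augmented-support : ∀ λ' μ → All (0 <_) λ' → augmented λ' μ ≡ 0 ⊎ λ' ↭ filterB nonzero μ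
  augmented-support [] μ [] = go μ
    where
    go : ∀ μ → augmented [] μ ≡ 0 ⊎ [] ↭ filterB nonzero μ
    go []          = inj₂ Perm.refl
    go (zero ∷ μ)  = go μ
    go (suc x ∷ μ) = inj₁ refl
  augmented-support (l ∷ λ') μ (0<l ∷ p) = ∑-zero⊎ (All.map (λ {ν} q → step ν q (augmented-support λ' ν p)) (cleared-↭ l μ 0<l))
    where
    step : ∀ ν → filterB nonzero μ ↭ l ∷ filterB nonzero ν → augmented λ' ν ≡ 0 ⊎ λ' ↭ filterB nonzero ν →
           augmented λ' ν ≡ 0 ⊎ l ∷ λ' ↭ filterB nonzero μ
    step ν q (inj₁ z) = inj₁ z
    step ν q (inj₂ r) = inj₂ (↭-trans (Perm.prep l r) (↭-sym q))

  Dec-All : ∀ {m xs} → Dec m xs → All (_≤ m) xs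
  Dec-All []      = []
  Dec-All (p ∷ d) = p ∷ All.map (λ q → ℕ.≤-trans q p) (Dec-All d)

  Dec-↭ : ∀ {m n xs ys} → Dec m xs → Dec n ys → xs ↭ ys → xs ≡ ys
  Dec-↭ {ys = ys}    []      _       p = sym (Perm.↭-empty-inv (↭-sym p))
  Dec-↭ {xs = x ∷ xs} (_ ∷ d) []     p = Perm.↭-empty-inv p
  Dec-↭ {xs = x ∷ xs} {y ∷ ys} (_ ∷ d) (_ ∷ e) p with ℕ.≤-antisym
      (All.head (Perm.All-resp-↭ (↭-sym p) (ℕ.≤-refl ∷ Dec-All e)))
      (All.head (Perm.All-resp-↭ p (ℕ.≤-refl ∷ Dec-All d)))
  ... | refl = cong (x ∷_) (Dec-↭ d e (Perm.drop-∷ p))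

  augmented-off-diagonal : ∀ {n m n′ m′ λ' μ} → IsPartition n m λ' → IsPartition n′ m′ μ → λ' ≢ μ → augmented λ' μ ≡ 0
  augmented-off-diagonal {λ' = λ'} {μ} pλ pμ ne with augmented-support λ' μ (positive pλ)
  ... | inj₁ z = z
  ... | inj₂ q = ⊥-elim (ne (Dec-↭ (dec pλ) (dec pμ) (subst (λ' ↭_) (filter-positive (positive pμ)) q)))

  -- elementaryAt k n μ = [x^μ] e_n(x₁ᵏ, x₂ᵏ, …).
  elementaryAt : ℕ → List ℕ → ℕ → ℕ
  elementaryAt k []          zero    = 1
  elementaryAt k []          (suc n) = 0
  elementaryAt k (zero ∷ μ)  n       = elementaryAt k μ n
  elementaryAt k (suc x ∷ μ) zero    = 0
  elementaryAt k (suc x ∷ μ) (suc n) = (suc x ≡ᵇ k) ▹ elementaryAt k μ n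

  -- A monomial of e_{n+1}(x₁ᵏ, x₂ᵏ, ...) has n + 1 variables of exponent k, any of which may be the
  -- one cleared.
  cleared-elementary : ∀ k n μ → 1 ≤ k → ∑ (cleared k μ) (λ ν → elementaryAt k ν n) ≡ suc n * elementaryAt k μ (suc n)
  cleared-elementary k n [] 1≤k = sym (ℕ.*-zeroʳ (suc n))
  cleared-elementary (suc k) n (zero ∷ μ) 1≤k =
    trans (∑-map (0 ∷_) (cleared (suc k) μ) _) (cleared-elementary (suc k) n μ 1≤k)
  cleared-elementary k zero (suc x ∷ μ) 1≤k = trans (∑-replaceOne (_≡ᵇ k) (λ _ → 0) (suc x) μ _)
    (trans (cong ((suc x ≡ᵇ k) ▹ elementaryAt k μ 0 +_) (∑-zero (cleared k μ)))
           refl)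
  cleared-elementary k (suc n) (suc x ∷ μ) 1≤k = trans (∑-replaceOne (_≡ᵇ k) (λ _ → 0) (suc x) μ _)
    (trans (cong ((suc x ≡ᵇ k) ▹ elementaryAt k μ (suc n) +_) (trans (∑-▹ (suc x ≡ᵇ k) (cleared k μ) _) (cong ((suc x ≡ᵇ k) ▹_) (cleared-elementary k n μ 1≤k))))
           (collect (suc x ≡ᵇ k) (elementaryAt k μ (suc n))))
    where
    collect : ∀ b u → b ▹ u + b ▹ (suc n * u) ≡ suc (suc n) * (b ▹ u)
    collect true  u = refl
    collect false u = sym (ℕ.*-zeroʳ (suc (suc n)))

  shrunk-elementary-0 : ∀ k i μ → ∑ (shrunk i μ) (λ ν → elementaryAt k ν 0) ≡ 0
  shrunk-elementary-0 k i []          = refl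
  shrunk-elementary-0 k i (zero ∷ μ)  = trans (∑-map (0 ∷_) (shrunk i μ) _) (shrunk-elementary-0 k i μ)
  shrunk-elementary-0 k i (suc x ∷ μ) = trans (∑-replaceOne (i <ᵇ_) (_∸ i) (suc x) μ _)
    (cong₂ _+_ (▹-false (i <ᵇ suc x) (λ t → first (suc x ∸ i) (ℕ.m<n⇒0<n∸m (ℕ.<ᵇ⇒< i (suc x) t)))) (∑-zero (shrunk i μ)))
    where
    first : ∀ y → 0 < y → elementaryAt k (y ∷ μ) 0 ≡ 0
    first (suc y) _ = refl

  -- A shrunk entry stays positive, so it must have become k. It was k + i, and the other entries
  -- form a monomial of e_n(x₁ᵏ, x₂ᵏ, ...).
  shrunk-elementary : ∀ k i n μ → 1 ≤ k → ∑ (shrunk i μ) (λ ν → elementaryAt k ν (suc n)) ≡ ∑ (cleared (k + i) μ) (λ ν → elementaryAt k ν n)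
  shrunk-elementary k i n [] 1≤k = refl
  shrunk-elementary (suc k) i n (zero ∷ μ) 1≤k = trans (∑-map (0 ∷_) (shrunk i μ) _)
    (trans (shrunk-elementary (suc k) i n μ 1≤k) (sym (∑-map (0 ∷_) (cleared (suc k + i) μ) _)))
  shrunk-elementary k i n (suc x ∷ μ) 1≤k = begin
    ∑ (shrunk i (suc x ∷ μ)) (λ ν → elementaryAt k ν (suc n))
      ≡⟨ ∑-replaceOne (i <ᵇ_) (_∸ i) (suc x) μ (λ ν → elementaryAt k ν (suc n)) ⟩
    (i <ᵇ suc x) ▹ elementaryAt k (suc x ∸ i ∷ μ) (suc n) + ∑ (shrunk i μ) (λ ν → (suc x ≡ᵇ k) ▹ elementaryAt k ν n)
      ≡⟨ cong₂ _+_ (trans (▹-cong (i <ᵇ suc x) (λ t → first (suc x ∸ i) (ℕ.m<n⇒0<n∸m (ℕ.<ᵇ⇒< i (suc x) t)))) (trans (sym (▹-∧ (i <ᵇ suc x) (suc x ∸ i ≡ᵇ k) _)) (cong (_▹ elementaryAt k μ n) (∸-≡ᵇ i k (suc x) 1≤k))))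
           (trans (∑-▹ (suc x ≡ᵇ k) (shrunk i μ) _) (other n)) ⟩
    (suc x ≡ᵇ k + i) ▹ elementaryAt k μ n + ∑ (cleared (k + i) μ) (λ ν → elementaryAt k (suc x ∷ ν) n)
      ≡⟨ ∑-replaceOne (_≡ᵇ (k + i)) (λ _ → 0) (suc x) μ (λ ν → elementaryAt k ν n) ⟨
    ∑ (cleared (k + i) (suc x ∷ μ)) (λ ν → elementaryAt k ν n) ∎
    where
    first : ∀ y → 0 < y → elementaryAt k (y ∷ μ) (suc n) ≡ (y ≡ᵇ k) ▹ elementaryAt k μ n
    first (suc y) _ = refl
    other : ∀ n → (suc x ≡ᵇ k) ▹ ∑ (shrunk i μ) (λ ν → elementaryAt k ν n) ≡ ∑ (cleared (k + i) μ) (λ ν → elementaryAt k (suc x ∷ ν) n)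
    other zero    = trans (cong ((suc x ≡ᵇ k) ▹_) (shrunk-elementary-0 k i μ)) (trans (▹-zero (suc x ≡ᵇ k)) (sym (∑-zero (cleared (k + i) μ))))
    other (suc n) = trans (cong ((suc x ≡ᵇ k) ▹_) (shrunk-elementary k i n μ 1≤k)) (sym (∑-▹ (suc x ≡ᵇ k) (cleared (k + i) μ) _))

  elementary-diagonal : ∀ k n → 1 ≤ k → elementaryAt k (replicate n k) n ≡ 1
  elementary-diagonal k       zero    1≤k = refl
  elementary-diagonal (suc k) (suc n) 1≤k = trans (cong (_▹ elementaryAt (suc k) (replicate n (suc k)) n) (≡ᵇ-refl k)) (elementary-diagonal (suc k) n 1≤k)

  elementary-off-diagonal : ∀ k n μ → All (0 <_) μ → replicate n k ≢ μ → elementaryAt k μ n ≡ 0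
  elementary-off-diagonal k zero    []          p       ne = ⊥-elim (ne refl)
  elementary-off-diagonal k (suc n) []          p       ne = refl
  elementary-off-diagonal k zero    (zero ∷ μ)  (() ∷ _)
  elementary-off-diagonal k zero    (suc x ∷ μ) p       ne = refl
  elementary-off-diagonal k (suc n) (suc x ∷ μ) (_ ∷ p) ne = ▹-false (suc x ≡ᵇ k) λ t →
    elementary-off-diagonal k n μ p (λ e → ne (cong₂ _∷_ (sym (ℕ.≡ᵇ⇒≡ (suc x) k t)) e))

  -- Hooks and the Pieri rule

  -- Trailing zeros are accepted because `strips` keeps empty rows.
  isColumn : ℕ → List ℕ → Bool
  isColumn k       []       = k ≡ᵇ 0
  isColumn zero    (x ∷ λ') = (x ≡ᵇ 0) ∧ isColumn zero λ'
  isColumn (suc k) (x ∷ λ') = (x ≡ᵇ 1) ∧ isColumn k λ'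

  isHook : ℕ → ℕ → List ℕ → Bool
  isHook a k []       = false
  isHook a k (x ∷ λ') = (x ≡ᵇ a) ∧ isColumn k λ'

  isColumn-0 : ∀ λ' → isColumn 0 λ' ≡ allB (_≡ᵇ 0) λ'
  isColumn-0 []       = refl
  isColumn-0 (x ∷ λ') = cong ((x ≡ᵇ 0) ∧_) (isColumn-0 λ')

  hd-bool : ∀ {n λ'} → hd λ' ≤ n → (hd λ' ≤ᵇ n) ≡ true
  hd-bool {n} {λ'} le = T-ext {hd λ' ≤ᵇ n} {true} (λ _ → tt) (λ _ → ℕ.≤⇒≤ᵇ le)

  ∧-false : ∀ b → (b ∧ false) ▹ 1 ≡ 0
  ∧-false true  = refl
  ∧-false false = refl

  -- From a single column a horizontal strip takes either nothing or the bottom box. The test φ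
  -- absorbs the boxes already removed from the row above.
  ∑-column : ∀ (φ : ℕ → Bool) k λ' → Dec 1 λ' →
    ∑ (strips λ') (λ p → (φ (proj₁ p) ∧ isColumn k (proj₂ p)) ▹ 1) ≡ (φ 0 ∧ isColumn k λ') ▹ 1 + (φ 1 ∧ isColumn (suc k) λ') ▹ 1
  ∑-column φ k [] [] = cong ((φ 0 ∧ (k ≡ᵇ 0)) ▹ 1 +_) (sym (∧-false (φ 1)))
  ∑-column φ k (zero ∷ λ') (_ ∷ d) = trans (strips-zero (z≤n ∷ d) (λ p → (φ (proj₁ p) ∧ isColumn k (proj₂ p)) ▹ 1))
    (trans (sym (ℕ.+-identityʳ _)) (cong ((φ 0 ∧ isColumn k (0 ∷ λ')) ▹ 1 +_) (sym (∧-false (φ 1)))))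
  ∑-column φ k (suc (suc x) ∷ λ') (s≤s () ∷ d)
  ∑-column φ k (suc zero ∷ λ') (_ ∷ d) = trans (∑-strips 1 λ' Φ) (trans (cong (A k +_) (ℕ.+-identityʳ (B k))) (go k))
    where
    Φ : ℕ × List ℕ → ℕ
    Φ p = (φ (proj₁ p) ∧ isColumn k (proj₂ p)) ▹ 1
    A B : ℕ → ℕ
    A k = (hd λ' ≤ᵇ 0) ▹ ∑ (strips λ') (λ p → (φ (suc (proj₁ p)) ∧ isColumn k (0 ∷ proj₂ p)) ▹ 1)
    B k = (hd λ' ≤ᵇ 1) ▹ ∑ (strips λ') (λ p → (φ (proj₁ p) ∧ isColumn k (1 ∷ proj₂ p)) ▹ 1)
    empty : ∀ λ' → Dec 1 λ' → (hd λ' ≤ᵇ 0) ▹ ∑ (strips λ') (λ p → (φ (suc (proj₁ p)) ∧ isColumn 0 (0 ∷ proj₂ p)) ▹ 1) ≡ (φ 1 ∧ isColumn 0 λ') ▹ 1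
    empty []           d       = ℕ.+-identityʳ _
    empty (zero ∷ λ')  (_ ∷ d) = strips-zero (z≤n ∷ d) (λ p → (φ (suc (proj₁ p)) ∧ isColumn 0 (0 ∷ proj₂ p)) ▹ 1)
    empty (suc x ∷ λ') d       = sym (∧-false (φ 1))
    go : ∀ k → A k + B k ≡ (φ 0 ∧ isColumn k (1 ∷ λ')) ▹ 1 + (φ 1 ∧ isColumn (suc k) (1 ∷ λ')) ▹ 1
    go zero = begin
      A 0 + B 0 ≡⟨ cong₂ _+_ (empty λ' d) (▹-false (hd λ' ≤ᵇ 1) (λ _ → ∑-vanish (strips λ') (λ p → ∧-false (φ (proj₁ p))))) ⟩
      (φ 1 ∧ isColumn 0 λ') ▹ 1 + 0 ≡⟨ ℕ.+-comm _ 0 ⟩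
      0 + (φ 1 ∧ isColumn 0 λ') ▹ 1 ≡⟨ cong (_+ (φ 1 ∧ isColumn 0 λ') ▹ 1) (∧-false (φ 0)) ⟨
      (φ 0 ∧ false) ▹ 1 + (φ 1 ∧ isColumn 0 λ') ▹ 1 ∎
    go (suc k) = begin
      A (suc k) + B (suc k)
        ≡⟨ cong₂ _+_ {u = B (suc k)} {v = ∑ (strips λ') Ψ}
             (▹-false (hd λ' ≤ᵇ 0) (λ _ → ∑-vanish (strips λ') (λ p → ∧-false (φ (suc (proj₁ p))))))
             (cong (_▹ ∑ (strips λ') Ψ) (hd-bool {1} {λ'} (Dec-hd d))) ⟩
      ∑ (strips λ') Ψ
        ≡⟨ ∑-column φ k λ' d ⟩
      (φ 0 ∧ isColumn k λ') ▹ 1 + (φ 1 ∧ isColumn (suc k) λ') ▹ 1 ∎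
      where
      Ψ : ℕ × List ℕ → ℕ
      Ψ p = (φ (proj₁ p) ∧ isColumn k (proj₂ p)) ▹ 1

  isColumn-wide : ∀ k {x λ'} → 1 < x → isColumn k (x ∷ λ') ≡ false
  isColumn-wide zero    (s≤s (s≤s _)) = refl
  isColumn-wide (suc k) (s≤s (s≤s _)) = refl

  -- h_a e_{k+1} = s_{(a, 1^{k+1})} + s_{(a+1, 1^k)}.
  pieri : ∀ a k {m} λ' → 1 ≤ a → Dec m λ' →
    ∑ (strips λ') (λ p → ((proj₁ p ≡ᵇ a) ∧ isHook 1 k (proj₂ p)) ▹ 1) ≡ isHook a (suc k) λ' ▹ 1 + isHook (suc a) k λ' ▹ 1
  pieri (suc a) k []           _ d       = refl
  pieri (suc a) k (zero ∷ λ')  _ (_ ∷ d) = trans (∑-strips 0 λ' _) (trans (ℕ.+-identityʳ _)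
    (▹-false (hd λ' ≤ᵇ 0) (λ _ → ∑-vanish (strips λ') (λ p → ∧-false (proj₁ p ≡ᵇ suc a)))))
  pieri a k (suc x ∷ λ') _ (_ ∷ d) = begin
    ∑ (strips (suc x ∷ λ')) Φ
      ≡⟨ ∑-strips (suc x) λ' Φ ⟩
    ∑ (upTo (suc (suc x))) Y
      ≡⟨ trans (∑-upTo-suc (suc x) Y) (cong (Y 0 +_) (∑-upTo-suc x (Y ∘ suc))) ⟩
    Y 0 + (Y 1 + ∑ (upTo x) (λ y → Y (2 + y)))
      -- What remains after the strip must be a column of height k + 1, so the first row keeps
      -- exactly one box.
      ≡⟨ cong₂ (λ u v → u + (Y 1 + v)) (vanish 0 (λ ())) (∑-vanish (upTo x) (λ y → vanish (2 + y) (λ ()))) ⟩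
    Y 1 + 0
      ≡⟨ ℕ.+-identityʳ (Y 1) ⟩
    Y 1
      ≡⟨ middle λ' d ⟩
    ((x + 0 ≡ᵇ a) ∧ isColumn k λ') ▹ 1 + ((x + 1 ≡ᵇ a) ∧ isColumn (suc k) λ') ▹ 1
      ≡⟨ cong₂ (λ u v → ((u ≡ᵇ a) ∧ isColumn k λ') ▹ 1 + ((v ≡ᵇ a) ∧ isColumn (suc k) λ') ▹ 1) (ℕ.+-identityʳ x) (ℕ.+-comm x 1) ⟩
    isHook (suc a) k (suc x ∷ λ') ▹ 1 + isHook a (suc k) (suc x ∷ λ') ▹ 1
      ≡⟨ ℕ.+-comm (isHook (suc a) k (suc x ∷ λ') ▹ 1) _ ⟩
    isHook a (suc k) (suc x ∷ λ') ▹ 1 + isHook (suc a) k (suc x ∷ λ') ▹ 1 ∎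
    where
    Φ : ℕ × List ℕ → ℕ
    Φ p = ((proj₁ p ≡ᵇ a) ∧ isHook 1 k (proj₂ p)) ▹ 1
    Y : ℕ → ℕ
    Y y = (hd λ' ≤ᵇ y) ▹ ∑ (strips λ') (Φ ∘ stripCons (suc x) y)
    vanish : ∀ y → y ≢ 1 → Y y ≡ 0
    vanish y ne = ▹-false (hd λ' ≤ᵇ y) (λ _ → ∑-vanish (strips λ') (λ p →
      trans (cong (λ b → ((suc x ∸ y + proj₁ p ≡ᵇ a) ∧ (b ∧ isColumn k (proj₂ p))) ▹ 1) (≢⇒≡ᵇ ne)) (∧-false (suc x ∸ y + proj₁ p ≡ᵇ a))))
    middle : ∀ λ' → Dec (suc x) λ' → (hd λ' ≤ᵇ 1) ▹ ∑ (strips λ') (λ p → ((x + proj₁ p ≡ᵇ a) ∧ isColumn k (proj₂ p)) ▹ 1)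
                                   ≡ ((x + 0 ≡ᵇ a) ∧ isColumn k λ') ▹ 1 + ((x + 1 ≡ᵇ a) ∧ isColumn (suc k) λ') ▹ 1
    middle λ' d with hd λ' ℕ.≤? 1
    ... | yes le rewrite hd-bool {1} {λ'} le = ∑-column (λ i → x + i ≡ᵇ a) k λ' (Dec-weaken le (Dec-tighten d))
    middle []       d | no gt = ⊥-elim (gt z≤n)
    middle (z ∷ λ') d | no gt rewrite isColumn-wide k {z} {λ'} (ℕ.≰⇒> gt) | isColumn-wide (suc k) {z} {λ'} (ℕ.≰⇒> gt) =
      trans (▹-false (z ≤ᵇ 1) (λ t → ⊥-elim (gt (ℕ.≤ᵇ⇒≤ z 1 t)))) (sym (cong₂ _+_ (∧-false (x + 0 ≡ᵇ a)) (∧-false (x + 1 ≡ᵇ a))))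

  Kr-row : ∀ a {m} λ' → 1 ≤ a → Dec m λ' → Kr (a ∷ []) λ' ≡ isHook a 0 λ' ▹ 1
  Kr-row (suc a) []       _ d       = refl
  Kr-row a       (x ∷ λ') _ (_ ∷ d) = trans (Kr-single a x λ' d)
    (trans (cong (λ b → (x ≡ᵇ a) ▹ b ▹ 1) (sym (isColumn-0 λ'))) (sym (▹-∧ (x ≡ᵇ a) (isColumn 0 λ') 1)))

  isHook-refl : ∀ a k → isHook a k (a ∷ replicate k 1) ≡ true
  isHook-refl a k rewrite ≡ᵇ-refl a = col k
    where
    col : ∀ k → isColumn k (replicate k 1) ≡ true
    col zero    = refl
    col (suc k) = col k

  isHook-sound : ∀ a k λ' → All (0 <_) λ' → T (isHook a k λ') → λ' ≡ a ∷ replicate k 1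
  isHook-sound a k (x ∷ λ') (_ ∷ p) t = cong₂ _∷_ (ℕ.≡ᵇ⇒≡ x a (T-∧₁ t)) (col k λ' p (T-∧₂ {x ≡ᵇ a} t))
    where
    col : ∀ k λ' → All (0 <_) λ' → T (isColumn k λ') → λ' ≡ replicate k 1
    col zero    []           _       _ = refl
    col zero    (zero ∷ λ')  (() ∷ _) _
    col (suc k) (x ∷ λ')     (_ ∷ p) t = cong₂ _∷_ (ℕ.≡ᵇ⇒≡ x 1 (T-∧₁ t)) (col k λ' p (T-∧₂ {x ≡ᵇ 1} t))

open Counting

module Counts = Sums ℕ.+-*-commutativeSemiring

-- Transfer of counts to the ring, and Newton's identity for complete functions

module OverRing {c ℓ : Level} (K : CommutativeRing c ℓ) where
  open CommutativeRing K hiding (zero)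
  open import Relation.Binary.Reasoning.Setoid setoid
  open Sums commutativeSemiring
  open StripSums commutativeSemiring
  open ReplaceSums commutativeSemiring
  open HOps commutativeSemiring

  natK-1 : natK K 1 ≈ 1#
  natK-1 = +-identityʳ 1#

  natK-+ : ∀ a b → natK K (a ℕ.+ b) ≈ natK K a + natK K b
  natK-+ zero    b = sym (+-identityˡ _)
  natK-+ (suc a) b = trans (+-congˡ (natK-+ a b)) (sym (+-assoc _ _ _))

  natK-* : ∀ a b → natK K (a ℕ.* b) ≈ natK K a * natK K b
  natK-* zero    b = sym (zeroˡ _)
  natK-* (suc a) b = trans (natK-+ b (a ℕ.* b))
    (trans (+-cong (sym (*-identityˡ _)) (natK-* a b)) (sym (distribʳ _ _ _)))

  natK-▹ : ∀ b u → natK K (Counts._▹_ b u) ≈ b ▹ natK K u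
  natK-▹ true  u = refl
  natK-▹ false u = refl

  natK-∑ : ∀ {a} {A : Set a} (xs : List A) (f : A → ℕ) → natK K (Counts.∑ xs f) ≈ ∑ xs (natK K ∘ f)
  natK-∑ []       f = refl
  natK-∑ (x ∷ xs) f = trans (natK-+ (f x) _) (+-congˡ (natK-∑ xs f))

  ▹-* : ∀ b u v → b ▹ (u * v) ≈ (b ▹ u) * v
  ▹-* true  u v = refl
  ▹-* false u v = sym (zeroˡ v)

  x+y-y≈x : ∀ x y → x + y - y ≈ x
  x+y-y≈x x y = trans (+-assoc _ _ _) (trans (+-congˡ (-‿inverseʳ _)) (+-identityʳ _))

  *-exchange : ∀ a b c → a * (b * c) ≈ b * (a * c)
  *-exchange a b c = trans (sym (*-assoc a b c)) (trans (*-congʳ (*-comm a b)) (*-assoc b a c))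

  -‿∑ : ∀ {a} {A : Set a} (xs : List A) (f : A → Carrier) → - ∑ xs f ≈ ∑ xs (λ x → - f x)
  -‿∑ []       f = -0#≈0#
    where open import Algebra.Properties.Ring ring using (-0#≈0#)
  -‿∑ (x ∷ xs) f = trans (sym (-‿+-comm _ _)) (+-congˡ (-‿∑ xs f))
    where open import Algebra.Properties.Ring ring using (-‿+-comm)

  ∑-pick : ∀ {a} {A : Set a} {L : List A} {x} (f : A → Carrier) → AllPairs _≢_ L → x ∈ L →
           (∀ {y} → y ∈ L → y ≢ x → f y ≈ 0#) → ∑ L f ≈ f x
  ∑-pick {L = y ∷ L} f (ne ∷ u) (here ≡.refl) z =
    trans (+-congˡ (trans (∑-congAll (All.tabulate (λ {w} w∈ → z (there w∈) (λ { ≡.refl → All.lookup ne w∈ ≡.refl })))) (∑-zero L))) (+-identityʳ _)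
  ∑-pick {L = y ∷ L} f (ne ∷ u) (there x∈) z =
    trans (+-cong (z (here ≡.refl) (λ { ≡.refl → All.lookup ne x∈ ≡.refl })) (∑-pick f u x∈ (λ w∈ → z (there w∈)))) (+-identityˡ _)

  ∑-cong∈ : ∀ {a} {A : Set a} {f g : A → Carrier} L → (∀ {x} → x ∈ L → f x ≈ g x) → ∑ L f ≈ ∑ L g
  ∑-cong∈ L e = ∑-congAll (All.tabulate e)

  Partitions-unique : ∀ n → AllPairs _≢_ (Partitions n)
  Partitions-unique n = AllPairs.map proj₁ (pars-unitriangular n n n)

  -- The operator form of m h_m = Σ_{i ≥ 1} p_i h_{m-i}.
  newton : ∀ m μ (g : List ℕ → Carrier) →
    natK K (suc m) * ∑ (hs μ (suc m)) g ≈ ∑⊕ m (λ i j → ∑ (lowered (suc i) μ) (λ ν → ∑ (hs ν j) g))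
  newton m []      g = trans (zeroʳ _) (sym (∑⊕-zero m))
  newton m (x ∷ μ) g = trans (go m x) (trans (sym (∑⊕-+ m _ _)) (∑⊕-cong m (λ i j _ → sym (∑-replaceOne (suc i ≤ᵇ_) (_∸ suc i) x μ (λ ν → ∑ (hs ν j) g)))))
    where
    A : ℕ → ℕ → Carrier
    A m x = ∑ (hs (x ∷ μ) m) g
    -- U collects the terms in which the power sum lowers the first entry, V those in which it
    -- lowers a later one, and V′ the part of V in which the complete function leaves the first
    -- entry alone.
    U V V′ : ℕ → ℕ → Carrier
    U m x = ∑⊕ m (λ i j → (suc i ≤ᵇ x) ▹ A j (x ∸ suc i))
    V m x = ∑⊕ m (λ i j → ∑ (lowered (suc i) μ) (λ ν → ∑ (hs (x ∷ ν) j) g))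
    V′ m x = ∑⊕ m (λ i j → ∑ (lowered (suc i) μ) (λ ν → ∑ (hs ν j) (g ∘ (x ∷_))))
    hs-0∷ : ∀ x ν → ∑ (hs (suc x ∷ ν) 0) g ≡ ∑ (hs ν 0) (g ∘ (suc x ∷_))
    hs-0∷ x ν = ∑-map (suc x ∷_) (hs ν 0) g
    V-suc : ∀ m x → V (suc m) (suc x) ≈ V′ (suc m) (suc x) + V m x
    V-suc m x = begin
      V (suc m) (suc x)
        ≈⟨ ∑⊕-snoc m (λ i j → ∑ (lowered (suc i) μ) (λ ν → ∑ (hs (suc x ∷ ν) j) g)) ⟩
      ∑⊕ m (λ i j → ∑ (lowered (suc i) μ) (λ ν → ∑ (hs (suc x ∷ ν) (suc j)) g)) + ∑ (lowered (suc (suc m)) μ) (λ ν → ∑ (hs (suc x ∷ ν) 0) g)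
        ≈⟨ +-cong
            (trans (∑⊕-cong m (λ i j _ → trans (∑-cong (lowered (suc i) μ) (λ ν → hs-suc x ν j g)) (∑-+ (lowered (suc i) μ) _ _))) (∑⊕-+ m _ _))
            (∑-cong (lowered (suc (suc m)) μ) (λ ν → reflexive (hs-0∷ x ν))) ⟩
      (P + V m x) + Q
        ≈⟨ trans (+-assoc _ _ _) (trans (+-congˡ (+-comm _ _)) (sym (+-assoc _ _ _))) ⟩
      (P + Q) + V m x
        ≈⟨ +-congʳ (∑⊕-snoc m (λ i j → ∑ (lowered (suc i) μ) (λ ν → ∑ (hs ν j) (g ∘ (suc x ∷_))))) ⟨
      V′ (suc m) (suc x) + V m x ∎
      where
      P = ∑⊕ m (λ i j → ∑ (lowered (suc i) μ) (λ ν → ∑ (hs ν (suc j)) (g ∘ (suc x ∷_))))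
      Q = ∑ (lowered (suc (suc m)) μ) (λ ν → ∑ (hs ν 0) (g ∘ (suc x ∷_)))
    U-suc : ∀ m x → U (suc m) (suc x) ≈ A (suc m) x + U m x
    U-suc m x = +-congˡ (∑⊕-cong m (λ i j _ → reflexive (cong (_▹ A j (x ∸ suc i)) (≤ᵇ-suc (suc i) x))))
    first : ∀ m x → natK K (suc m) * ∑ (hs μ (suc m)) (g ∘ (x ∷_)) ≈ V′ m x
    first m x = newton m μ (g ∘ (x ∷_))
    go : ∀ m x → natK K (suc m) * A (suc m) x ≈ U m x + V m x
    go m zero = begin
      natK K (suc m) * A (suc m) 0 ≡⟨ cong (natK K (suc m) *_) (∑-map (0 ∷_) (hs μ (suc m)) g) ⟩
      natK K (suc m) * ∑ (hs μ (suc m)) (g ∘ (0 ∷_)) ≈⟨ first m 0 ⟩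
      V′ m 0 ≈⟨ ∑⊕-cong m (λ i j _ → ∑-cong (lowered (suc i) μ) (λ ν → reflexive (≡.sym (∑-map (0 ∷_) (hs ν j) g)))) ⟩
      V m 0 ≈⟨ +-identityˡ _ ⟨
      0# + V m 0 ≈⟨ +-congʳ (∑⊕-zero m) ⟨
      U m 0 + V m 0 ∎
    go zero (suc x) = begin
      natK K 1 * A 1 (suc x) ≈⟨ *-congˡ (hs-suc x μ 0 g) ⟩
      natK K 1 * (∑ (hs μ 1) (g ∘ (suc x ∷_)) + A 0 x) ≈⟨ distribˡ _ _ _ ⟩
      natK K 1 * ∑ (hs μ 1) (g ∘ (suc x ∷_)) + natK K 1 * A 0 x ≈⟨ +-cong (first 0 (suc x)) (trans (*-congʳ natK-1) (*-identityˡ _)) ⟩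
      V′ 0 (suc x) + A 0 x ≈⟨ +-comm _ _ ⟩
      A 0 x + V′ 0 (suc x) ≈⟨ +-congˡ (∑-cong (lowered 1 μ) (λ ν → reflexive (≡.sym (hs-0∷ x ν)))) ⟩
      U 0 (suc x) + V 0 (suc x) ∎
    go (suc m) (suc x) = begin
      natK K (2 ℕ.+ m) * A (2 ℕ.+ m) (suc x)
        ≈⟨ *-congˡ (hs-suc x μ (suc m) g) ⟩
      natK K (2 ℕ.+ m) * (∑ (hs μ (2 ℕ.+ m)) (g ∘ (suc x ∷_)) + A (suc m) x)
        ≈⟨ distribˡ _ _ _ ⟩
      -- The summand 1 split off from the factor m + 2 supplies the term of U in which p_1 lowers
      -- the first entry; the remaining m + 1 is the factor in the inductive hypothesis.
      natK K (2 ℕ.+ m) * ∑ (hs μ (2 ℕ.+ m)) (g ∘ (suc x ∷_)) + (1# + natK K (suc m)) * A (suc m) x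
        ≈⟨ +-cong (first (suc m) (suc x)) (trans (distribʳ _ _ _) (+-cong (*-identityˡ _) (go m x))) ⟩
      V′ (suc m) (suc x) + (A (suc m) x + (U m x + V m x))
        ≈⟨ solve 4 (λ t a u s → t :+ (a :+ (u :+ s)) := (a :+ u) :+ (t :+ s)) refl _ _ _ _ ⟩
      (A (suc m) x + U m x) + (V′ (suc m) (suc x) + V m x)
        ≈⟨ +-cong (U-suc m x) (V-suc m x) ⟨
      U (suc m) (suc x) + V (suc m) (suc x) ∎
      where
      open import Algebra.Solver.Ring.NaturalCoefficients.Default commutativeSemiring

_≟ᴸ_ : DecidableEquality (List ℕ)
_≟ᴸ_ = List-≡-dec ℕ._≟_

-- Polynomials in the complete symmetric functions

module HPolynomials {c ℓ : Level} (K : CommutativeRing c ℓ) (F : Series K)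
                    (F-0 : CommutativeRing._≈_ K (F 0) (CommutativeRing.1# K)) where
  open CommutativeRing K hiding (zero)
  open import Relation.Binary.Reasoning.Setoid setoid
  open Sums commutativeSemiring
  open StripSums commutativeSemiring
  open HOps commutativeSemiring
  open OverRing K

  R : Sym K
  R α = Πl K α F

  R-↭ : ∀ {α β} → α ↭ β → R α ≈ R β
  R-↭ Perm.refl         = refl
  R-↭ (Perm.prep x p)   = *-congˡ (R-↭ p)
  R-↭ (Perm.swap x y p) = trans (*-congˡ (*-congˡ (R-↭ p)))
    (*-exchange _ _ _)
  R-↭ (Perm.trans p q)  = trans (R-↭ p) (R-↭ q)

  R-toPartition : ∀ α → R (toPartition α) ≈ R α
  R-toPartition α = trans (R-↭ (sortD-↭ (filterB nonzero α))) (drop α)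
    where
    drop : ∀ α → R (filterB nonzero α) ≈ R α
    drop []          = refl
    drop (zero ∷ α)  = trans (drop α) (trans (sym (*-identityˡ _)) (*-congʳ (sym F-0)))
    drop (suc x ∷ α) = *-congˡ (drop α)

  h : List ℕ → List ℕ → Carrier
  h κ μ = natK K (hCoeff κ μ)

  -- HPoly n g v: the symmetric function with coefficients g is a linear combination of the
  -- h_κ with |κ| = n, and the homomorphism φ with φ(h_i) = F i sends this combination to v.
  record HPoly (n : ℕ) (g : List ℕ → Carrier) (v : Carrier) : Set (c ⊔ˡ ℓ) where
    constructor hPoly
    field
      terms     : List (Carrier × List ℕ)
      degree    : All (λ t → sumℕ (proj₂ t) ≡ n) terms
      evaluates : ∀ μ → ∑ terms (λ t → proj₁ t * h (proj₂ t) μ) ≈ g μ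
      value     : ∑ terms (λ t → proj₁ t * R (proj₂ t)) ≈ v
  open HPoly

  HPoly-cong : ∀ {n n′ g g′ v v′} → n ≡ n′ → (∀ μ → g μ ≈ g′ μ) → v ≈ v′ → HPoly n g v → HPoly n′ g′ v′
  HPoly-cong ≡.refl eg ev (hPoly t d e w) = hPoly t d (λ μ → trans (e μ) (eg μ)) (trans w ev)

  HPoly-0 : ∀ {n} → HPoly n (λ _ → 0#) 0#
  HPoly-0 = hPoly [] [] (λ _ → refl) refl

  HPoly-1 : HPoly 0 (h []) 1#
  HPoly-1 = hPoly ((1# , []) ∷ []) (≡.refl ∷ []) (λ μ → trans (+-identityʳ _) (*-identityˡ _)) (trans (+-identityʳ _) (*-identityˡ _))

  HPoly-+ : ∀ {n g g′ v v′} → HPoly n g v → HPoly n g′ v′ → HPoly n (λ μ → g μ + g′ μ) (v + v′)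
  HPoly-+ (hPoly t d e w) (hPoly t′ d′ e′ w′) =
    hPoly (t ++ t′) (All.++⁺ d d′) (λ μ → trans (∑-++ t t′ _) (+-cong (e μ) (e′ μ))) (trans (∑-++ t t′ _) (+-cong w w′))

  HPoly-* : ∀ a {n g v} → HPoly n g v → HPoly n (λ μ → a * g μ) (a * v)
  HPoly-* a (hPoly t d e w) = hPoly (map scale t) (All.map⁺ d)
    (λ μ → trans (scaled (λ κ → h κ μ)) (*-congˡ (e μ))) (trans (scaled R) (*-congˡ w))
    where
    scale : Carrier × List ℕ → Carrier × List ℕ
    scale (b , κ) = a * b , κ
    scaled : ∀ f → ∑ (map scale t) (λ s → proj₁ s * f (proj₂ s)) ≈ a * ∑ t (λ s → proj₁ s * f (proj₂ s))
    scaled f = trans (reflexive (∑-map scale t _)) (trans (∑-cong t (λ s → *-assoc _ _ _)) (∑-*ˡ a t _))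

  HPoly-h : ∀ m {n g v} → HPoly n g v → HPoly (m ℕ.+ n) (λ μ → ∑ (hs μ m) g) (F m * v)
  HPoly-h m {n} {g} {v} (hPoly t d e w) = hPoly (map cons t) (All.map⁺ (All.map (cong (m ℕ.+_)) d)) ev val
    where
    cons : Carrier × List ℕ → Carrier × List ℕ
    cons (b , κ) = b , m ∷ κ
    ev : ∀ μ → ∑ (map cons t) (λ s → proj₁ s * h (proj₂ s) μ) ≈ ∑ (hs μ m) g
    ev μ = begin
      ∑ (map cons t) (λ s → proj₁ s * h (proj₂ s) μ)
        ≡⟨ ∑-map cons t _ ⟩
      ∑ t (λ s → proj₁ s * h (m ∷ proj₂ s) μ)
        ≈⟨ ∑-cong t (λ s → trans (*-congˡ (trans (reflexive (cong (natK K) (hCoeff-∷ m (proj₂ s) μ))) (natK-∑ (hs μ m) _))) (sym (∑-*ˡ (proj₁ s) (hs μ m) _))) ⟩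
      ∑ t (λ s → ∑ (hs μ m) (λ ν → proj₁ s * h (proj₂ s) ν))
        ≈⟨ ∑-swap t (hs μ m) _ ⟩
      ∑ (hs μ m) (λ ν → ∑ t (λ s → proj₁ s * h (proj₂ s) ν))
        ≈⟨ ∑-cong (hs μ m) e ⟩
      ∑ (hs μ m) g ∎
    val : ∑ (map cons t) (λ s → proj₁ s * R (proj₂ s)) ≈ F m * v
    val = begin
      ∑ (map cons t) (λ s → proj₁ s * R (proj₂ s)) ≡⟨ ∑-map cons t _ ⟩
      ∑ t (λ s → proj₁ s * (F m * R (proj₂ s))) ≈⟨ ∑-cong t (λ s → *-exchange _ _ _) ⟩
      ∑ t (λ s → F m * (proj₁ s * R (proj₂ s))) ≈⟨ ∑-*ˡ (F m) t _ ⟩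
      F m * ∑ t (λ s → proj₁ s * R (proj₂ s)) ≈⟨ *-congˡ w ⟩
      F m * v ∎

  HPoly-minus : ∀ {n g g′ v v′} → HPoly n g v → HPoly n g′ v′ → HPoly n (λ μ → g μ - g′ μ) (v - v′)
  HPoly-minus p q = HPoly-cong ≡.refl (λ μ → +-congˡ (-1*x≈-x _)) (+-congˡ (-1*x≈-x _)) (HPoly-+ p (HPoly-* (- 1#) q))
    where open import Algebra.Properties.Ring ring using (-1*x≈-x)

  HPoly-∑⊕ : ∀ k {n} {g : ℕ → ℕ → List ℕ → Carrier} {v : ℕ → ℕ → Carrier} →
             (∀ i j → i ℕ.+ j ≡ k → HPoly n (g i j) (v i j)) → HPoly n (λ μ → ∑⊕ k (λ i j → g i j μ)) (∑⊕ k v)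
  HPoly-∑⊕ zero    p = p 0 0 ≡.refl
  HPoly-∑⊕ (suc k) p = HPoly-+ (p 0 (suc k) ≡.refl) (HPoly-∑⊕ k (λ i j e → p (suc i) j (cong suc e)))

  -- The matrix [m_κ] h_λ is symmetric, so φ(h_κ) = [m_κ] R is also the combination of the [m_λ] h_κ
  -- with the h-coefficients of R as weights.
  HPoly-pairing : ∀ {n g v cf} → IsExpansion K n (hF K) R cf → HPoly n g v → v ≈ ∑ (Partitions n) (λ λ' → cf λ' * g λ')
  HPoly-pairing {n} {g} {v} {cf} ex (hPoly t d e w) = begin
    v
      ≈⟨ w ⟨
    ∑ t (λ s → proj₁ s * R (proj₂ s))
      ≈⟨ ∑-congAll (All.map (λ {s} ds → trans (*-congˡ (term (proj₂ s) ds)) (sym (∑-*ˡ (proj₁ s) (Partitions n) _))) d) ⟩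
    ∑ t (λ s → ∑ (Partitions n) (λ λ' → proj₁ s * (cf λ' * h (proj₂ s) λ')))
      ≈⟨ ∑-swap t (Partitions n) _ ⟩
    ∑ (Partitions n) (λ λ' → ∑ t (λ s → proj₁ s * (cf λ' * h (proj₂ s) λ')))
      ≈⟨ ∑-cong (Partitions n) (λ λ' → trans (∑-cong t (λ s → *-exchange _ _ _))
           (trans (∑-*ˡ (cf λ') t _) (*-congˡ (e λ')))) ⟩
    ∑ (Partitions n) (λ λ' → cf λ' * g λ') ∎
    where
    term : ∀ κ → sumℕ κ ≡ n → R κ ≈ ∑ (Partitions n) (λ λ' → cf λ' * h κ λ')
    term κ ≡.refl = begin
      R κ ≈⟨ R-toPartition κ ⟨
      R (toPartition κ) ≈⟨ ex (toPartition κ) (toPartition-∈ κ) ⟩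
      ∑ (Partitions n) (λ λ' → cf λ' * h λ' (toPartition κ)) ≈⟨ ∑-cong (Partitions n) (λ λ' → *-congˡ (reflexive (cong (natK K)
                                                                      (≡.trans (hCoeff-sym λ' (toPartition κ)) (hCoeff-toPartition κ λ'))))) ⟩
      ∑ (Partitions n) (λ λ' → cf λ' * h κ λ') ∎

  -- With g equal to m_{λ₀} in degree n, the pairing has a single nonzero term.
  HPoly-coefficient : ∀ {n λ₀ g v cf} → IsExpansion K n (hF K) R cf → HPoly n g v → λ₀ ∈ Partitions n →
                      g λ₀ ≈ 1# → (∀ {μ} → μ ∈ Partitions n → μ ≢ λ₀ → g μ ≈ 0#) → cf λ₀ ≈ v
  HPoly-coefficient {n} {λ₀} {g} {v} {cf} ex p λ₀∈ g1 g0 = sym (begin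
    v ≈⟨ HPoly-pairing ex p ⟩
    ∑ (Partitions n) (λ λ' → cf λ' * g λ') ≈⟨ ∑-pick _ (Partitions-unique n) λ₀∈ (λ μ∈ ne → trans (*-congˡ (g0 μ∈ ne)) (zeroʳ _)) ⟩
    cf λ₀ * g λ₀ ≈⟨ trans (*-congˡ g1) (*-identityʳ _) ⟩
    cf λ₀ ∎)

  HPoly-expansion : ∀ {n g v f} → HPoly n g v → (∀ {μ} → μ ∈ Partitions n → g μ ≈ f μ) → ∃ λ ch → IsExpansion K n (hF K) f ch
  HPoly-expansion {n} {g} {f = f} (hPoly t d e _) gf = ch , ex
    where
    δ : List ℕ → List ℕ → Bool
    δ κ λ' = does (toPartition κ ≟ᴸ λ')
    -- Several terms may sort to the same partition, so their coefficients are added.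
    ch : List ℕ → Carrier
    ch λ' = ∑ t (λ s → δ (proj₂ s) λ' ▹ proj₁ s)
    pick : ∀ μ a κ → sumℕ κ ≡ n → ∑ (Partitions n) (λ λ' → (δ κ λ' ▹ a) * h λ' μ) ≈ a * h κ μ
    pick μ a κ ≡.refl = trans
      (∑-pick _ (Partitions-unique n) (toPartition-∈ κ) (λ {λ'} _ ne →
        trans (*-congʳ (reflexive (cong (_▹ a) (dec-false (toPartition κ ≟ᴸ λ') (λ eq → ne (≡.sym eq)))))) (zeroˡ _)))
      (*-cong (reflexive (cong (_▹ a) (dec-true (toPartition κ ≟ᴸ toPartition κ) ≡.refl))) (reflexive (cong (natK K) (hCoeff-toPartition κ μ))))
    ex : IsExpansion K n (hF K) f ch
    ex μ μ∈ = begin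
      f μ
        ≈⟨ gf μ∈ ⟨
      g μ
        ≈⟨ e μ ⟨
      ∑ t (λ s → proj₁ s * h (proj₂ s) μ)
        ≈⟨ ∑-congAll (All.map (λ {s} ds → sym (pick μ (proj₁ s) (proj₂ s) ds)) d) ⟩
      ∑ t (λ s → ∑ (Partitions n) (λ λ' → (δ (proj₂ s) λ' ▹ proj₁ s) * h λ' μ))
        ≈⟨ ∑-swap t (Partitions n) _ ⟩
      ∑ (Partitions n) (λ λ' → ∑ t (λ s → (δ (proj₂ s) λ' ▹ proj₁ s) * h λ' μ))
        ≈⟨ ∑-cong (Partitions n) (λ λ' → ∑-*ʳ (h λ' μ) t _) ⟩
      ∑ (Partitions n) (λ λ' → ch λ' * h λ' μ) ∎

  module PowerSums (b : ℕ → Carrier) (F-newton : ∀ m → natK K (suc m) * F (suc m) ≈ ∑⊕ m (λ i j → b (suc i) * F j)) where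

    -- Newton's identity is solved for its last term p_{m+1} h_0, which needs only subtraction, and
    -- `F-newton` performs the same subtraction on the values. The bound N in `below` provides
    -- induction over all smaller indices.
    HPoly-lowered : ∀ m {n g v} → HPoly n g v → HPoly (suc m ℕ.+ n) (λ μ → ∑ (lowered (suc m) μ) g) (b (suc m) * v)
    HPoly-lowered m = below (suc m) m ℕ.≤-refl
      where
      open import Algebra.Properties.AbelianGroup +-abelianGroup using (xyx⁻¹≈y)
      below : ∀ N m → m < N → ∀ {n g v} → HPoly n g v → HPoly (suc m ℕ.+ n) (λ μ → ∑ (lowered (suc m) μ) g) (b (suc m) * v)
      below (suc N) zero _ {n} {g} {v} p = HPoly-cong ≡.refl
        (λ μ → trans (newton 0 μ g) (∑-cong (lowered 1 μ) (λ ν → hs-0 ν g)))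
        (trans (sym (*-assoc _ _ _)) (*-congʳ (trans (F-newton 0) (trans (*-congˡ F-0) (*-identityʳ _)))))
        (HPoly-* (natK K 1) (HPoly-h 1 p))
      below (suc N) (suc m) (s≤s m<N) {n} {g} {v} p = HPoly-cong ≡.refl ev val (HPoly-minus (HPoly-* (natK K (2 ℕ.+ m)) (HPoly-h (2 ℕ.+ m) p)) earlier)
        where
        earlier : HPoly (2 ℕ.+ m ℕ.+ n) (λ μ → ∑⊕ m (λ i j → ∑ (lowered (suc i) μ) (λ ν → ∑ (hs ν (suc j)) g)))
                        (∑⊕ m (λ i j → b (suc i) * (F (suc j) * v)))
        earlier = HPoly-∑⊕ m (λ i j e → HPoly-cong (degrees i j e) (λ _ → refl) refl
          (below N i (ℕ.≤-<-trans (subst (i ≤_) e (ℕ.m≤m+n i j)) m<N) (HPoly-h (suc j) p)))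
          where
          degrees : ∀ i j → i ℕ.+ j ≡ m → suc i ℕ.+ (suc j ℕ.+ n) ≡ 2 ℕ.+ m ℕ.+ n
          degrees i j ≡.refl = cong suc (≡.trans (ℕ.+-suc i (j ℕ.+ n)) (cong suc (≡.sym (ℕ.+-assoc i j n))))
        ev : ∀ μ → natK K (2 ℕ.+ m) * ∑ (hs μ (2 ℕ.+ m)) g - ∑⊕ m (λ i j → ∑ (lowered (suc i) μ) (λ ν → ∑ (hs ν (suc j)) g)) ≈ ∑ (lowered (2 ℕ.+ m) μ) g
        ev μ = begin
          natK K (2 ℕ.+ m) * ∑ (hs μ (2 ℕ.+ m)) g - E
            ≈⟨ +-congʳ (trans (newton (suc m) μ g) (∑⊕-snoc m (λ i j → ∑ (lowered (suc i) μ) (λ ν → ∑ (hs ν j) g)))) ⟩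
          E + ∑ (lowered (2 ℕ.+ m) μ) (λ ν → ∑ (hs ν 0) g) - E
            ≈⟨ xyx⁻¹≈y E _ ⟩
          ∑ (lowered (2 ℕ.+ m) μ) (λ ν → ∑ (hs ν 0) g)
            ≈⟨ ∑-cong (lowered (2 ℕ.+ m) μ) (λ ν → hs-0 ν g) ⟩
          ∑ (lowered (2 ℕ.+ m) μ) g ∎
          where E = ∑⊕ m (λ i j → ∑ (lowered (suc i) μ) (λ ν → ∑ (hs ν (suc j)) g))
        val : natK K (2 ℕ.+ m) * (F (2 ℕ.+ m) * v) - ∑⊕ m (λ i j → b (suc i) * (F (suc j) * v)) ≈ b (2 ℕ.+ m) * v
        val = begin
          natK K (2 ℕ.+ m) * (F (2 ℕ.+ m) * v) - ∑⊕ m (λ i j → b (suc i) * (F (suc j) * v))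
            ≈⟨ +-cong (trans (sym (*-assoc _ _ _)) (*-congʳ (trans (F-newton (suc m)) (∑⊕-snoc m (λ i j → b (suc i) * F j)))))
                      (-‿cong (trans (∑⊕-cong m (λ i j _ → sym (*-assoc _ _ _))) (∑⊕-*ʳ v m _))) ⟩
          (E + b (2 ℕ.+ m) * F 0) * v - E * v
            ≈⟨ +-congʳ (trans (distribʳ _ _ _) (+-congˡ (*-congʳ (trans (*-congˡ F-0) (*-identityʳ _))))) ⟩
          E * v + b (2 ℕ.+ m) * v - E * v
            ≈⟨ xyx⁻¹≈y (E * v) _ ⟩
          b (2 ℕ.+ m) * v ∎
          where E = ∑⊕ m (λ i j → b (suc i) * F (suc j))

-- Power series

module Series {c ℓ : Level} (K : CommutativeRing c ℓ) where
  open CommutativeRing K hiding (zero)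
  open import Relation.Binary.Reasoning.Setoid setoid
  open import Algebra.Properties.Ring ring using (-‿distribˡ-*; -1*x≈-x)
  open Sums commutativeSemiring
  open OverRing K

  -- Each product P splits into two neighbouring terms on an antidiagonal of Z, so the signed sum
  -- telescopes. Newton's identity for elementary functions and E(t) F(-t) = 1 are both of this
  -- shape, the latter with hook coefficients as Z.
  alternating : ∀ n (P Z : ℕ → ℕ → Carrier) → (∀ i → P i 0 ≈ Z i 0) → (∀ i j → P i (suc j) ≈ Z i (suc j) + Z (suc i) j) →
                ∑⊕ n (λ i j → sgnK K i * P i j) ≈ Z 0 n
  alternating zero    P Z e₀ e₁ = trans (*-identityˡ _) (e₀ 0)
  alternating (suc n) P Z e₀ e₁ = begin
    1# * P 0 (suc n) + ∑⊕ n (λ i j → - sgnK K i * P (suc i) j)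
      ≈⟨ +-cong (trans (*-identityˡ _) (e₁ 0 n))
           (trans (∑⊕-cong n (λ i j _ → trans (sym (-‿distribˡ-* _ _)) (sym (-1*x≈-x _)))) (∑⊕-*ˡ (- 1#) n _)) ⟩
    Z 0 (suc n) + Z 1 n + - 1# * ∑⊕ n (λ i j → sgnK K i * P (suc i) j)
      ≈⟨ +-congˡ (trans (*-congˡ (alternating n (P ∘ suc) (Z ∘ suc) (e₀ ∘ suc) (e₁ ∘ suc))) (-1*x≈-x _)) ⟩
    Z 0 (suc n) + Z 1 n - Z 1 n
      ≈⟨ x+y-y≈x _ _ ⟩
    Z 0 (suc n) ∎

  telescope : ∀ N (x : ℕ → Carrier) → ∑ (upTo N) (λ k → sgnK K k * (x k + x (suc k))) + sgnK K N * x N ≈ x 0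
  telescope zero    x = trans (+-identityˡ _) (*-identityˡ _)
  telescope (suc N) x = begin
    ∑ (upTo (suc N)) (λ k → sgnK K k * (x k + x (suc k))) + - sgnK K N * x (suc N)
      ≈⟨ +-cong (∑-upTo-snoc N _) (sym (-‿distribˡ-* _ _)) ⟩
    S + sgnK K N * (x N + x (suc N)) - sgnK K N * x (suc N)
      ≈⟨ trans (+-assoc _ _ _) (+-congˡ (trans (+-congʳ (distribˡ _ _ _)) (trans (+-assoc _ _ _) (trans (+-congˡ (-‿inverseʳ _)) (+-identityʳ _))))) ⟩
    S + sgnK K N * x N
      ≈⟨ telescope N x ⟩
    x 0 ∎
    where S = ∑ (upTo N) (λ k → sgnK K k * (x k + x (suc k)))

  _⊛_ : Series K → Series K → Series K
  (f ⊛ g) n = ∑⊕ n (λ i j → f i * g j)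

  ⋆≈⊛ : ∀ (f g : Series K) n → _⋆_ K f g n ≈ (f ⊛ g) n
  ⋆≈⊛ f g n = ∑-upTo-⊕ n (λ i j → f i * g j)

  ⊛-cong : ∀ {f f′ g g′ : Series K} n → (∀ i → i ≤ n → f i ≈ f′ i) → (∀ i → i ≤ n → g i ≈ g′ i) → (f ⊛ g) n ≈ (f′ ⊛ g′) n
  ⊛-cong n ef eg = ∑⊕-cong n (λ i j p → *-cong (ef i (subst (i ≤_) p (ℕ.m≤m+n i j))) (eg j (subst (j ≤_) p (ℕ.m≤n+m j i))))

  ⊛-comm : ∀ f g n → (f ⊛ g) n ≈ (g ⊛ f) n
  ⊛-comm f g n = trans (∑⊕-comm n _) (∑⊕-cong n (λ i j _ → *-comm _ _))

  ⊛-assoc : ∀ f g k n → ((f ⊛ g) ⊛ k) n ≈ (f ⊛ (g ⊛ k)) n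
  ⊛-assoc f g k n = begin
    ∑⊕ n (λ i j → (f ⊛ g) i * k j)
      ≈⟨ ∑⊕-cong n (λ i j _ → sym (∑⊕-*ʳ (k j) i _)) ⟩
    ∑⊕ n (λ i j → ∑⊕ i (λ a b → f a * g b * k j))
      ≈⟨ ∑⊕-assoc n (λ a b j → f a * g b * k j) ⟩
    ∑⊕ n (λ a r → ∑⊕ r (λ b j → f a * g b * k j))
      ≈⟨ ∑⊕-cong n (λ a r _ → trans (∑⊕-cong r (λ b j _ → *-assoc _ _ _)) (∑⊕-*ˡ (f a) r _)) ⟩
    ∑⊕ n (λ a r → f a * (g ⊛ k) r) ∎

  ⊛-identityˡ : ∀ f n → (oneS K ⊛ f) n ≈ f n
  ⊛-identityˡ f zero    = *-identityˡ _
  ⊛-identityˡ f (suc n) = trans (+-cong (*-identityˡ _) (∑⊕-vanish n (λ i j _ → zeroˡ _))) (+-identityʳ _)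

  pow-suc : ∀ f m n → powS K f (suc m) n ≈ (f ⊛ powS K f m) n
  pow-suc f m n = ⋆≈⊛ f (powS K f m) n

  -- The derivation t d/dt; it preserves degrees, so products need no shift of indices.
  θ : Series K → Series K
  θ f n = natK K n * f n

  θ-⊛ : ∀ f g n → θ (f ⊛ g) n ≈ (θ f ⊛ g) n + (f ⊛ θ g) n
  θ-⊛ f g n = trans (sym (∑⊕-*ˡ (natK K n) n _)) (trans (∑⊕-cong n term) (∑⊕-+ n _ _))
    where
    term : ∀ i j → i ℕ.+ j ≡ n → natK K n * (f i * g j) ≈ natK K i * f i * g j + f i * (natK K j * g j)
    term i j ≡.refl = trans (*-congʳ (natK-+ i j)) (trans (distribʳ _ _ _) (+-cong (sym (*-assoc _ _ _)) (*-exchange _ _ _)))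

  θ-one : ∀ n → θ (oneS K) n ≈ 0#
  θ-one zero    = zeroˡ _
  θ-one (suc n) = zeroʳ _

  θ-pow : ∀ f m n → θ (powS K f (suc m)) n ≈ natK K (suc m) * (powS K f m ⊛ θ f) n
  θ-pow f m n = begin
    θ (powS K f (suc m)) n ≈⟨ *-congˡ (pow-suc f m n) ⟩
    θ (f ⊛ powS K f m) n ≈⟨ θ-⊛ f (powS K f m) n ⟩
    (θ f ⊛ powS K f m) n + (f ⊛ θ (powS K f m)) n ≈⟨ +-cong (trans (⊛-comm _ _ n) (sym (*-identityˡ _))) (rest m) ⟩
    1# * (powS K f m ⊛ θ f) n + natK K m * (powS K f m ⊛ θ f) n ≈⟨ distribʳ _ _ _ ⟨
    natK K (suc m) * (powS K f m ⊛ θ f) n ∎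
    where
    rest : ∀ m → (f ⊛ θ (powS K f m)) n ≈ natK K m * (powS K f m ⊛ θ f) n
    rest zero    = trans (∑⊕-vanish n (λ i j _ → trans (*-congˡ (θ-one j)) (zeroʳ _))) (sym (zeroˡ _))
    rest (suc m) = begin
      (f ⊛ θ (powS K f (suc m))) n
        ≈⟨ ∑⊕-cong n (λ i j _ → trans (*-congˡ (θ-pow f m j)) (*-exchange _ _ _)) ⟩
      ∑⊕ n (λ i j → natK K (suc m) * (f i * (powS K f m ⊛ θ f) j))
        ≈⟨ ∑⊕-*ˡ (natK K (suc m)) n _ ⟩
      natK K (suc m) * (f ⊛ (powS K f m ⊛ θ f)) n
        ≈⟨ *-congˡ (trans (sym (⊛-assoc f _ _ n)) (⊛-cong n (λ i _ → sym (pow-suc f m i)) (λ _ _ → refl))) ⟩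
      natK K (suc m) * (powS K f (suc m) ⊛ θ f) n ∎

  module _ {G : Series K} (G-0 : G 0 ≈ 0#) where

    pow-order : ∀ m n → n < m → powS K G m n ≈ 0#
    pow-order (suc m) n (s≤s n≤m) = trans (pow-suc G m n) (∑⊕-vanish n term)
      where
      term : ∀ i j → i ℕ.+ j ≡ n → G i * powS K G m j ≈ 0#
      term zero    j _      = trans (*-congʳ G-0) (zeroˡ _)
      term (suc i) j ≡.refl = trans (*-congˡ (pow-order m j (ℕ.≤-trans (s≤s (ℕ.m≤n+m j i)) n≤m))) (zeroʳ _)

    pow-θ-order : ∀ m n → n ≤ m → (powS K G m ⊛ θ G) n ≈ 0#
    pow-θ-order m n n≤m = ∑⊕-vanish n term
      where
      term : ∀ i j → i ℕ.+ j ≡ n → powS K G m i * θ G j ≈ 0#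
      term i zero    _ = trans (*-congˡ (zeroˡ _)) (zeroʳ _)
      term i (suc j) e = trans (*-congʳ (pow-order m i (ℕ.≤-trans (subst (suc i ≤_) (≡.trans (≡.sym (ℕ.+-suc i j)) e) (s≤s (ℕ.m≤m+n i j))) n≤m))) (zeroˡ _)

  module LogExp (fld : IsField K) (ch0 : CharZero K) where
    open IsField fld

    invS-l : ∀ i → invS K fld ch0 i * natK K (suc i) ≈ 1#
    invS-l i = inv-l (natK K (suc i)) (ch0 i)

    module _ (F : Series K) (F-0 : F 0 ≈ 1#) where
      private
        G = minus1 K fld ch0 F
        X : ℕ → Series K
        X k = powS K G k ⊛ θ G
        b = bCoef K fld ch0 F

      G-0 : G 0 ≈ 0#
      G-0 = refl

      -- The denominators of the logarithm cancel against the exponents produced by `θ-pow`, which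
      -- leaves θ log F = Σ (-1)^k G^k θG. The bound N is free so that one bound serves all
      -- coefficients in a convolution.
      bCoef≈ : ∀ {n N} → n ≤ N → b n ≈ ∑ (upTo N) (λ k → sgnK K k * X k n)
      bCoef≈ {n} {N} n≤N = begin
        natK K n * ∑ (upTo n) (λ k → sgnK K k * invS K fld ch0 k * powS K G (suc k) n)
          ≈⟨ ∑-*ˡ (natK K n) (upTo n) _ ⟨
        ∑ (upTo n) (λ k → natK K n * (sgnK K k * invS K fld ch0 k * powS K G (suc k) n))
          ≈⟨ ∑-cong (upTo n) term ⟩
        ∑ (upTo n) (λ k → sgnK K k * X k n)
          ≈⟨ ∑-upTo-truncate n≤N _ (λ k n≤k → trans (*-congˡ (pow-θ-order G-0 k n n≤k)) (zeroʳ _)) ⟨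
        ∑ (upTo N) (λ k → sgnK K k * X k n) ∎
        where
        term : ∀ k → natK K n * (sgnK K k * invS K fld ch0 k * powS K G (suc k) n) ≈ sgnK K k * X k n
        term k = begin
          natK K n * (sgnK K k * invS K fld ch0 k * powS K G (suc k) n) ≈⟨ *-exchange _ _ _ ⟩
          sgnK K k * invS K fld ch0 k * θ (powS K G (suc k)) n ≈⟨ *-congˡ (θ-pow G k n) ⟩
          sgnK K k * invS K fld ch0 k * (natK K (suc k) * X k n) ≈⟨ *-assoc _ _ _ ⟩
          sgnK K k * (invS K fld ch0 k * (natK K (suc k) * X k n)) ≈⟨ *-congˡ (trans (sym (*-assoc _ _ _)) (trans (*-congʳ (invS-l k)) (*-identityˡ _))) ⟩
          sgnK K k * X k n ∎

      F≈1+G : ∀ n → F n ≈ oneS K n + G n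
      F≈1+G zero    = trans F-0 (sym (+-identityʳ _))
      F≈1+G (suc n) = sym (+-identityˡ _)

      X-step : ∀ k n → (X k ⊛ F) n ≈ X k n + X (suc k) n
      X-step k n = begin
        (X k ⊛ F) n
          ≈⟨ ∑⊕-cong n (λ i j _ → trans (*-congˡ (F≈1+G j)) (distribˡ _ _ _)) ⟩
        ∑⊕ n (λ i j → X k i * oneS K j + X k i * G j)
          ≈⟨ ∑⊕-+ n _ _ ⟩
        (X k ⊛ oneS K) n + (X k ⊛ G) n
          ≈⟨ +-cong (trans (⊛-comm _ _ n) (⊛-identityˡ (X k) n))
               (trans (⊛-comm _ _ n) (trans (sym (⊛-assoc G (powS K G k) (θ G) n)) (⊛-cong n (λ i _ → sym (pow-suc G k i)) (λ _ _ → refl)))) ⟩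
        X k n + X (suc k) n ∎

      -- This is θF = F · θ log F. Multiplying `X k` by F = 1 + G gives `X k` plus `X (suc k)`, and
      -- the alternating sum collapses to `X 0`, which is θG.
      log-newton : ∀ m → natK K (suc m) * F (suc m) ≈ ∑⊕ m (λ i j → b (suc i) * F j)
      log-newton m = sym (begin
        ∑⊕ m (λ i j → b (suc i) * F j)
          ≈⟨ +-identityˡ _ ⟨
        0# + ∑⊕ m (λ i j → b (suc i) * F j)
          ≈⟨ +-congʳ (trans (*-congʳ (zeroˡ _)) (zeroˡ _)) ⟨
        (b ⊛ F) N
          ≈⟨ ∑⊕-cong N (λ i j e → trans (*-congʳ (bCoef≈ (subst (i ≤_) e (ℕ.m≤m+n i j)))) (sym (∑-*ʳ (F j) (upTo N) _))) ⟩
        ∑⊕ N (λ i j → ∑ (upTo N) (λ k → sgnK K k * X k i * F j))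
          ≈⟨ ∑⊕-∑ N (upTo N) (λ k i j → sgnK K k * X k i * F j) ⟩
        ∑ (upTo N) (λ k → ∑⊕ N (λ i j → sgnK K k * X k i * F j))
          ≈⟨ ∑-cong (upTo N) (λ k → trans (∑⊕-cong N (λ i j _ → *-assoc (sgnK K k) (X k i) (F j))) (trans (∑⊕-*ˡ (sgnK K k) N (λ i j → X k i * F j)) (*-congˡ (X-step k N)))) ⟩
        ∑ (upTo N) (λ k → sgnK K k * (X k N + X (suc k) N))
          ≈⟨ +-identityʳ _ ⟨
        ∑ (upTo N) (λ k → sgnK K k * (X k N + X (suc k) N)) + 0#
          -- The remainder of the telescoping sum is zero because G^N θG begins in degree N + 1.
          ≈⟨ +-congˡ (trans (*-congˡ (pow-θ-order G-0 N N ℕ.≤-refl)) (zeroʳ _)) ⟨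
        ∑ (upTo N) (λ k → sgnK K k * (X k N + X (suc k) N)) + sgnK K N * X N N
          ≈⟨ telescope N (λ k → X k N) ⟩
        X 0 N
          ≈⟨ ⊛-identityˡ (θ G) N ⟩
        natK K N * F N ∎)
        where
        N = suc m

    invFact-suc : ∀ m → invFact K fld ch0 (suc m) * natK K (suc m) ≈ invFact K fld ch0 m
    invFact-suc m = begin
      invFact K fld ch0 (suc m) * natK K (suc m) ≈⟨ *-congʳ (trans (reflexive (shift id (suc m))) (snoc m (invS K fld ch0))) ⟩
      (pr (invS K fld ch0) m * invS K fld ch0 m) * natK K (suc m) ≈⟨ trans (*-assoc _ _ _) (trans (*-congˡ (invS-l m)) (*-identityʳ _)) ⟩
      pr (invS K fld ch0) m ≡⟨ shift id m ⟨
      invFact K fld ch0 m ∎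
      where
      pr : (ℕ → Carrier) → ℕ → Carrier
      pr f zero    = 1#
      pr f (suc n) = f 0 * pr (f ∘ suc) n
      shift : ∀ (k : ℕ → ℕ) n → Πl K (applyUpTo k n) (invS K fld ch0) ≡ pr (invS K fld ch0 ∘ k) n
      shift k zero    = ≡.refl
      shift k (suc n) = cong (invS K fld ch0 (k 0) *_) (shift (k ∘ suc) n)
      snoc : ∀ n f → pr f (suc n) ≈ pr f n * f n
      snoc zero    f = *-comm _ _
      snoc (suc n) f = trans (*-congˡ (snoc n (f ∘ suc))) (sym (*-assoc _ _ _))

    module _ {H : Series K} (H-0 : H 0 ≈ 0#) where
      private
        E = expS K fld ch0 H

      -- Termwise θ(H^{m+1})/(m+1)! = (H^m/m!) θH, hence θ exp H = θH · exp H. The coefficients of E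
      -- cut the sum over m at different places; H has no constant term, so all of them may use the
      -- common cut.
      exp-newton : ∀ n → natK K (suc n) * E (suc n) ≈ ∑⊕ n (λ i j → θ H (suc i) * E j)
      exp-newton n = begin
        natK K N * ∑ (upTo (suc N)) (λ m → invFact K fld ch0 m * powS K H m N)
          ≈⟨ ∑-*ˡ (natK K N) (upTo (suc N)) _ ⟨
        ∑ (upTo (suc N)) (λ m → natK K N * (invFact K fld ch0 m * powS K H m N))
          ≈⟨ ∑-cong (upTo (suc N)) (λ m → *-exchange _ _ _) ⟩
        ∑ (upTo (suc N)) (λ m → invFact K fld ch0 m * θ (powS K H m) N)
          ≡⟨ ∑-upTo-suc N (λ m → invFact K fld ch0 m * θ (powS K H m) N) ⟩
        invFact K fld ch0 0 * θ (oneS K) N + ∑ (upTo N) (λ m → invFact K fld ch0 (suc m) * θ (powS K H (suc m)) N)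
          ≈⟨ trans (+-congʳ (trans (*-congˡ (θ-one N)) (zeroʳ _))) (+-identityˡ _) ⟩
        ∑ (upTo N) (λ m → invFact K fld ch0 (suc m) * θ (powS K H (suc m)) N)
          ≈⟨ ∑-cong (upTo N) (λ m → trans (*-congˡ (θ-pow H m N)) (trans (sym (*-assoc _ _ _)) (*-congʳ (invFact-suc m)))) ⟩
        ∑ (upTo N) (λ m → invFact K fld ch0 m * (powS K H m ⊛ θ H) N)
          ≈⟨ ∑-upTo-truncate (ℕ.n≤1+n N) _ (λ m N≤m → trans (*-congˡ (pow-θ-order H-0 m N N≤m)) (zeroʳ _)) ⟨
        ∑ (upTo (suc N)) (λ m → invFact K fld ch0 m * (powS K H m ⊛ θ H) N)
          ≈⟨ ∑-cong (upTo (suc N)) (λ m → trans (sym (∑⊕-*ˡ (invFact K fld ch0 m) N (λ i j → powS K H m i * θ H j))) (∑⊕-cong N (λ i j _ → sym (*-assoc (invFact K fld ch0 m) (powS K H m i) (θ H j))))) ⟩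
        ∑ (upTo (suc N)) (λ m → ∑⊕ N (λ i j → invFact K fld ch0 m * powS K H m i * θ H j))
          ≈⟨ ∑⊕-∑ N (upTo (suc N)) (λ m i j → invFact K fld ch0 m * powS K H m i * θ H j) ⟨
        ∑⊕ N (λ i j → ∑ (upTo (suc N)) (λ m → invFact K fld ch0 m * powS K H m i * θ H j))
          ≈⟨ ∑⊕-cong N (λ i j e → trans (∑-*ʳ (θ H j) (upTo (suc N)) (λ m → invFact K fld ch0 m * powS K H m i))
               (*-congʳ (∑-upTo-truncate (s≤s (subst (i ≤_) e (ℕ.m≤m+n i j))) (λ m → invFact K fld ch0 m * powS K H m i)
                 (λ m i<m → trans (*-congˡ (pow-order {H} H-0 m i i<m)) (zeroʳ _))))) ⟩
        (E ⊛ θ H) N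
          ≈⟨ ⊛-comm E (θ H) N ⟩
        θ H 0 * E N + ∑⊕ n (λ i j → θ H (suc i) * E j)
          ≈⟨ trans (+-congʳ (trans (*-congʳ (zeroˡ _)) (zeroˡ _))) (+-identityˡ _) ⟩
        ∑⊕ n (λ i j → θ H (suc i) * E j) ∎
        where
        N = suc n

-- Existence of h-expansions, and the coefficients in (c) and (d)

module HExpansions {c ℓ : Level} (K : CommutativeRing c ℓ) (fld : IsField K) (ch0 : CharZero K) (F : Series K)
                   (F-0 : CommutativeRing._≈_ K (F 0) (CommutativeRing.1# K)) where
  open CommutativeRing K hiding (zero)
  open import Relation.Binary.Reasoning.Setoid setoid
  open import Algebra.Properties.Ring ring using (-‿distribˡ-*; -‿distribʳ-*; -‿involutive; -0#≈0#)
  open Sums commutativeSemiring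
  open OverRing K
  open Series K
  open LogExp fld ch0
  open HPolynomials K F F-0

  b : ℕ → Carrier
  b = bCoef K fld ch0 F

  open PowerSums b (log-newton F F-0)

  aug : List ℕ → List ℕ → Carrier
  aug λ' μ = natK K (augmented λ' μ)

  -- The product rule `lowered-augmented` is solved for its new augmented function. The value w of
  -- the bumped terms is left open: `HPoly-augmented` asks only for its existence, `HPoly-pair` for
  -- its exact form.
  HPoly-augmented-∷ : ∀ m λ' {n v w} → All (0 <_) λ' → HPoly n (aug λ') v →
    HPoly (suc m ℕ.+ n) (λ μ → ∑ (bumps (suc m) λ') (λ κ → aug κ μ)) w →
    HPoly (suc m ℕ.+ n) (aug (suc m ∷ λ')) (b (suc m) * v - w)
  HPoly-augmented-∷ m λ' pos p q = HPoly-cong ≡.refl ev refl (HPoly-minus (HPoly-lowered m p) q)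
    where
    ev : ∀ μ → ∑ (lowered (suc m) μ) (aug λ') - ∑ (bumps (suc m) λ') (λ κ → aug κ μ) ≈ aug (suc m ∷ λ') μ
    ev μ = begin
      ∑ (lowered (suc m) μ) (aug λ') - B
        ≈⟨ +-congʳ (natK-∑ (lowered (suc m) μ) (augmented λ')) ⟨
      natK K (Counts.∑ (lowered (suc m) μ) (augmented λ')) - B
        ≡⟨ cong (λ z → natK K z - B) (lowered-augmented (suc m) λ' μ pos) ⟩
      natK K (augmented (suc m ∷ λ') μ ℕ.+ Counts.∑ (bumps (suc m) λ') (λ κ → augmented κ μ)) - B
        ≈⟨ +-congʳ (trans (natK-+ (augmented (suc m ∷ λ') μ) _) (+-congˡ (natK-∑ (bumps (suc m) λ') (λ κ → augmented κ μ)))) ⟩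
      aug (suc m ∷ λ') μ + B - B
        ≈⟨ x+y-y≈x _ _ ⟩
      aug (suc m ∷ λ') μ ∎
      where B = ∑ (bumps (suc m) λ') (λ κ → aug κ μ)

  HPoly-∑∃ : ∀ {a} {A : Set a} {L : List A} {n} {g : A → List ℕ → Carrier} →
             All (λ x → ∃ (HPoly n (g x))) L → ∃ (HPoly n (λ μ → ∑ L (λ x → g x μ)))
  HPoly-∑∃ []             = _ , HPoly-0
  HPoly-∑∃ ((_ , p) ∷ ps) = _ , HPoly-+ p (proj₂ (HPoly-∑∃ ps))

  record Bump (i : ℕ) (λ' κ : List ℕ) : Set where
    constructor bump
    field
      same-length : length κ ≡ length λ'
      positive    : All (0 <_) κ
      size        : sumℕ κ ≡ i ℕ.+ sumℕ λ'

  bumps-Bump : ∀ i λ' → All (0 <_) λ' → All (Bump i λ') (bumps i λ')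
  bumps-Bump i []       []         = []
  bumps-Bump i (l ∷ λ') (0<l ∷ ps) =
    bump ≡.refl (ℕ.≤-trans 0<l (ℕ.m≤m+n l i) ∷ ps) (≡.trans (cong (ℕ._+ sumℕ λ') (ℕ.+-comm l i)) (ℕ.+-assoc i l _))
    ∷ All.map⁺ (All.map (λ (bump e p s) → bump (cong suc e) (0<l ∷ p) (≡.trans (cong (l ℕ.+_) s) (move l i _))) (bumps-Bump i λ' ps))
    where
    move : ∀ l i s → l ℕ.+ (i ℕ.+ s) ≡ i ℕ.+ (l ℕ.+ s)
    move l i s = ≡.trans (≡.sym (ℕ.+-assoc l i s)) (≡.trans (cong (ℕ._+ s) (ℕ.+-comm l i)) (ℕ.+-assoc i l s))

  -- Bumping changes the parts of the tail but keeps their number, so the induction runs on the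
  -- length and not on the list.
  HPoly-augmented : ∀ N λ' → length λ' ≡ N → All (0 <_) λ' → ∃ (HPoly (sumℕ λ') (aug λ'))
  HPoly-augmented N       []           e      []       = 1# , HPoly-1
  HPoly-augmented (suc N) (suc m ∷ λ') ≡.refl (_ ∷ ps) = _ , HPoly-augmented-∷ m λ' ps
    (proj₂ (HPoly-augmented N λ' ≡.refl ps))
    (proj₂ (HPoly-∑∃ (All.map (λ {κ} (bump e p s) → _ , HPoly-cong s (λ _ → refl) refl (proj₂ (HPoly-augmented N κ e p))) (bumps-Bump (suc m) λ' ps))))

  -- The value at 0 is a dummy; the arguments of interest are the positive diagonal entries of
  -- `augmented`.
  invℕ : ℕ → Carrier
  invℕ zero    = 0#
  invℕ (suc n) = invS K fld ch0 n

  invℕ-l : ∀ n → 1 ≤ n → invℕ n * natK K n ≈ 1#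
  invℕ-l (suc n) _ = invS-l n

  aug-off-diagonal : ∀ n {μ λ'} → μ ∈ Partitions n → λ' ∈ Partitions n → λ' ≢ μ → aug λ' μ ≈ 0#
  aug-off-diagonal n μ∈ λ∈ ne =
    reflexive (cong (natK K) (augmented-off-diagonal (∈-partition n λ∈) (∈-partition n μ∈) ne))

  h-expansion : ∀ n (f : Sym K) → ∃ λ ch → IsExpansion K n (hF K) f ch
  h-expansion n f = HPoly-expansion (proj₂ (HPoly-∑∃ {g = λ λ' μ → f λ' * (invℕ (augmented λ' λ') * aug λ' μ)}
      (All.map (λ {λ'} (isPartition _ p s) →
        _ , HPoly-* (f λ') (HPoly-* (invℕ (augmented λ' λ')) (HPoly-cong s (λ _ → refl) refl (proj₂ (HPoly-augmented (length λ') λ' ≡.refl p)))))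
      (pars-sound n n n)))) at
    where
    at : ∀ {μ} → μ ∈ Partitions n → ∑ (Partitions n) (λ λ' → f λ' * (invℕ (augmented λ' λ') * aug λ' μ)) ≈ f μ
    at {μ} μ∈ = begin
      ∑ (Partitions n) (λ λ' → f λ' * (invℕ (augmented λ' λ') * aug λ' μ))
        ≈⟨ ∑-pick _ (Partitions-unique n) μ∈ (λ λ∈ ne → trans (*-congˡ (trans (*-congˡ (aug-off-diagonal n μ∈ λ∈ ne)) (zeroʳ _))) (zeroʳ _)) ⟩
      f μ * (invℕ (augmented μ μ) * aug μ μ)
        ≈⟨ *-congˡ (invℕ-l (augmented μ μ) (augmented-diagonal μ (positive (∈-partition n μ∈)))) ⟩
      f μ * 1#
        ≈⟨ *-identityʳ _ ⟩
      f μ ∎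

  h-coefficient : ∀ {n λ₀ g v} → HPoly n g v → λ₀ ∈ Partitions n → g λ₀ ≈ 1# →
                  (∀ {μ} → μ ∈ Partitions n → μ ≢ λ₀ → g μ ≈ 0#) → CoeffIs K n (hF K) (Rsym K F n) λ₀ v
  h-coefficient {n} p λ₀∈ g1 g0 = h-expansion n (Rsym K F n) , λ cf ex → HPoly-coefficient ex p λ₀∈ g1 g0

  elem : ℕ → ℕ → List ℕ → Carrier
  elem k n μ = natK K (elementaryAt k μ n)

  -- In the variables x₁ᵏ, x₂ᵏ, ... the power sums are p_k, p_{2k}, .... The product of e_j with one
  -- of them is split according to whether its variable is new, `Z i j`, or already occurs, which
  -- raises an exponent and yields `Z (suc i)` with one factor fewer.
  elem-newton : ∀ k n μ → 1 ≤ k → natK K (suc n) * elem k (suc n) μ ≈ ∑⊕ n (λ i j → sgnK K i * ∑ (lowered (k ℕ.* suc i) μ) (elem k j))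
  elem-newton k n μ 1≤k = sym (begin
    ∑⊕ n (λ i j → sgnK K i * ∑ (lowered (k ℕ.* suc i) μ) (elem k j))
      ≈⟨ ∑⊕-cong n (λ i j _ → *-congˡ (sym (natK-∑ (lowered (k ℕ.* suc i) μ) (λ ν → elementaryAt k ν j)))) ⟩
    ∑⊕ n (λ i j → sgnK K i * natK K (P i j))
      ≈⟨ alternating n (λ i j → natK K (P i j)) (λ i j → natK K (Z i j)) (λ i → reflexive (cong (natK K) (P-0 i)))
           (λ i j → trans (reflexive (cong (natK K) (P-suc i j))) (natK-+ (Z i (suc j)) (Z (suc i) j))) ⟩
    natK K (Z 0 n)
      ≡⟨ cong (natK K) (≡.trans (cong (λ l → Counts.∑ (cleared l μ) (λ ν → elementaryAt k ν n)) (ℕ.*-identityʳ k)) (cleared-elementary k n μ 1≤k)) ⟩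
    natK K (suc n ℕ.* elementaryAt k μ (suc n))
      ≈⟨ natK-* (suc n) (elementaryAt k μ (suc n)) ⟩
    natK K (suc n) * elem k (suc n) μ ∎)
    where
    P Z : ℕ → ℕ → ℕ
    P i j = Counts.∑ (lowered (k ℕ.* suc i) μ) (λ ν → elementaryAt k ν j)
    Z i j = Counts.∑ (cleared (k ℕ.* suc i) μ) (λ ν → elementaryAt k ν j)
    P-0 : ∀ i → P i 0 ≡ Z i 0
    P-0 i = ≡.trans (lowered-split (k ℕ.* suc i) μ _) (≡.trans (cong (Z i 0 ℕ.+_) (shrunk-elementary-0 k (k ℕ.* suc i) μ)) (ℕ.+-identityʳ _))
    P-suc : ∀ i j → P i (suc j) ≡ Z i (suc j) ℕ.+ Z (suc i) j
    P-suc i j = ≡.trans (lowered-split (k ℕ.* suc i) μ _) (cong (Z i (suc j) ℕ.+_) (≡.trans (shrunk-elementary k (k ℕ.* suc i) j μ 1≤k)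
      (cong (λ l → Counts.∑ (cleared l μ) (λ ν → elementaryAt k ν j)) (≡.sym (ℕ.*-suc k (suc i))))))

  module _ (k : ℕ) where
    private
      H = Hk K fld ch0 F (suc k)
      E = expS K fld ch0 H

    θ-Hk : ∀ i → θ H (suc i) ≈ sgnK K i * b (suc k ℕ.* suc i)
    θ-Hk i = begin
      natK K (suc i) * - (β * - sgnK K i * invS K fld ch0 i)
        ≈⟨ *-congˡ (trans (-‿cong (trans (*-congʳ (sym (-‿distribʳ-* _ _))) (sym (-‿distribˡ-* _ _)))) (-‿involutive _)) ⟩
      natK K (suc i) * (β * sgnK K i * invS K fld ch0 i)
        ≈⟨ trans (*-exchange _ _ _) (*-congˡ (trans (*-comm _ _) (invS-l i))) ⟩
      β * sgnK K i * 1#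
        ≈⟨ trans (*-identityʳ _) (*-comm _ _) ⟩
      sgnK K i * β ∎
      where β = b (suc k ℕ.* suc i)

    HPoly-elem : ∀ n → HPoly (suc k ℕ.* n) (elem (suc k) n) (E n)
    HPoly-elem n = below (suc n) n ℕ.≤-refl
      where
      base : ∀ μ → hCoeff [] μ ≡ elementaryAt (suc k) μ 0
      base []          = ≡.refl
      base (zero ∷ μ)  = base μ
      base (suc x ∷ μ) = ≡.refl
      below : ∀ N n → n < N → HPoly (suc k ℕ.* n) (elem (suc k) n) (E n)
      below (suc N) zero    _         = HPoly-cong (≡.sym (ℕ.*-zeroʳ k)) (λ μ → reflexive (cong (natK K) (base μ)))
                                          (sym (trans (+-identityʳ _) (*-identityˡ _))) HPoly-1
      below (suc N) (suc n) (s≤s n<N) = HPoly-cong ≡.refl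
        (λ μ → trans (*-congˡ (sym (elem-newton (suc k) n μ (s≤s z≤n)))) (cancel _))
        (trans (*-congˡ (trans (∑⊕-cong n (λ i j _ → trans (sym (*-assoc _ _ _)) (*-congʳ (sym (θ-Hk i))))) (sym (exp-newton {H} refl n)))) (cancel _))
        (HPoly-* (invS K fld ch0 n) (HPoly-∑⊕ n (λ i j e → HPoly-* (sgnK K i)
          -- `HPoly-lowered` takes the predecessor of the index of the power sum: `suc k * suc i` is
          -- the successor of `i + k * suc i`.
          (HPoly-cong (degrees i j e) (λ _ → refl) refl (HPoly-lowered (i ℕ.+ k ℕ.* suc i) (below N j (ℕ.≤-<-trans (subst (j ≤_) e (ℕ.m≤n+m j i)) n<N)))))))
        where
        cancel : ∀ x → invS K fld ch0 n * (natK K (suc n) * x) ≈ x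
        cancel x = trans (sym (*-assoc _ _ _)) (trans (*-congʳ (invS-l n)) (*-identityˡ _))
        degrees : ∀ i j → i ℕ.+ j ≡ n → suc k ℕ.* suc i ℕ.+ suc k ℕ.* j ≡ suc k ℕ.* suc n
        degrees i j ≡.refl = ≡.sym (ℕ.*-distribˡ-+ (suc k) (suc i) j)

  rectangle-∈ : ∀ n k → replicate n (suc k) ∈ Partitions (suc k ℕ.* n)
  rectangle-∈ n k = subst (λ s → replicate n (suc k) ∈ Partitions s) (≡.trans (sum n) (ℕ.*-comm n (suc k))) (partition-∈ (decr n) (All.replicate⁺ n (s≤s z≤n)))
    where
    decr : ∀ n → Dec (suc k) (replicate n (suc k))
    decr zero    = []
    decr (suc n) = ℕ.≤-refl ∷ decr n
    sum : ∀ n → sumℕ (replicate n (suc k)) ≡ n ℕ.* suc k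
    sum zero    = ≡.refl
    sum (suc n) = cong (suc k ℕ.+_) (sum n)

  HPoly-single : ∀ m → HPoly (suc m) (aug (suc m ∷ [])) (b (suc m))
  HPoly-single m = HPoly-cong (ℕ.+-identityʳ _) (λ _ → refl)
    (trans (+-cong (*-identityʳ _) -0#≈0#) (+-identityʳ _)) (HPoly-augmented-∷ m [] [] HPoly-1 HPoly-0)

  augmented-single : ∀ p → augmented (p ∷ []) (p ∷ []) ≡ 1
  augmented-single p rewrite ≡ᵇ-refl p = ≡.refl

  partC : PartC K fld ch0 F
  partC = rectangles , singles
    where
    rectangles : ∀ k → 1 ≤ k → ∀ n → CoeffIs K (k ℕ.* n) (hF K) (Rsym K F (k ℕ.* n)) (replicate n k) (expS K fld ch0 (Hk K fld ch0 F k) n)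
    rectangles (suc k) 1≤k n = h-coefficient (HPoly-elem k n) (rectangle-∈ n k)
      (trans (reflexive (cong (natK K) (elementary-diagonal (suc k) n 1≤k))) natK-1)
      (λ {μ} μ∈ ne → reflexive (cong (natK K) (elementary-off-diagonal (suc k) n μ (positive (∈-partition (suc k ℕ.* n) μ∈)) (λ e → ne (≡.sym e)))))
    singles : ∀ n → 1 ≤ n → CoeffIs K n (hF K) (Rsym K F n) (n ∷ []) (b n)
    singles (suc m) _ = h-coefficient (HPoly-single m) (row-∈ (suc m)) (trans (reflexive (cong (natK K) (augmented-single (suc m)))) natK-1)
      (λ μ∈ ne → aug-off-diagonal (suc m) μ∈ (row-∈ (suc m)) (λ e → ne (≡.sym e)))

  HPoly-pair : ∀ p q → HPoly (suc p ℕ.+ suc q) (aug (suc p ∷ suc q ∷ [])) (b (suc p) * b (suc q) - b (suc p ℕ.+ suc q))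
  HPoly-pair p q = HPoly-augmented-∷ p (suc q ∷ []) (s≤s z≤n ∷ []) (HPoly-single q)
    (HPoly-cong (ℕ.+-comm (suc q) (suc p)) (λ _ → sym (+-identityʳ _)) (reflexive (cong b (ℕ.+-comm (suc q) (suc p)))) (HPoly-single (q ℕ.+ suc p)))

  pair-∈ : ∀ p q → q ≤ p → suc p ∷ suc q ∷ [] ∈ Partitions (suc p ℕ.+ suc q)
  pair-∈ p q q≤p = subst (λ s → suc p ∷ suc q ∷ [] ∈ Partitions (suc p ℕ.+ s)) (ℕ.+-identityʳ (suc q))
    (partition-∈ (ℕ.≤-refl ∷ s≤s q≤p ∷ []) (s≤s z≤n ∷ s≤s z≤n ∷ []))

  augmented-pair-≢ : ∀ p q → p ≢ q → augmented (suc p ∷ suc q ∷ []) (suc p ∷ suc q ∷ []) ≡ 1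
  augmented-pair-≢ p q ne rewrite ≡ᵇ-refl p | ≢⇒≡ᵇ {q} {p} (λ e → ne (≡.sym e)) | ≡ᵇ-refl q = ≡.refl

  -- Two equal exponents can be assigned to two variables in two ways; this is the origin of the
  -- factor 1/2 in (d).
  augmented-pair-≡ : ∀ p → augmented (suc p ∷ suc p ∷ []) (suc p ∷ suc p ∷ []) ≡ 2
  augmented-pair-≡ p rewrite ≡ᵇ-refl p | ≡ᵇ-refl p = ≡.refl

  partD : PartD K fld ch0 F
  partD (suc i) (suc j) _ _ = distinct , equal
    where
    ordered : ∀ p q → q ≤ p → p ≢ q →
              CoeffIs K (suc p ℕ.+ suc q) (hF K) (Rsym K F (suc p ℕ.+ suc q)) (suc p ∷ suc q ∷ []) (b (suc p) * b (suc q) - b (suc p ℕ.+ suc q))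
    ordered p q q≤p ne = h-coefficient (HPoly-pair p q) (pair-∈ p q q≤p) (trans (reflexive (cong (natK K) (augmented-pair-≢ p q ne))) natK-1)
      (λ μ∈ ne′ → aug-off-diagonal (suc p ℕ.+ suc q) μ∈ (pair-∈ p q q≤p) (λ e → ne′ (≡.sym e)))
    CoeffIs-≈ : ∀ n {λ₀ v v′} → v ≈ v′ → CoeffIs K n (hF K) (Rsym K F n) λ₀ v → CoeffIs K n (hF K) (Rsym K F n) λ₀ v′
    CoeffIs-≈ n e (ex , co) = ex , λ cf p → trans (co cf p) e
    Goal : ℕ → List ℕ → Carrier → Set _
    Goal n = CoeffIs K n (hF K) (Rsym K F n)
    distinct : suc i ≢ suc j → Goal (suc i ℕ.+ suc j) (suc (i ⊔ j) ∷ suc (i ⊓ j) ∷ []) (b (suc i) * b (suc j) - b (suc i ℕ.+ suc j))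
    distinct ne with ℕ.≤-total j i
    ... | inj₁ j≤i rewrite ℕ.m≥n⇒m⊔n≡m j≤i | ℕ.m≥n⇒m⊓n≡n j≤i = ordered i j j≤i (λ e → ne (cong suc e))
    ... | inj₂ i≤j rewrite ℕ.m≤n⇒m⊔n≡n i≤j | ℕ.m≤n⇒m⊓n≡m i≤j =
      subst (λ n → Goal n (suc j ∷ suc i ∷ []) (b (suc i) * b (suc j) - b n)) (ℕ.+-comm (suc j) (suc i))
        (CoeffIs-≈ (suc j ℕ.+ suc i) (+-congʳ (*-comm _ _)) (ordered j i i≤j (λ e → ne (cong suc (≡.sym e)))))
    equal : suc i ≡ suc j → Goal (suc i ℕ.+ suc j) (suc i ∷ suc i ∷ []) (invS K fld ch0 1 * (b (suc i) * b (suc i) - b (suc i ℕ.+ suc j)))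
    equal ≡.refl = h-coefficient (HPoly-* (invS K fld ch0 1) (HPoly-pair i i)) (pair-∈ i i ℕ.≤-refl)
      (trans (*-congˡ (reflexive (cong (natK K) (augmented-pair-≡ i)))) (invS-l 1))
      (λ μ∈ ne → trans (*-congˡ (aug-off-diagonal (suc i ℕ.+ suc i) μ∈ (pair-∈ i i ℕ.≤-refl) (λ e → ne (≡.sym e)))) (zeroʳ _))

-- Schur expansions

module SchurExpansions {c ℓ : Level} (K : CommutativeRing c ℓ) where
  open CommutativeRing K hiding (zero)
  open import Relation.Binary.Reasoning.Setoid setoid
  open import Algebra.Properties.Ring ring using (-‿distribʳ-*)
  open Sums commutativeSemiring
  open StripSums commutativeSemiring
  open OverRing K

  x-y+y≈x : ∀ x y → x - y + y ≈ x
  x-y+y≈x x y = trans (+-assoc _ _ _) (trans (+-congˡ (-‿inverseˡ _)) (+-identityʳ _))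

  -- Since A x μ vanishes for every μ after x, the coefficient of x does not disturb the equations
  -- already solved on the tail, and it is free to absorb the defect at x.
  solve-unitriangular : (A : List ℕ → List ℕ → Carrier) (L : List (List ℕ)) →
    AllPairs (λ x y → x ≢ y × A x y ≈ 0#) L → All (λ x → A x x ≈ 1#) L →
    ∀ (f : List ℕ → Carrier) → ∃ λ (cf : List ℕ → Carrier) → ∀ {μ} → μ ∈ L → f μ ≈ ∑ L (λ λ' → cf λ' * A λ' μ)
  solve-unitriangular A []       []       []       f = (λ _ → 0#) , λ ()
  solve-unitriangular A (x ∷ xs) (q ∷ qs) (d ∷ ds) f with solve-unitriangular A xs qs ds f
  ... | cf , ex = cf′ , ex′
    where
    cf′ : List ℕ → Carrier
    cf′ λ' = if does (λ' ≟ᴸ x) then f x - ∑ xs (λ λ' → cf λ' * A λ' x) else cf λ'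
    cf′-x : cf′ x ≡ f x - ∑ xs (λ λ' → cf λ' * A λ' x)
    cf′-x = cong (λ b → if b then f x - ∑ xs (λ λ' → cf λ' * A λ' x) else cf x) (dec-true (x ≟ᴸ x) ≡.refl)
    tail : ∀ μ → ∑ xs (λ λ' → cf′ λ' * A λ' μ) ≈ ∑ xs (λ λ' → cf λ' * A λ' μ)
    tail μ = ∑-congAll (All.map (λ {λ'} (ne , _) → *-congʳ (reflexive
      (cong (λ b → if b then f x - ∑ xs (λ κ → cf κ * A κ x) else cf λ') (dec-false (λ' ≟ᴸ x) (λ e → ne (≡.sym e)))))) q)
    ex′ : ∀ {μ} → μ ∈ x ∷ xs → f μ ≈ ∑ (x ∷ xs) (λ λ' → cf′ λ' * A λ' μ)
    ex′ (here ≡.refl) = sym (trans (+-cong (trans (*-cong (reflexive cf′-x) d) (*-identityʳ _)) (tail x)) (x-y+y≈x _ _))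
    ex′ {μ} (there μ∈) = sym (trans (+-cong (trans (*-congˡ (proj₂ (All.lookup q μ∈))) (zeroʳ _)) (tail μ)) (trans (+-identityˡ _) (sym (ex μ∈))))

  schur≈Kr : ∀ n {λ'} μ → λ' ∈ Partitions n → schurF K λ' μ ≈ natK K (Kr μ λ')
  schur≈Kr n μ λ∈ = reflexive (cong (natK K) (kostka≡Kr (dec (∈-partition n λ∈)) μ))

  schur-expansion : ∀ n (f : Sym K) → ∃ λ cs → IsExpansion K n (schurF K) f cs
  schur-expansion n f with solve-unitriangular (λ λ' μ → natK K (Kr μ λ')) (Partitions n)
      (AllPairs.map (λ (ne , z) → ne , reflexive (cong (natK K) z)) (pars-unitriangular n n n))
      (All.map (λ p → trans (reflexive (cong (natK K) (Kr-diagonal (dec p)))) natK-1) (pars-sound n n n)) f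
  ... | cs , ex = cs , λ μ μ∈ → trans (ex μ∈) (∑-cong∈ (Partitions n) (λ λ∈ → *-congˡ (sym (schur≈Kr n μ λ∈))))

  -- hookPart a k f = [s_{(a,1^k)}] f: pairing f with h_α reads off [m_α] f, and the recursion is
  -- s_{(a,1^{k+1})} = h_a e_{k+1} − s_{(a+1,1^k)} with e_{k+1} = s_{(1,1^k)}.
  hookPart : ℕ → ℕ → (List ℕ → Carrier) → Carrier
  hookPart a zero    f = f (a ∷ [])
  hookPart a (suc k) f = hookPart 1 k (f ∘ (a ∷_)) - hookPart (suc a) k f

  hookPart-cong : ∀ a k {f g} → 1 ≤ a → (∀ α → All (0 <_) α → sumℕ α ≡ a ℕ.+ k → f α ≈ g α) → hookPart a k f ≈ hookPart a k g
  hookPart-cong a zero    1≤a e = e (a ∷ []) (1≤a ∷ []) ≡.refl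
  hookPart-cong a (suc k) 1≤a e = +-cong
    (hookPart-cong 1 k ℕ.≤-refl (λ α p s → e (a ∷ α) (1≤a ∷ p) (cong (a ℕ.+_) s)))
    (-‿cong (hookPart-cong (suc a) k (s≤s z≤n) (λ α p s → e α p (≡.trans s (≡.sym (ℕ.+-suc a k))))))

  hookPart-∑ : ∀ {b} {B : Set b} a k (L : List B) (u : B → Carrier) (f : B → List ℕ → Carrier) →
               hookPart a k (λ α → ∑ L (λ x → u x * f x α)) ≈ ∑ L (λ x → u x * hookPart a k (f x))
  hookPart-∑ a zero    L u f = refl
  hookPart-∑ a (suc k) L u f = begin
    hookPart 1 k (λ α → ∑ L (λ x → u x * f x (a ∷ α))) - hookPart (suc a) k (λ α → ∑ L (λ x → u x * f x α))
      ≈⟨ +-cong (hookPart-∑ 1 k L u (λ x → f x ∘ (a ∷_))) (-‿cong (hookPart-∑ (suc a) k L u f)) ⟩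
    ∑ L (λ x → u x * hookPart 1 k (f x ∘ (a ∷_))) - ∑ L (λ x → u x * hookPart (suc a) k (f x))
      ≈⟨ +-congˡ (-‿∑ L _) ⟩
    ∑ L (λ x → u x * hookPart 1 k (f x ∘ (a ∷_))) + ∑ L (λ x → - (u x * hookPart (suc a) k (f x)))
      ≈⟨ ∑-+ L _ _ ⟨
    ∑ L (λ x → u x * hookPart 1 k (f x ∘ (a ∷_)) - u x * hookPart (suc a) k (f x))
      ≈⟨ ∑-cong L (λ x → trans (+-congˡ (-‿distribʳ-* _ _)) (sym (distribˡ _ _ _))) ⟩
    ∑ L (λ x → u x * hookPart a (suc k) (f x)) ∎

  hookPart-* : ∀ a k u f → hookPart a k (λ α → u * f α) ≈ u * hookPart a k f
  hookPart-* a zero    u f = refl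
  hookPart-* a (suc k) u f = trans (+-cong (hookPart-* 1 k u (f ∘ (a ∷_))) (-‿cong (hookPart-* (suc a) k u f)))
    (trans (+-congˡ (-‿distribʳ-* _ _)) (sym (distribˡ _ _ _)))

  indicator : Bool → Carrier
  indicator b = b ▹ 1#

  natK-indicator : ∀ b → natK K (Counts._▹_ b 1) ≈ indicator b
  natK-indicator b = trans (natK-▹ b 1) (▹-cong b (λ _ → natK-1))

  -- Prepending a to the content removes a horizontal strip of size a. The inductive hypothesis
  -- makes the rest a column, `pieri` then leaves two hooks, and the recursion of `hookPart`
  -- subtracts the unwanted one.
  hookPart-Kr : ∀ a k {m} λ' → 1 ≤ a → Dec m λ' → hookPart a k (λ α → natK K (Kr α λ')) ≈ indicator (isHook a k λ')
  hookPart-Kr a zero    λ' 1≤a d = trans (reflexive (cong (natK K) (Kr-row a λ' 1≤a d))) (natK-indicator (isHook a 0 λ'))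
  hookPart-Kr a (suc k) λ' 1≤a d = begin
    hookPart 1 k (λ α → natK K (Kr (a ∷ α) λ')) - hookPart (suc a) k (λ α → natK K (Kr α λ'))
      ≈⟨ +-cong removed (-‿cong (hookPart-Kr (suc a) k λ' (s≤s z≤n) d)) ⟩
    indicator (isHook a (suc k) λ') + indicator (isHook (suc a) k λ') - indicator (isHook (suc a) k λ')
      ≈⟨ x+y-y≈x _ _ ⟩
    indicator (isHook a (suc k) λ') ∎
    where
    removed : hookPart 1 k (λ α → natK K (Kr (a ∷ α) λ')) ≈ indicator (isHook a (suc k) λ') + indicator (isHook (suc a) k λ')
    removed = begin
      hookPart 1 k (λ α → natK K (Kr (a ∷ α) λ'))
        ≈⟨ hookPart-cong 1 k ℕ.≤-refl (λ α _ _ → trans (natK-∑ (strips λ') _) (∑-cong (strips λ') (λ p →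
             trans (natK-▹ (proj₁ p ≡ᵇ a) (Kr α (proj₂ p))) (trans (▹-cong (proj₁ p ≡ᵇ a) (λ _ → sym (*-identityˡ _))) (▹-* (proj₁ p ≡ᵇ a) 1# _))))) ⟩
      hookPart 1 k (λ α → ∑ (strips λ') (λ p → indicator (proj₁ p ≡ᵇ a) * natK K (Kr α (proj₂ p))))
        ≈⟨ hookPart-∑ 1 k (strips λ') (λ p → indicator (proj₁ p ≡ᵇ a)) (λ p α → natK K (Kr α (proj₂ p))) ⟩
      ∑ (strips λ') (λ p → indicator (proj₁ p ≡ᵇ a) * hookPart 1 k (λ α → natK K (Kr α (proj₂ p))))
        ≈⟨ ∑-congAll (All.map (λ {p} dν → trans (*-congˡ (hookPart-Kr 1 k (proj₂ p) ℕ.≤-refl dν)) (both (proj₁ p ≡ᵇ a) (isHook 1 k (proj₂ p)))) (strips-Dec d)) ⟩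
      ∑ (strips λ') (λ p → natK K (Counts._▹_ ((proj₁ p ≡ᵇ a) ∧ isHook 1 k (proj₂ p)) 1))
        ≈⟨ natK-∑ (strips λ') (λ p → Counts._▹_ ((proj₁ p ≡ᵇ a) ∧ isHook 1 k (proj₂ p)) 1) ⟨
      natK K (Counts.∑ (strips λ') (λ p → Counts._▹_ ((proj₁ p ≡ᵇ a) ∧ isHook 1 k (proj₂ p)) 1))
        ≡⟨ cong (natK K) (pieri a k λ' 1≤a d) ⟩
      natK K (Counts._▹_ (isHook a (suc k) λ') 1 ℕ.+ Counts._▹_ (isHook (suc a) k λ') 1)
        ≈⟨ trans (natK-+ (Counts._▹_ (isHook a (suc k) λ') 1) _) (+-cong (natK-indicator (isHook a (suc k) λ')) (natK-indicator (isHook (suc a) k λ'))) ⟩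
      indicator (isHook a (suc k) λ') + indicator (isHook (suc a) k λ') ∎
      where
      both : ∀ b b′ → indicator b * indicator b′ ≈ natK K (Counts._▹_ (b ∧ b′) 1)
      both true  b′ = trans (*-identityˡ _) (sym (natK-indicator b′))
      both false b′ = zeroˡ _

  hook-∈ : ∀ a k → 1 ≤ a → a ∷ replicate k 1 ∈ Partitions (a ℕ.+ k)
  hook-∈ a k 1≤a = subst (λ s → a ∷ replicate k 1 ∈ Partitions (a ℕ.+ s)) (ones k)
    (partition-∈ (ℕ.≤-refl ∷ Dec-weaken 1≤a (decr k)) (1≤a ∷ All.replicate⁺ k (s≤s z≤n)))
    where
    ones : ∀ k → sumℕ (replicate k 1) ≡ k
    ones zero    = ≡.refl
    ones (suc k) = cong suc (ones k)
    decr : ∀ k → Dec 1 (replicate k 1)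
    decr zero    = []
    decr (suc k) = ℕ.≤-refl ∷ decr k

  pick-hook : ∀ a k n (cs : List ℕ → Carrier) → 1 ≤ a → a ℕ.+ k ≡ n →
              ∑ (Partitions n) (λ λ' → cs λ' * indicator (isHook a k λ')) ≈ cs (a ∷ replicate k 1)
  pick-hook a k n cs 1≤a ≡.refl = trans
    (∑-pick _ (Partitions-unique n) (hook-∈ a k 1≤a) (λ {λ'} λ∈ ne → trans (*-congˡ (▹-false (isHook a k λ')
      (λ t → ⊥-elim (ne (isHook-sound a k λ' (positive (∈-partition n λ∈)) t))))) (zeroʳ _)))
    (trans (*-congˡ (reflexive (cong indicator (isHook-refl a k)))) (*-identityʳ _))

  -- `IsExpansion` speaks of partitions only, whereas `hookPart` evaluates f at unsorted
  -- compositions. The invariance of f under sorting bridges this, matched on the Schur side by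
  -- `Kr-↭`.
  schur-hook : ∀ n a k {f cs} → 1 ≤ a → a ℕ.+ k ≡ n → (∀ {α} → All (0 <_) α → f (toPartition α) ≈ f α) →
               IsExpansion K n (schurF K) f cs → cs (a ∷ replicate k 1) ≈ hookPart a k f
  schur-hook n a k {f} {cs} 1≤a a+k≡n sf ex = sym (begin
    hookPart a k f
      ≈⟨ hookPart-cong a k 1≤a (λ α p s → extended α p (≡.trans s a+k≡n)) ⟩
    hookPart a k (λ α → ∑ (Partitions n) (λ λ' → cs λ' * natK K (Kr α λ')))
      ≈⟨ hookPart-∑ a k (Partitions n) cs (λ λ' α → natK K (Kr α λ')) ⟩
    ∑ (Partitions n) (λ λ' → cs λ' * hookPart a k (λ α → natK K (Kr α λ')))
      ≈⟨ ∑-congAll (All.map (λ {λ'} p → *-congˡ (hookPart-Kr a k λ' 1≤a (dec p))) (pars-sound n n n)) ⟩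
    ∑ (Partitions n) (λ λ' → cs λ' * indicator (isHook a k λ'))
      ≈⟨ pick-hook a k n cs 1≤a a+k≡n ⟩
    cs (a ∷ replicate k 1) ∎)
    where
    extended : ∀ α → All (0 <_) α → sumℕ α ≡ n → f α ≈ ∑ (Partitions n) (λ λ' → cs λ' * natK K (Kr α λ'))
    extended α p ≡.refl = trans (sym (sf p)) (trans (ex (toPartition α) (toPartition-∈ α)) (∑-cong∈ (Partitions n) (λ {λ'} λ∈ →
      *-congˡ (trans (schur≈Kr n (toPartition α) λ∈) (reflexive (cong (natK K) (Kr-↭ (toPartition-↭ p) λ')))))))

  -- Only the sorted content (n) is evaluated, which gives the statement for arbitrary f as (a)
  -- requires.
  schur-row : ∀ n {f cs} → IsExpansion K n (schurF K) f cs → cs (rowP n) ≈ f (rowP n)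
  schur-row zero    {f} {cs} ex = sym (trans (ex [] (here ≡.refl)) (trans (+-identityʳ _) (trans (*-congˡ natK-1) (*-identityʳ _))))
  schur-row (suc n) {f} {cs} ex = sym (begin
    f (suc n ∷ [])
      ≈⟨ ex (suc n ∷ []) (row-∈ (suc n)) ⟩
    ∑ (Partitions (suc n)) (λ λ' → cs λ' * schurF K λ' (suc n ∷ []))
      ≈⟨ ∑-cong∈ (Partitions (suc n)) (λ {λ'} λ∈ → *-congˡ (trans (schur≈Kr (suc n) (suc n ∷ []) λ∈)
           (hookPart-Kr (suc n) 0 λ' (s≤s z≤n) (dec (∈-partition (suc n) λ∈))))) ⟩
    ∑ (Partitions (suc n)) (λ λ' → cs λ' * indicator (isHook (suc n) 0 λ'))
      ≈⟨ pick-hook (suc n) 0 (suc n) cs (s≤s z≤n) (ℕ.+-identityʳ _) ⟩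
    cs (suc n ∷ []) ∎)

-- In one variable every h_m is a single monomial, so the coefficient of m_{(n)} in an h-expansion
-- is the sum of its coefficients.
row-hCoeff : ∀ λ' {n} → sumℕ λ' ≡ n → hCoeff λ' (rowP n) ≡ 1
row-hCoeff λ' {n} e = ≡.trans (drop n) (≡.trans (cong (λ s → hCoeff λ' (s ∷ [])) (≡.sym e)) (single λ'))
  where
  drop : ∀ n → hCoeff λ' (rowP n) ≡ hCoeff λ' (n ∷ [])
  drop zero    = ≡.sym (hCoeff-∷0 λ' [])
  drop (suc n) = ≡.refl
  take : ∀ m s (g : List ℕ → ℕ) → Counts.∑ (hs (m ℕ.+ s ∷ []) m) g ≡ g (s ∷ [])
  take zero    s g = HOps.hs-0 ℕ.+-*-commutativeSemiring (s ∷ []) g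
  take (suc m) s g = take m s g
  single : ∀ λ' → hCoeff λ' (sumℕ λ' ∷ []) ≡ 1
  single []       = ≡.refl
  single (m ∷ λ') = ≡.trans (hCoeff-∷ m λ' (m ℕ.+ sumℕ λ' ∷ [])) (≡.trans (take m (sumℕ λ') (hCoeff λ')) (single λ'))

-- Row, column and hook coefficients of R, its values at 1^k, and the quotient series

module Assembly {c ℓ : Level} (K : CommutativeRing c ℓ) (fld : IsField K) (ch0 : CharZero K) (F : Series K)
                (F-0 : CommutativeRing._≈_ K (F 0) (CommutativeRing.1# K)) where
  open CommutativeRing K hiding (zero)
  open import Relation.Binary.Reasoning.Setoid setoid
  open import Algebra.Properties.Ring ring using (-‿distribˡ-*; -1*x≈-x)
  open Sums commutativeSemiring
  open StripSums commutativeSemiring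
  open OverRing K
  open Series K
  open HPolynomials K F F-0 using (R; R-toPartition)
  open HExpansions K fld ch0 F F-0 using (h-expansion)
  open SchurExpansions K

  partA : PartA K fld ch0 F
  partA = (λ n → schur-expansion n (Rsym K F n) , λ cs ex → trans (schur-row n ex) (R-row n)) ,
          (λ n f → schur-expansion n f , h-expansion n f , λ cs ch exs exh → trans (schur-row n exs) (h-sum n f ch exh))
    where
    R-row : ∀ n → R (rowP n) ≈ F n
    R-row zero    = sym F-0
    R-row (suc n) = *-identityʳ _
    h-sum : ∀ n f ch → IsExpansion K n (hF K) f ch → f (rowP n) ≈ Σl K (Partitions n) ch
    h-sum n f ch ex = trans (ex (rowP n) (row-∈ n)) (∑-congAll (All.map (λ {λ'} p →
      trans (*-congˡ (trans (reflexive (cong (natK K) (row-hCoeff λ' (size p)))) natK-1)) (*-identityʳ _)) (pars-sound n n n)))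

  s : ℕ → ℕ → Carrier
  s a k = hookPart a k R

  -- The coefficient of s_{1^n} in R_n; the shift arises because (1, 1^k) has k + 1 boxes.
  e : ℕ → Carrier
  e zero    = 1#
  e (suc k) = s 1 k

  -- R is multiplicative, so F a factors out of the values at contents beginning with a, and the
  -- recursion of `hookPart` becomes the Pieri identity.
  F*e : ∀ a k → F a * e (suc k) ≈ s a (suc k) + s (suc a) k
  F*e a k = sym (trans (x-y+y≈x _ _) (hookPart-* 1 k (F a) R))

  negT-⊛-e : ∀ n → (negT K F ⊛ e) n ≈ oneS K n
  negT-⊛-e zero    = trans (*-identityʳ _) (trans (*-identityˡ _) F-0)
  negT-⊛-e (suc k) = begin
    1# * F 0 * e (suc k) + ∑⊕ k (λ i j → - sgnK K i * F (suc i) * e j)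
      ≈⟨ +-cong (trans (*-congʳ (trans (*-identityˡ _) F-0)) (*-identityˡ _))
           (trans (∑⊕-cong k (λ i j _ → trans (*-assoc _ _ _) (trans (sym (-‿distribˡ-* _ _)) (sym (-1*x≈-x _))))) (∑⊕-*ˡ (- 1#) k _)) ⟩
    e (suc k) + - 1# * ∑⊕ k (λ i j → sgnK K i * (F (suc i) * e j))
      -- The telescoping sum returns `s 1 k`, which is `e (suc k)` by definition.
      ≈⟨ +-congˡ (trans (-1*x≈-x _) (-‿cong (alternating k (λ i j → F (suc i) * e j) (λ i j → s (suc i) j) (λ i → refl) (λ i j → F*e (suc i) j)))) ⟩
    e (suc k) - e (suc k)
      ≈⟨ -‿inverseʳ _ ⟩
    0# ∎

  R-hook : ∀ n a k {cs} → 1 ≤ a → a ℕ.+ k ≡ n → IsExpansion K n (schurF K) (Rsym K F n) cs → cs (a ∷ replicate k 1) ≈ s a k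
  R-hook n a k 1≤a a+k≡n = schur-hook n a k 1≤a a+k≡n (λ {α} _ → R-toPartition α)

  partB : PartB K fld ch0 F
  partB = (λ n → schur-expansion n (Rsym K F n)) , λ cs ex n → trans (⋆≈⊛ _ (negT K F) n)
      (trans (⊛-cong n (λ m _ → column cs ex m) (λ _ _ → refl)) (trans (⊛-comm e (negT K F) n) (negT-⊛-e n)))
    where
    column : ∀ (cs : ℕ → List ℕ → Carrier) → (∀ n → IsExpansion K n (schurF K) (Rsym K F n) (cs n)) → ∀ m → cs m (replicate m 1) ≈ e m
    column cs ex zero    = schur-row 0 {R} {cs 0} (ex 0)
    column cs ex (suc k) = R-hook (suc k) 1 k ℕ.≤-refl ≡.refl (ex (suc k))

  partE : PartE K fld ch0 F
  partE k n = trans (∑-cong (comps n k) R-toPartition) (go k n)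
    where
    go : ∀ k n → ∑ (comps n k) R ≈ powS K F k n
    go zero    zero    = +-identityʳ _
    go zero    (suc n) = refl
    go (suc k) n       = begin
      ∑ (comps n (suc k)) R
        ≡⟨ cong (λ L → ∑ L R) (comps-suc n k) ⟩
      ∑ (concatMap (λ j → map (j ∷_) (comps (n ∸ j) k)) (upTo (suc n))) R
        ≈⟨ ∑-concatMap (λ j → map (j ∷_) (comps (n ∸ j) k)) (upTo (suc n)) R ⟩
      ∑ (upTo (suc n)) (λ j → ∑ (map (j ∷_) (comps (n ∸ j) k)) R)
        ≈⟨ ∑-cong (upTo (suc n)) (λ j → trans (reflexive (∑-map (j ∷_) (comps (n ∸ j) k) R))
             (trans (∑-*ˡ (F j) (comps (n ∸ j) k) R) (*-congˡ (go k (n ∸ j))))) ⟩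
      powS K F (suc k) n ∎

  -- F(-ut) contains only the powers (ut)^i, so a single term of the inner sum survives; the guard
  -- records that i ≤ j.
  negUT-⋆₂ : ∀ P n j → _⋆₂_ K (negUT K F) P n j ≈ ∑ (upTo (suc n)) (λ i → (i <ᵇ suc j) ▹ (negT K F i * P (n ∸ i) (j ∸ i)))
  negUT-⋆₂ P n j = ∑-cong (upTo (suc n)) inner
    where
    upTo-unique : AllPairs _≢_ (upTo (suc j))
    upTo-unique = AllPairs.applyUpTo⁺₁ id (suc j) (λ i<k _ → ℕ.<⇒≢ i<k)
    term : ℕ → ℕ → Carrier
    term i l = negUT K F i l * P (n ∸ i) (j ∸ l)
    off : ∀ i l → l ≢ i → term i l ≈ 0#
    off i l ne = trans (*-congʳ (reflexive (cong (_▹ (sgnK K i * F i)) (≢⇒≡ᵇ {i} {l} (λ eq → ne (≡.sym eq)))))) (zeroˡ _)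
    inner : ∀ i → ∑ (upTo (suc j)) (term i) ≈ (i <ᵇ suc j) ▹ (negT K F i * P (n ∸ i) (j ∸ i))
    inner i with i ℕ.<? suc j
    ... | yes i<j = trans (∑-pick (term i) upTo-unique (∈-upTo⁺ i<j) (λ {l} _ ne → off i l ne))
      (trans (*-congʳ (reflexive (cong (_▹ (sgnK K i * F i)) (≡ᵇ-refl i))))
             (reflexive (cong (_▹ (negT K F i * P (n ∸ i) (j ∸ i))) (≡.sym (T-ext {i <ᵇ suc j} {true} (λ _ → tt) (λ _ → ℕ.<⇒<ᵇ i<j))))))
    ... | no i≮j = trans (∑-upTo-cong (suc j) (λ l l<j → off i l (λ { ≡.refl → i≮j l<j })))
      (trans (∑-zero (upTo (suc j))) (sym (▹-false (i <ᵇ suc j) (λ t → ⊥-elim (i≮j (ℕ.<ᵇ⇒< i (suc j) t))))))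

  -- The coefficients of F(t) E(ut). Beyond j = n the truncated subtraction would yield F 0, so the
  -- guard sets these coefficients to 0.
  P₀ : Series2 K
  P₀ n j = (j <ᵇ suc n) ▹ (e j * F (n ∸ j))

  P₀-inside : ∀ {n j} → j ≤ n → P₀ n j ≈ e j * F (n ∸ j)
  P₀-inside {n} {j} j≤n = reflexive (cong (_▹ (e j * F (n ∸ j))) (T-ext {j <ᵇ suc n} {true} (λ _ → tt) (λ _ → ℕ.<⇒<ᵇ (s≤s j≤n))))

  P₀-outside : ∀ {n j} → n < j → P₀ n j ≈ 0#
  P₀-outside {n} {j} n<j = ▹-false (j <ᵇ suc n) (λ t → ⊥-elim (ℕ.<⇒≱ n<j (ℕ.≤-pred (ℕ.<ᵇ⇒< j (suc n) t))))

  P₀-quotient : IsQuotient K fld ch0 F P₀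
  P₀-quotient n j = trans (negUT-⋆₂ P₀ n j) (go (ℕ.≤-<-connex j n))
    where
    T′ : ℕ → Carrier
    T′ i = negT K F i * P₀ (n ∸ i) (j ∸ i)
    one : ∀ j → oneS K j * F (n ∸ j) ≈ inT K F n j
    one zero    = *-identityˡ _
    one (suc j) = zeroˡ _
    outside : ∀ j → n < j → inT K F n j ≈ 0#
    outside (suc j) _ = refl
    go : j ≤ n ⊎ n < j → ∑ (upTo (suc n)) (λ i → (i <ᵇ suc j) ▹ T′ i) ≈ inT K F n j
    go (inj₁ j≤n) = begin
      ∑ (upTo (suc n)) (λ i → (i <ᵇ suc j) ▹ T′ i)
        ≈⟨ ∑-upTo-extend (s≤s j≤n) T′ ⟨
      ∑ (upTo (suc j)) T′
        ≈⟨ ∑-upTo-cong (suc j) (λ { i (s≤s i≤j) → trans (*-congˡ (trans (P₀-inside (ℕ.∸-monoˡ-≤ i j≤n))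
             (*-congˡ (reflexive (cong F (cancel i i≤j)))))) (sym (*-assoc _ _ _)) }) ⟩
      ∑ (upTo (suc j)) (λ i → negT K F i * e (j ∸ i) * F (n ∸ j))
        ≈⟨ ∑-*ʳ (F (n ∸ j)) (upTo (suc j)) _ ⟩
      ∑ (upTo (suc j)) (λ i → negT K F i * e (j ∸ i)) * F (n ∸ j)
        ≈⟨ *-congʳ (trans (∑-upTo-⊕ j (λ i l → negT K F i * e l)) (negT-⊛-e j)) ⟩
      oneS K j * F (n ∸ j)
        ≈⟨ one j ⟩
      inT K F n j ∎
      where
      cancel : ∀ i → i ≤ j → n ∸ i ∸ (j ∸ i) ≡ n ∸ j
      cancel i i≤j = ≡.trans (ℕ.∸-+-assoc n i (j ∸ i)) (cong (n ∸_) (ℕ.m+[n∸m]≡n i≤j))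
    go (inj₂ n<j) = trans (∑-upTo-cong (suc n) (λ { i (s≤s i≤n) → ▹-false (i <ᵇ suc j) (λ _ →
      trans (*-congˡ (P₀-outside (ℕ.∸-monoˡ-< n<j i≤n))) (zeroʳ _)) })) (trans (∑-zero (upTo (suc n))) (sym (outside j n<j)))

  -- F(-ut) has constant term 1, so the coefficients of t^n in the quotient are determined by those
  -- of lower powers of t.
  quotient-unique : ∀ P P′ → IsQuotient K fld ch0 F P → IsQuotient K fld ch0 F P′ → ∀ n j → P n j ≈ P′ n j
  quotient-unique P P′ q q′ n = below (suc n) n ℕ.≤-refl
    where
    rest : Series2 K → ℕ → ℕ → Carrier
    rest P n j = ∑ (upTo n) (λ i → (i <ᵇ j) ▹ (negT K F (suc i) * P (n ∸ suc i) (j ∸ suc i)))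
    split : ∀ P → IsQuotient K fld ch0 F P → ∀ n j → P n j + rest P n j ≈ inT K F n j
    split P q n j = trans (+-congʳ (sym (trans (*-congʳ (trans (*-identityˡ _) F-0)) (*-identityˡ _))))
      (trans (reflexive (≡.sym (∑-upTo-suc n (λ i → (i <ᵇ suc j) ▹ (negT K F i * P (n ∸ i) (j ∸ i))))))
      (trans (sym (negUT-⋆₂ P n j)) (q n j)))
    below : ∀ N n → n < N → ∀ j → P n j ≈ P′ n j
    below (suc N) n (s≤s n≤N) j = +-cancelʳ (rest P n j) (P n j) (P′ n j) (trans (split P q n j) (trans (sym (split P′ q′ n j)) (+-congˡ (sym same))))
      where
      open import Algebra.Properties.Group +-group using () renaming (∙-cancelʳ to +-cancelʳ)
      same : rest P n j ≈ rest P′ n j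
      same = ∑-upTo-cong n (λ i i<n → ▹-cong (i <ᵇ j) (λ _ → *-congˡ
        (below N (n ∸ suc i) (ℕ.<-≤-trans (ℕ.∸-monoʳ-< {n} {suc i} {0} (s≤s z≤n) i<n) n≤N) (j ∸ suc i))))

  partF : PartF K fld ch0 F
  partF = (P₀ , P₀-quotient) , λ P q n 1≤n →
    (λ j n<j → trans (quotient-unique P P₀ q P₀-quotient n j) (P₀-outside n<j)) ,
    schur-expansion n (Rsym K F n) ,
    λ cs ex j → trans (quotient-unique P P₀ q P₀-quotient n j) (hooks n 1≤n cs ex j)
    where
    module _ (n : ℕ) (1≤n : 1 ≤ n) (cs : List ℕ → Carrier) (ex : IsExpansion K n (schurF K) (Rsym K F n) cs) where
      q : ℕ → Carrier
      q = hookPoly K fld ch0 n cs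
      q-inside : ∀ {k} → k < n → q k ≈ s (n ∸ k) k
      q-inside {k} k<n = trans (reflexive (cong (_▹ cs (hook n k)) (T-ext {k <ᵇ n} {true} (λ _ → tt) (λ _ → ℕ.<⇒<ᵇ k<n))))
        (R-hook n (n ∸ k) k (ℕ.m<n⇒0<n∸m k<n) (ℕ.m∸n+n≡m (ℕ.<⇒≤ k<n)) ex)
      q-outside : ∀ {k} → n ≤ k → q k ≈ 0#
      q-outside {k} n≤k = ▹-false (k <ᵇ n) (λ t → ⊥-elim (ℕ.<⇒≱ (ℕ.<ᵇ⇒< k n t) n≤k))
      hooks : ∀ j → P₀ n j ≈ onePlusU K q j
      hooks zero = trans (P₀-inside z≤n) (trans (*-comm _ _) (sym (q-inside 1≤n)))
      hooks (suc j) with ℕ.<-cmp (suc j) n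
      ... | tri< j+1<n _ _ = begin
        P₀ n (suc j) ≈⟨ P₀-inside (ℕ.<⇒≤ j+1<n) ⟩
        e (suc j) * F (n ∸ suc j) ≈⟨ trans (*-comm _ _) (F*e (n ∸ suc j) j) ⟩
        -- The two hooks of the Pieri identity have n boxes each and are consecutive coefficients of
        -- `hookPoly`; this is where the factor 1 + u comes from.
        s (n ∸ suc j) (suc j) + s (suc (n ∸ suc j)) j ≈⟨ +-cong (sym (q-inside j+1<n)) (trans (reflexive (cong (λ a → s a j) (≡.sym (ℕ.+-∸-assoc 1 (ℕ.<⇒≤ j+1<n))))) (sym (q-inside (ℕ.<⇒≤ j+1<n)))) ⟩
        q (suc j) + q j ∎
      -- Here the first index of the Pieri identity would be 0. The factor is F 0 = 1, the hook (1,
      -- 1^j) alone remains, and `hookPoly` is already 0 at n.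
      ... | tri≈ _ ≡.refl _ = begin
        P₀ n n ≈⟨ P₀-inside (ℕ.≤-refl {n}) ⟩
        e n * F (n ∸ n) ≈⟨ trans (*-congˡ (trans (reflexive (cong F (ℕ.n∸n≡0 n))) F-0)) (*-identityʳ _) ⟩
        s 1 j ≈⟨ +-identityˡ _ ⟨
        0# + s 1 j ≈⟨ +-cong (q-outside ℕ.≤-refl) (trans (q-inside {j} ℕ.≤-refl) (reflexive (cong (λ a → s a j) (ℕ.m+n∸n≡m 1 j)))) ⟨
        q n + q j ∎
      ... | tri> _ _ (s≤s n≤j) = trans (P₀-outside (s≤s n≤j)) (sym (trans (+-cong (q-outside (ℕ.m≤n⇒m≤1+n n≤j)) (q-outside n≤j)) (+-identityˡ _)))

theorem2p7 : ∀ {c ℓ : Level} (K : CommutativeRing c ℓ)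
    (fld : IsField K) (ch0 : CharZero K) (F : Series K) →
    CommutativeRing._≈_ K (F 0) (CommutativeRing.1# K) →
    PartA K fld ch0 F × PartB K fld ch0 F × PartC K fld ch0 F
    × PartD K fld ch0 F × PartE K fld ch0 F × PartF K fld ch0 F
theorem2p7 K fld ch0 F F-0 = partA , partB , partC , partD , partE , partF
  where
  open Assembly K fld ch0 F F-0
  open HExpansions K fld ch0 F F-0 using (partC; partD)
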